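{- Let $r$ be a positive integer, $p \equiv 3 \pmod 4$ a prime, and $q=p^{4r}$. Let $g$ be a primitive root of $\mathbb{F}_q$ and let $$B=\{g^{4k}:1 \leq k \leq (q-1)/4\} \cup \{g^{4k+3}:1 \leq k \leq (q-1)/4\}.$$ Let $I=\{x^{p^r}-x: x \in \mathbb{F}_q\}$. If $h \in \mathbb{F}_q \setminus \mathbb{F}_{p^r}$, then $\mathbb{F}_{p^r} \oplus h\mathbb{F}_{p^r}=\{x+hy: x,y\in\mathbb{F}_{p^r}\}$ forms a (maximum) clique in the Peisert graph $P_q^*$ (constructed with $g$) if and only if $I \cap h^{ -1} I \cap B=\emptyset$.
   Context: The Peisert graph $P_q^*$ (for $q=p^{2s}$, $p\equiv 3\pmod 4$, with primitive root $g$) has vertex set $\mathbb{F}_q$, two distinct vertices being adjacent iff their difference lies in $\{g^j: j \equiv 0,1 \pmod 4\}$. $h^{ -1}I=\{h^{ -1}x: x\in I\}$. -}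

module Defs where

open import Level using (Level; _⊔_) renaming (suc to lsuc)
open import Algebra.Bundles using (CommutativeRing)
open import Data.Fin.Base using (Fin)
open import Data.Nat.Base as ℕ using (ℕ)
open import Data.Nat.DivMod using (_%_; _/_)
open import Data.Product.Base using (Σ; ∃; _×_; proj₁)
open import Data.Sum.Base using (_⊎_)
open import Function.Bundles using (Inverse)
open import Relation.Binary.Bundles using (Setoid)
open import Relation.Binary.Core using (Rel)
open import Relation.Binary.Definitions using (_Respects_)
open import Relation.Binary.PropositionalEquality.Core using (_≡_)
import Relation.Binary.PropositionalEquality.Properties as ≡
import Relation.Binary.Construct.On as On
open import Relation.Nullary.Negation.Core using (¬_)
open import Relation.Unary using (Pred; _∈_; _∪_)

-- The value of 0# ⁻¹ is left unspecified.
record Field (c ℓ : Level) : Set (lsuc (c ⊔ ℓ)) where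
  infix 9 _⁻¹
  field
    commutativeRing : CommutativeRing c ℓ
  open CommutativeRing commutativeRing public
  field
    _⁻¹        : Carrier → Carrier
    ⁻¹-cong    : ∀ {x y} → x ≈ y → x ⁻¹ ≈ y ⁻¹
    *-inverseʳ : ∀ x → ¬ (x ≈ 0#) → x * x ⁻¹ ≈ 1#
    1≉0        : ¬ (1# ≈ 0#)
  open import Algebra.Properties.Semiring.Exp semiring public using (_^_)

HasCardinality : ∀ {a ℓ} → Setoid a ℓ → ℕ → Set (a ⊔ ℓ)
HasCardinality S n = Inverse S (≡.setoid (Fin n))

module _ {a ℓ} (S : Setoid a ℓ) where
  open Setoid S

  subsetoid : ∀ {p} → Pred Carrier p → Setoid (a ⊔ p) ℓ
  subsetoid P = On.setoid S (proj₁ {B = P})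

  -- Both orders of each pair x, y are required to be adjacent, so the notion
  -- is the usual one when Adj is the adjacency relation of an undirected graph.
  IsClique : ∀ {e p} → Rel Carrier e → Pred Carrier p → Set (a ⊔ ℓ ⊔ e ⊔ p)
  IsClique Adj P = ∀ {x y} → x ∈ P → y ∈ P → ¬ (x ≈ y) → Adj x y

  -- A clique whose number of elements is largest among all finite cliques.
  IsMaximumClique : ∀ {e p} → Rel Carrier e → Pred Carrier p →
                    Set (a ⊔ ℓ ⊔ e ⊔ lsuc p)
  IsMaximumClique {p = p} Adj P =
    IsClique Adj P ×
    Σ ℕ λ m → HasCardinality (subsetoid P) m ×
      (∀ (Q : Pred Carrier p) n → IsClique Adj Q →
         HasCardinality (subsetoid Q) n → n ℕ.≤ m)

module _ {c ℓ} (F : Field c ℓ) where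
  open Field F

  record IsSubfield {k} (K : Pred Carrier k) : Set (c ⊔ ℓ ⊔ k) where
    field
      resp       : K Respects _≈_
      0∈         : 0# ∈ K
      1∈         : 1# ∈ K
      +-closed   : ∀ {x y} → x ∈ K → y ∈ K → x + y ∈ K
      neg-closed : ∀ {x} → x ∈ K → - x ∈ K
      *-closed   : ∀ {x y} → x ∈ K → y ∈ K → x * y ∈ K
      ⁻¹-closed  : ∀ {x} → ¬ (x ≈ 0#) → x ∈ K → x ⁻¹ ∈ K

  -- A finite field of order pⁿ has exactly one subfield of order pᵐ for each
  -- m ∣ n, so this pins down the subfield 𝔽_{pᵐ}.
  IsSubfieldOfOrder : ∀ {k} → Pred Carrier k → ℕ → Set (c ⊔ ℓ ⊔ k)
  IsSubfieldOfOrder K n = IsSubfield K × HasCardinality (subsetoid setoid K) n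

  -- A generator of the multiplicative group. Natural exponents suffice when
  -- F is finite.
  IsPrimitiveRoot : Carrier → Set (c ⊔ ℓ)
  IsPrimitiveRoot g = ¬ (g ≈ 0#) × (∀ x → ¬ (x ≈ 0#) → ∃ λ (j : ℕ) → x ≈ g ^ j)

  PeisertSet : Carrier → Pred Carrier ℓ
  PeisertSet g x = ∃ λ (j : ℕ) → (j % 4 ≡ 0 ⊎ j % 4 ≡ 1) × x ≈ g ^ j

  PeisertAdj : Carrier → Rel Carrier ℓ
  PeisertAdj g x y = ¬ (x ≈ y) × (x - y) ∈ PeisertSet g

  setB : ℕ → Carrier → Pred Carrier ℓ
  setB q g = powers 0 ∪ powers 3
    where
    powers : ℕ → Pred Carrier ℓ
    powers i x = ∃ λ (k : ℕ) → 1 ℕ.≤ k × k ℕ.≤ (q ℕ.∸ 1) / 4 × x ≈ g ^ (4 ℕ.* k ℕ.+ i)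

  -- The image of x ↦ xⁿ - x.
  setI : ℕ → Pred Carrier (c ⊔ ℓ)
  setI n z = ∃ λ x → z ≈ x ^ n - x

  scale : ∀ {p} → Carrier → Pred Carrier p → Pred Carrier (c ⊔ ℓ ⊔ p)
  scale a P z = ∃ λ x → x ∈ P × z ≈ a * x

  -- K ⊕ hK as a set of elements of F.
  span : ∀ {k} → Pred Carrier k → Carrier → Pred Carrier (c ⊔ ℓ ⊔ k)
  span K h z = ∃ λ x → ∃ λ y → x ∈ K × y ∈ K × z ≈ x + h * y

{-# OPTIONS --safe #-}
module Submission where

open import Defs
open import Algebra.Bundles using (CommutativeMonoid)
import Algebra.Properties.CommutativeMonoid.Sum
import Algebra.Properties.Semiring.Sum
open import Data.Empty using (⊥-elim)
open import Data.Fin.Base as Fin using (Fin; zero; suc; toℕ; fromℕ; inject₁; punchIn; combine; remQuot)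
open import Data.Fin.Permutation using (Permutation′; permutation; _⟨$⟩ʳ_)
open import Data.Fin.Properties as Fin using (punchInᵢ≢i; toℕ-fromℕ; toℕ-inject₁; toℕ<n; remQuot-combine; combine-remQuot)
open import Data.Integer.Base as ℤ using (ℤ; 0ℤ; 1ℤ)
import Data.Integer.Properties as ℤ
open import Data.Integer.Solver using () renaming (module +-*-Solver to ℤ-Solver)
open import Data.Nat.Base as ℕ using (ℕ; zero; suc; _!; NonZero; s≤s; z≤n)
open import Data.Nat.Combinatorics using (_C_; nCk≡n!/k![n-k]!; k![n∸k]!∣n!; nCn≡1)
open import Data.Nat.Coprimality using (prime⇒coprime; coprime-Bézout)
open import Data.Nat.DivMod using (_%_; _/_; m%n<n; m%n≤n; m/n*n≡m; m≡m%n+[m/n]*n; [m+kn]%n≡m%n; %-distribˡ-+)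
open import Data.Nat.Divisibility
  using (_∣_; _∤_; divides; ∣⇒≤; ∣1⇒≡1; ∣-trans; m∣m*n; ∣m⇒∣m*n; ∣n⇒∣m*n; ∣m+n∣m⇒∣n; m%n≡0⇒n∣m; *-cancelˡ-∣)
open import Data.Nat.GCD using (module Bézout)
open import Data.Nat.Primality using (Prime; ¬prime[0]; euclidsLemma; prime⇒nonZero; prime⇒nonTrivial)
import Data.Nat.Properties as ℕ
open import Data.Nat.Solver using () renaming (module +-*-Solver to ℕ-Solver)
open import Data.Product.Base using (Σ; ∃; _×_; _,_; proj₁; proj₂)
open import Data.Sum.Base using (_⊎_; inj₁; inj₂; [_,_]′)
open import Data.Unit.Base using (⊤; tt)
open import Function.Base using (_∘_; _$_; case_of_)
open import Function.Bundles using (Inverse; _⇔_; mk⇔)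
open import Level using (Level; _⊔_)
open import Relation.Binary.Definitions using (_Respects_)
open import Relation.Binary.PropositionalEquality as ≡ using (_≡_; _≢_; cong; cong₂)
open import Relation.Nullary using (¬_; Dec; yes; no; contradiction)
open import Relation.Nullary.Decidable using (map′; ¬?; _→-dec_; _×-dec_)
open import Relation.Unary using (Pred; Decidable; _∉_; _∩_; Empty)
import Algebra.Properties.AbelianGroup ℤ.+-0-abelianGroup as ℤ+
import Algebra.Properties.Semiring.Sum ℤ.+-*-semiring as ∑ℤ

-- Let T be the trace to 𝔽_p and φ(t) = p[t = 0] - 1 the sum of the nontrivial
-- additive characters of 𝔽_p. For the trace form K⊥ = I, hence V⊥ = I ∩ h⁻¹I.
--
-- If a is not a (p+1)-th power, then S = Σ_y φ(T(a yᵖ⁺¹)) is the sum of a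
-- nondegenerate quadratic form, which gives S² = (p-1)² q; the sign follows from
-- S ≡ p - 1 (mod p² - 1), so that S = (p-1)√q. Since 4 divides p + 1, for a union A
-- of two adjacent quartic classes Σ_{x ∈ A} φ(T(ux)) is (p-1)(√q-1)/2 if u⁻¹ ∉ A,
-- and -(p-1)(√q+1)/2 if u⁻¹ ∈ A.
--
-- Let U be a subgroup of order √q. If U⊥ ∩ A = ∅, then
-- Σ_{u ∈ U} Σ_{x ∈ A} φ(T(ux)) = 0 by orthogonality, and comparing with these values
-- forces u⁻¹ ∈ A for every nonzero u ∈ U. The two directions of the theorem are the
-- cases U = V⊥, with A the non-neighbours of 0, and U = V, with A = B.

-- Taking φ in place of complex characters keeps every sum in ℤ. The price is multiplicativity; its
-- substitute on 𝔽_p is Σ_{i<p} φ(t + iz) = (φ(z) + 1) φ(t), which yields both orthogonality and the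
-- formula for S². The exponent p + 1 serves two purposes: its powers are fourth powers, so that
-- multiplying by them preserves A, and every nonzero element of 𝔽_p is such a power. The form T(a
-- yᵖ⁺¹) can only degenerate if b = a uᵖ⁺¹ satisfies bᵖ = -b for some u ≠ 0. Then b, and with it a,
-- is a (p+1)-th power, because 2(p² - 1) divides q - 1. Averaging the sum over A along x ↦ yᵖ⁺¹x
-- reduces it to sums S for a = ux. If u⁻¹ ∉ A, no such ux is a (p+1)-th power and all these sums
-- are known. If u⁻¹ ∈ A, the value is read off from the complementary pair of classes. The forcing
-- is a count. With Q = √q and w the number of nonzero u ∈ U such that u⁻¹ ∉ A, the vanishing of the
-- total reads 2Qw = (Q + 1)(|U| - Q), so |U| ≤ Q gives w = 0.

private variable
  ℓ₁ ℓ₂ : Level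

-- Finite sums of integers and indicator values.

module _ (M : CommutativeMonoid ℓ₁ ℓ₂) where
  open CommutativeMonoid M
  open import Algebra.Properties.CommutativeMonoid.Sum M

  sum-single : ∀ {n} (t : Fin n → Carrier) i → (∀ j → j ≢ i → t j ≈ ε) → sum t ≈ t i
  sum-single {suc n} t i t≈ε = trans (sum-remove {i = i} t) $ trans
    (∙-congˡ (trans (sum-cong-≋ λ j → t≈ε (punchIn i j) (punchInᵢ≢i i j)) (sum-replicate-zero n)))
    (identityʳ (t i))

module _ where
  open ∑ℤ using (sum)

  sumℤ-single : ∀ {n} (t : Fin n → ℤ) i → (∀ j → j ≢ i → t j ≡ 0ℤ) → sum t ≡ t i
  sumℤ-single = sum-single ℤ.+-0-commutativeMonoid

  sumℤ-zero : ∀ {n} (t : Fin n → ℤ) → (∀ j → t j ≡ 0ℤ) → sum t ≡ 0ℤ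
  sumℤ-zero {n} t t≡0 = ≡.trans (∑ℤ.sum-cong-≋ t≡0) (∑ℤ.sum-replicate-zero n)

  sumℤ-const : ∀ n c → sum {n} (λ _ → c) ≡ ℤ.+ n ℤ.* c
  sumℤ-const zero    c = ≡.sym (ℤ.*-zeroˡ c)
  sumℤ-const (suc n) c = ≡.trans (cong (λ z → c ℤ.+ z) (sumℤ-const n c)) (≡.sym (ℤ.suc-* (ℤ.+ n) c))

  sumℤ-nonneg : ∀ {n} (t : Fin n → ℤ) → (∀ i → 0ℤ ℤ.≤ t i) → 0ℤ ℤ.≤ sum t
  sumℤ-nonneg {zero}  t 0≤t = ℤ.≤-refl
  sumℤ-nonneg {suc n} t 0≤t = ℤ.+-mono-≤ (0≤t zero) (sumℤ-nonneg (t ∘ suc) (0≤t ∘ suc))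

  sumℤ-nonneg-≤0 : ∀ {n} (t : Fin n → ℤ) → (∀ i → 0ℤ ℤ.≤ t i) → sum t ℤ.≤ 0ℤ → ∀ i → t i ≡ 0ℤ
  sumℤ-nonneg-≤0 {suc n} t 0≤t s≤0 i = ℤ.≤-antisym
    (ℤ.≤-trans (ℤ.≤-trans
      (≡.subst (ℤ._≤ t i ℤ.+ sum (λ j → t (punchIn i j))) (ℤ.+-identityʳ (t i))
        (ℤ.+-monoʳ-≤ (t i) (sumℤ-nonneg _ λ j → 0≤t (punchIn i j))))
      (ℤ.≤-reflexive (≡.sym (∑ℤ.sum-remove {i = i} t)))) s≤0)
    (0≤t i)

  sumℤ-splitAt : ∀ m {n} (f : ℕ → ℤ) →
    sum {m ℕ.+ n} (f ∘ toℕ) ≡ sum {m} (f ∘ toℕ) ℤ.+ sum {n} (λ i → f (m ℕ.+ toℕ i))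
  sumℤ-splitAt zero    f = ≡.sym (ℤ.+-identityˡ _)
  sumℤ-splitAt (suc m) f = ≡.trans (cong (λ z → f 0 ℤ.+ z) (sumℤ-splitAt m (f ∘ suc)))
    (≡.sym (ℤ.+-assoc (f 0) _ _))

  sumℤ-periodic : ∀ m L (f : ℕ → ℤ) → (∀ n → f (L ℕ.+ n) ≡ f n) →
    sum {m ℕ.* L} (f ∘ toℕ) ≡ ℤ.+ m ℤ.* sum {L} (f ∘ toℕ)
  sumℤ-periodic zero    L f f-per = ≡.sym (ℤ.*-zeroˡ (sum {L} (f ∘ toℕ)))
  sumℤ-periodic (suc m) L f f-per = begin
    sum {L ℕ.+ m ℕ.* L} (f ∘ toℕ)
      ≡⟨ sumℤ-splitAt L f ⟩
    sum {L} (f ∘ toℕ) ℤ.+ sum {m ℕ.* L} (λ i → f (L ℕ.+ toℕ i))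
      ≡⟨ cong (λ z → sum {L} (f ∘ toℕ) ℤ.+ z)
           (≡.trans (∑ℤ.sum-cong-≋ {m ℕ.* L} (λ i → f-per (toℕ i))) (sumℤ-periodic m L f f-per)) ⟩
    sum {L} (f ∘ toℕ) ℤ.+ ℤ.+ m ℤ.* sum {L} (f ∘ toℕ)
      ≡⟨ ℤ.suc-* (ℤ.+ m) (sum {L} (f ∘ toℕ)) ⟨
    ℤ.+ suc m ℤ.* sum {L} (f ∘ toℕ) ∎
    where open ≡.≡-Reasoning

ind : {P : Set ℓ₁} → Dec P → ℤ
ind (yes _) = 1ℤ
ind (no  _) = 0ℤ

ind-yes : {P : Set ℓ₁} (d : Dec P) → P → ind d ≡ 1ℤ
ind-yes (yes _) _  = ≡.refl
ind-yes (no ¬p) p = contradiction p ¬p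

ind-no : {P : Set ℓ₁} (d : Dec P) → ¬ P → ind d ≡ 0ℤ
ind-no (yes p) ¬p = contradiction p ¬p
ind-no (no _)  _  = ≡.refl

ind-⇔ : {P : Set ℓ₁} {Q : Set ℓ₂} (d : Dec P) (d′ : Dec Q) → (P → Q) → (Q → P) → ind d ≡ ind d′
ind-⇔ (yes p) d′ f g = ≡.sym (ind-yes d′ (f p))
ind-⇔ (no ¬p) d′ f g = ≡.sym (ind-no d′ (¬p ∘ g))

ind-nonneg : {P : Set ℓ₁} (d : Dec P) → 0ℤ ℤ.≤ ind d
ind-nonneg (yes _) = ℤ.+≤+ z≤n
ind-nonneg (no _)  = ℤ.≤-refl

-- Divisibility facts about natural numbers.

prime∤! : ∀ {p} → Prime p → ∀ k → k ℕ.< p → p ∤ k !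
prime∤! {p} pr zero    _   p∣1 = ℕ.nonTrivial⇒≢1 {{prime⇒nonTrivial pr}} (∣1⇒≡1 p∣1)
prime∤! {p} pr (suc k) k<p p∣k! with euclidsLemma (suc k) (k !) pr p∣k!
... | inj₁ p∣1+k = ℕ.<⇒≱ k<p (∣⇒≤ p∣1+k)
... | inj₂ p∣k   = prime∤! pr k (ℕ.<-trans (ℕ.n<1+n k) k<p) p∣k

-- In (p C k) · k! (p - k)! = p! the prime divides the right side but neither factorial on the left,
-- both having arguments below p.
prime∣C : ∀ {p} → Prime p → ∀ {k} → 0 ℕ.< k → k ℕ.< p → p ∣ p C k
prime∣C {p} pr {k} 0<k k<p with euclidsLemma (p C k) (k ! ℕ.* (p ℕ.∸ k) !) pr p∣C*
  where
  instance
    k!≢0 : NonZero (k ! ℕ.* (p ℕ.∸ k) !)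
    k!≢0 = ℕ.m*n≢0 (k !) ((p ℕ.∸ k) !) {{k ℕ.!≢0}} {{(p ℕ.∸ k) ℕ.!≢0}}
  eq : (p C k) ℕ.* (k ! ℕ.* (p ℕ.∸ k) !) ≡ p !
  eq = ≡.trans (cong (ℕ._* (k ! ℕ.* (p ℕ.∸ k) !)) (nCk≡n!/k![n-k]! (ℕ.<⇒≤ k<p)))
    (m/n*n≡m (k![n∸k]!∣n! (ℕ.<⇒≤ k<p)))
  p∣p! : ∀ n → .{{NonZero n}} → n ∣ n !
  p∣p! (suc n) = m∣m*n (n !)
  p∣C* : p ∣ (p C k) ℕ.* (k ! ℕ.* (p ℕ.∸ k) !)
  p∣C* = ≡.subst (p ∣_) (≡.sym eq) (p∣p! p {{prime⇒nonZero pr}})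
... | inj₁ p∣C = p∣C
... | inj₂ p∣k!* with euclidsLemma (k !) ((p ℕ.∸ k) !) pr p∣k!*
...   | inj₁ p∣k!  = contradiction p∣k! (prime∤! pr k k<p)
...   | inj₂ p∣k!′ = contradiction p∣k!′ (prime∤! pr (p ℕ.∸ k) (ℕ.∸-monoʳ-< 0<k (ℕ.<⇒≤ k<p)))

-- The cofactor t is kept as a witness: this is the source of the quotients `L`, `t` and `M` by
-- which q - 1 and √q - 1 are later factored.
1+^ : ∀ y n → ∃ λ t → suc y ℕ.^ n ≡ suc (y ℕ.* t)
1+^ y zero    = 0 , cong suc (≡.sym (ℕ.*-zeroʳ y))
1+^ y (suc n) with 1+^ y n
... | t , eq = t ℕ.+ suc (y ℕ.* t) , ≡.trans (cong (suc y ℕ.*_) eq) (cong suc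
  (≡.sym (ℕ.*-distribˡ-+ y t (suc (y ℕ.* t)))))

-- Fields: powers, additive maps, characteristic and Frobenius.

module FieldProperties {c ℓ} (F : Field c ℓ) where
  open Field F public
    renaming (_*_ to infixl 7 _·_; _+_ to infixl 6 _+_; _^_ to infixr 8 _^_) hiding (zero)
  open import Algebra.Properties.CommutativeSemiring.Exp commutativeSemiring public
    using (^-congˡ; ^-congʳ; ^-homo-*; ^-assocʳ; ^-distrib-*)
  open import Algebra.Properties.Semiring.Mult semiring public
    using (×-homo-+; ×-assoc-*; ×-congʳ; ×-congˡ; ×1-homo-*; ×-assocˡ)
    renaming (_×_ to infixr 8 _×′_)
  open import Algebra.Properties.Ring ring public
    using (-‿distribˡ-*; -‿distribʳ-*; x[y-z]≈xy-xz)
  open import Algebra.Properties.AbelianGroup +-abelianGroup public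
    using (inverseʳ-unique; inverseˡ-unique; ⁻¹-involutive; x∙y⁻¹≈ε⇒x≈y; x≈y⇒x∙y⁻¹≈ε; ε⁻¹≈ε; ⁻¹-∙-comm)
    renaming (∙-cancelʳ to +-cancelʳ)
  open import Relation.Binary.Reasoning.Setoid setoid public
    using (begin_; step-≈-⟩; step-≈-⟨; _∎)
  open import Algebra.Properties.CommutativeSemigroup *-commutativeSemigroup public
    using () renaming (x∙yz≈y∙xz to x·yz≈y·xz; xy∙z≈xz∙y to xy·z≈xz·y)
  open import Algebra.Properties.CommutativeSemigroup +-commutativeSemigroup public
    using () renaming (interchange to +-interchange)
  module ∑F = Algebra.Properties.Semiring.Sum semiring
  module ∏F = Algebra.Properties.CommutativeMonoid.Sum *-commutativeMonoid

  infix 4 _≉0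

  _≉0 : Carrier → Set ℓ
  x ≉0 = ¬ x ≈ 0#

  *-inverseˡ : ∀ {x} → x ≉0 → x ⁻¹ · x ≈ 1#
  *-inverseˡ x≉0 = trans (*-comm _ _) (*-inverseʳ _ x≉0)

  *-cancelˡ : ∀ {x y z} → x ≉0 → x · y ≈ x · z → y ≈ z
  *-cancelˡ {x} {y} {z} x≉0 eq = begin
    y               ≈⟨ *-identityˡ y ⟨
    1# · y          ≈⟨ *-congʳ (*-inverseˡ x≉0) ⟨
    x ⁻¹ · x · y    ≈⟨ *-assoc _ _ _ ⟩
    x ⁻¹ · (x · y)  ≈⟨ *-congˡ eq ⟩
    x ⁻¹ · (x · z)  ≈⟨ *-assoc _ _ _ ⟨
    x ⁻¹ · x · z    ≈⟨ *-congʳ (*-inverseˡ x≉0) ⟩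
    1# · z          ≈⟨ *-identityˡ z ⟩
    z               ∎

  *-≉0 : ∀ {x y} → x ≉0 → y ≉0 → x · y ≉0
  *-≉0 x≉0 y≉0 eq = y≉0 (*-cancelˡ x≉0 (trans eq (sym (zeroʳ _))))

  ⁻¹-≉0 : ∀ {x} → x ≉0 → x ⁻¹ ≉0
  ⁻¹-≉0 x≉0 eq = 1≉0 (trans (sym (*-inverseʳ _ x≉0)) (trans (*-congˡ eq) (zeroʳ _)))

  ≉0-cong : ∀ {x y} → x ≈ y → x ≉0 → y ≉0
  ≉0-cong x≈y x≉0 y≈0 = x≉0 (trans x≈y y≈0)

  ^-≉0 : ∀ {x} → x ≉0 → ∀ n → x ^ n ≉0
  ^-≉0 x≉0 zero    = 1≉0
  ^-≉0 x≉0 (suc n) = *-≉0 x≉0 (^-≉0 x≉0 n)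

  ^-≈0 : ∀ {x} n → x ≈ 0# → x ^ suc n ≈ 0#
  ^-≈0 n x≈0 = trans (*-congʳ x≈0) (zeroˡ _)

  1^ : ∀ n → 1# ^ n ≈ 1#
  1^ zero    = refl
  1^ (suc n) = trans (*-identityˡ _) (1^ n)

  ^-∣ : ∀ {x m n} → m ∣ n → x ^ m ≈ 1# → x ^ n ≈ 1#
  ^-∣ {x} {m} (divides k ≡.refl) eq = begin
    x ^ (k ℕ.* m)  ≈⟨ ^-congʳ x (ℕ.*-comm k m) ⟩
    x ^ (m ℕ.* k)  ≈⟨ ^-assocʳ x m k ⟨
    (x ^ m) ^ k    ≈⟨ ^-congˡ k eq ⟩
    1# ^ k         ≈⟨ 1^ k ⟩
    1#             ∎

  ^-≤ : ∀ {x} → x ≉0 → ∀ {m n} → m ℕ.≤ n → x ^ m ≈ x ^ n → x ^ (n ℕ.∸ m) ≈ 1#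
  ^-≤ {x} x≉0 {m} {n} m≤n eq = *-cancelˡ (^-≉0 x≉0 m) (begin
    x ^ m · x ^ (n ℕ.∸ m)   ≈⟨ ^-homo-* x m _ ⟨
    x ^ (m ℕ.+ (n ℕ.∸ m))   ≈⟨ ^-congʳ x (ℕ.m+[n∸m]≡n m≤n) ⟩
    x ^ n                   ≈⟨ eq ⟨
    x ^ m                   ≈⟨ *-identityʳ _ ⟨
    x ^ m · 1#              ∎)

  x^1+n≈x⇒x^n≈1 : ∀ {x} n → x ≉0 → x ^ suc n ≈ x → x ^ n ≈ 1#
  x^1+n≈x⇒x^n≈1 n x≉0 eq = *-cancelˡ x≉0 (trans eq (sym (*-identityʳ _)))

  -- One interface for Frobenius powers, traces, the maps x ↦ T(ax) and the polar form.
  -- Compatibility with multiples of the prime field comes from `homo-×`.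
  record IsAdditive (f : Carrier → Carrier) : Set (c ⊔ ℓ) where
    field
      cong-≈ : ∀ {x y} → x ≈ y → f x ≈ f y
      homo-+ : ∀ x y → f (x + y) ≈ f x + f y

    homo-0 : f 0# ≈ 0#
    homo-0 = begin
      f 0#                    ≈⟨ +-identityʳ _ ⟨
      f 0# + 0#               ≈⟨ +-congˡ (-‿inverseʳ (f 0#)) ⟨
      f 0# + (f 0# + - f 0#)  ≈⟨ +-assoc _ _ _ ⟨
      f 0# + f 0# + - f 0#    ≈⟨ +-congʳ (homo-+ 0# 0#) ⟨
      f (0# + 0#) + - f 0#    ≈⟨ +-congʳ (cong-≈ (+-identityʳ 0#)) ⟩
      f 0# + - f 0#           ≈⟨ -‿inverseʳ _ ⟩
      0#                      ∎

    homo-neg : ∀ x → f (- x) ≈ - f x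
    homo-neg x = inverseʳ-unique (f x) (f (- x)) (begin
      f x + f (- x)  ≈⟨ homo-+ x (- x) ⟨
      f (x + - x)    ≈⟨ cong-≈ (-‿inverseʳ x) ⟩
      f 0#           ≈⟨ homo-0 ⟩
      0#             ∎)

    homo-× : ∀ n x → f (n ×′ x) ≈ n ×′ f x
    homo-× zero    x = homo-0
    homo-× (suc n) x = trans (homo-+ x (n ×′ x)) (+-congˡ (homo-× n x))

  open IsAdditive public

  ∏-≉0 : ∀ {n} (t : Fin n → Carrier) → (∀ i → t i ≉0) → ∏F.sum t ≉0
  ∏-≉0 {zero}  t t≉0 = 1≉0
  ∏-≉0 {suc n} t t≉0 = *-≉0 (t≉0 zero) (∏-≉0 (t ∘ suc) (t≉0 ∘ suc))

  -- Lagrange's argument: multiplication by x permutes the nonzero entries of e,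
  -- so their product P satisfies xⁿ⁻¹P ≈ P. Here u replaces the entry 0 by 1.
  enumeration-power : (∀ x y → Dec (x ≈ y)) → ∀ {n} (e : Fin n → Carrier) x → x ≉0 →
    (π : Permutation′ n) → (∀ i → e (π ⟨$⟩ʳ i) ≈ x · e i) →
    ∀ i₀ → e i₀ ≈ 0# → (∀ i → e i ≈ 0# → i ≡ i₀) → x ^ n ≈ x
  enumeration-power _≟_ {n} e x x≉0 π π-scales i₀ ei₀≈0 unique =
    *-cancelˡ (∏-≉0 (u ∘ e) (λ i → u≉0 (e i))) (begin
      ∏F.sum (u ∘ e) · x ^ n
        ≈⟨ *-comm _ _ ⟩
      x ^ n · ∏F.sum (u ∘ e)
        ≈⟨ *-congʳ (∏F.sum-replicate n) ⟨
      ∏F.sum {n} (λ _ → x) · ∏F.sum (u ∘ e)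
        ≈⟨ ∏F.∑-distrib-+ (λ _ → x) (u ∘ e) ⟨
      ∏F.sum (λ i → x · u (e i))
        ≈⟨ ∏F.sum-cong-≋ (λ i → step i) ⟩
      ∏F.sum (λ i → w (e i) · u (e (π ⟨$⟩ʳ i)))
        ≈⟨ ∏F.∑-distrib-+ (w ∘ e) (λ i → u (e (π ⟨$⟩ʳ i))) ⟩
      ∏F.sum (w ∘ e) · ∏F.sum (λ i → u (e (π ⟨$⟩ʳ i)))
        ≈⟨ *-cong (trans (sum-single *-commutativeMonoid (w ∘ e) i₀ w≈1) w₀) (sym (∏F.sum-permute (u ∘ e) π)) ⟩
      x · ∏F.sum (u ∘ e)
        ≈⟨ *-comm _ _ ⟩
      ∏F.sum (u ∘ e) · x ∎)
    where
    u w : Carrier → Carrier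
    u y = case y ≟ 0# of λ { (yes _) → 1# ; (no _) → y }
    -- `w` absorbs the mismatch at the zero entry, where `u` is 1 on both sides. It contributes the
    -- single extra x that turns xⁿ⁻¹ ≈ 1 into xⁿ ≈ x.
    w y = case y ≟ 0# of λ { (yes _) → x ; (no _) → 1# }
    u≉0 : ∀ y → u y ≉0
    u≉0 y with y ≟ 0#
    ... | yes _  = 1≉0
    ... | no y≉0 = y≉0
    w₀ : w (e i₀) ≈ x
    w₀ with e i₀ ≟ 0#
    ... | yes _ = refl
    ... | no ne = contradiction ei₀≈0 ne
    w≈1 : ∀ i → i ≢ i₀ → w (e i) ≈ 1#
    w≈1 i i≢i₀ with e i ≟ 0#
    ... | yes ≈0 = contradiction (unique i ≈0) i≢i₀
    ... | no _   = refl
    step : ∀ i → x · u (e i) ≈ w (e i) · u (e (π ⟨$⟩ʳ i))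
    step i with e i ≟ 0# | e (π ⟨$⟩ʳ i) ≟ 0#
    ... | yes _  | yes _   = refl
    ... | yes ≈0 | no ne   = contradiction (trans (π-scales i) (trans (*-congˡ ≈0) (zeroʳ x))) ne
    ... | no ne  | yes ≈0  = contradiction (trans (sym (π-scales i)) ≈0) (*-≉0 x≉0 ne)
    ... | no _   | no _    = trans (sym (π-scales i)) (sym (*-identityˡ _))

  ×1≈0-* : ∀ m n → (m ℕ.* n) ×′ 1# ≈ 0# → ¬ m ×′ 1# ≈ 0# → n ×′ 1# ≈ 0#
  ×1≈0-* m n eq m≉0 = *-cancelˡ m≉0 (trans (sym (×1-homo-* m n)) (trans eq (sym (zeroʳ _))))

  module Characteristic (p : ℕ) (p-prime : Prime p) (p×1≈0 : p ×′ 1# ≈ 0#) where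

    p×≈0 : ∀ x → p ×′ x ≈ 0#
    p×≈0 x = begin
      p ×′ x         ≈⟨ ×-congʳ p (*-identityˡ x) ⟨
      p ×′ (1# · x)  ≈⟨ ×-assoc-* p 1# x ⟨
      (p ×′ 1#) · x  ≈⟨ *-congʳ p×1≈0 ⟩
      0# · x         ≈⟨ zeroˡ x ⟩
      0#             ∎

    p∣⇒×≈0 : ∀ {n} x → p ∣ n → n ×′ x ≈ 0#
    p∣⇒×≈0 x (divides k ≡.refl) = trans (×-congˡ (ℕ.*-comm k p)) (trans (sym (×-assocˡ x p k)) (p×≈0 _))

    -- If 0 < n < p then n and p are coprime, and a Bézout identity writes 1 as a difference of
    -- multiples of n and p, all of which vanish in the field.
    ×1≈0⇒n≡0 : ∀ n → n ℕ.< p → n ×′ 1# ≈ 0# → n ≡ 0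
    ×1≈0⇒n≡0 zero    _   _  = ≡.refl
    ×1≈0⇒n≡0 (suc n) n<p eq = ⊥-elim (1≉0 (1≈0 (coprime-Bézout (prime⇒coprime p-prime n<p))))
      where
      k*≈0 : ∀ k m → m ×′ 1# ≈ 0# → (k ℕ.* m) ×′ 1# ≈ 0#
      k*≈0 k m m≈0 = trans (×1-homo-* k m) (trans (*-congˡ m≈0) (zeroʳ _))
      finish : ∀ m k → suc m ≡ k → m ×′ 1# ≈ 0# → k ×′ 1# ≈ 0# → 1# ≈ 0#
      finish m .(suc m) ≡.refl m≈0 k≈0 = trans (sym (+-identityʳ 1#)) (trans (+-congˡ (sym m≈0)) k≈0)
      1≈0 : Bézout.Identity 1 p (suc n) → 1# ≈ 0#
      1≈0 (Bézout.+- x y e) = finish _ _ e (k*≈0 y (suc n) eq) (k*≈0 x p p×1≈0)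
      1≈0 (Bézout.-+ x y e) = finish _ _ e (k*≈0 x p p×1≈0) (k*≈0 y (suc n) eq)

    ×1-injective : ∀ m n → m ℕ.< p → n ℕ.< p → m ×′ 1# ≈ n ×′ 1# → m ≡ n
    ×1-injective m n m<p n<p eq =
      [ (λ m≤n → ≡.sym (go m≤n n<p (sym eq))) , (λ n≤m → go n≤m m<p eq) ]′ (ℕ.≤-total m n)
      where
      go : ∀ {m n} → n ℕ.≤ m → m ℕ.< p → m ×′ 1# ≈ n ×′ 1# → m ≡ n
      go {m} {n} n≤m m<p eq = ℕ.≤-antisym (ℕ.m∸n≡0⇒m≤n (×1≈0⇒n≡0 (m ℕ.∸ n) (ℕ.≤-<-trans (ℕ.m∸n≤m m n) m<p) (begin
        d                      ≈⟨ +-identityˡ d ⟨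
        0# + d                 ≈⟨ +-congʳ (-‿inverseˡ (n ×′ 1#)) ⟨
        - (n ×′ 1#) + n ×′ 1# + d    ≈⟨ +-assoc _ _ _ ⟩
        - (n ×′ 1#) + (n ×′ 1# + d)  ≈⟨ +-congˡ (×-homo-+ 1# n _) ⟨
        - (n ×′ 1#) + (n ℕ.+ (m ℕ.∸ n)) ×′ 1# ≈⟨ +-congˡ (×-congˡ (ℕ.m+[n∸m]≡n n≤m)) ⟩
        - (n ×′ 1#) + m ×′ 1#  ≈⟨ +-congˡ eq ⟩
        - (n ×′ 1#) + n ×′ 1#  ≈⟨ -‿inverseˡ _ ⟩
        0# ∎))) n≤m
        where d = (m ℕ.∸ n) ×′ 1#

    frobenius : IsAdditive (_^ p)
    frobenius = record { cong-≈ = ^-congˡ p ; homo-+ = homo p p-prime (λ {k} → prime∣C p-prime) p∣⇒×≈0 }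
      where
      import Algebra.Properties.CommutativeSemiring.Binomial commutativeSemiring as Binomial
      -- The prime is generalised to a variable so that it can be matched as `suc n`, which exposes
      -- the two end terms of the binomial sum. The inner ones vanish.
      homo : ∀ n → Prime n → (∀ {k} → 0 ℕ.< k → k ℕ.< n → n ∣ n C k) →
        (∀ {k} x → n ∣ k → k ×′ x ≈ 0#) → ∀ x y → (x + y) ^ n ≈ x ^ n + y ^ n
      homo zero    pr _ _ x y = ⊥-elim (¬prime[0] pr)
      homo (suc n) pr n∣C n∣⇒×≈0 x y = begin
        (x + y) ^ suc n
          ≈⟨ Binomial.theorem (suc n) x y ⟩
        t zero + ∑F.sum (t ∘ suc)
          ≈⟨ +-congˡ (∑F.sum-init-last (t ∘ suc)) ⟩
        t zero + (∑F.sum (λ i → t (suc (inject₁ i))) + t (suc (fromℕ n)))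
          ≈⟨ +-cong t₀ (+-cong (trans (∑F.sum-cong-≋ tᵢ) (∑F.sum-replicate-zero n)) tₙ) ⟩
        y ^ suc n + (0# + x ^ suc n)
          ≈⟨ trans (+-comm _ _) (+-congʳ (+-identityˡ _)) ⟩
        x ^ suc n + y ^ suc n ∎
        where
        t = Binomial.binomialTerm x y (suc n)
        t₀ : t zero ≈ y ^ suc n
        t₀ = trans (+-identityʳ _) (*-identityˡ _)
        tᵢ : ∀ i → t (suc (inject₁ i)) ≈ 0#
        tᵢ i = n∣⇒×≈0 _ (n∣C (s≤s z≤n) (s≤s (≡.subst (ℕ._< n) (≡.sym (toℕ-inject₁ i)) (toℕ<n i))))
        tₙ : t (suc (fromℕ n)) ≈ x ^ suc n
        tₙ = last-term _ (cong suc (toℕ-fromℕ n))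
          where
          last-term : ∀ k → k ≡ suc n → (suc n C k) ×′ (x ^ k · y ^ (suc n ℕ.∸ k)) ≈ x ^ suc n
          last-term k ≡.refl = begin
            (suc n C k) ×′ (x ^ k · y ^ (k ℕ.∸ k))  ≈⟨ ×-congˡ (nCn≡1 k) ⟩
            1 ×′ (x ^ k · y ^ (k ℕ.∸ k))            ≈⟨ +-identityʳ _ ⟩
            x ^ k · y ^ (k ℕ.∸ k)                   ≈⟨ *-congˡ (^-congʳ y (ℕ.n∸n≡0 k)) ⟩
            x ^ k · 1#                              ≈⟨ *-identityʳ _ ⟩
            x ^ k                                   ∎

    frobenius^ : ∀ n → IsAdditive (_^ (p ℕ.^ n))
    frobenius^ n = record { cong-≈ = ^-congˡ (p ℕ.^ n) ; homo-+ = homo n }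
      where
      homo : ∀ n x y → (x + y) ^ (p ℕ.^ n) ≈ x ^ (p ℕ.^ n) + y ^ (p ℕ.^ n)
      homo zero    x y = trans (*-identityʳ _) (sym (+-cong (*-identityʳ x) (*-identityʳ y)))
      homo (suc n) x y = begin
        (x + y) ^ (p ℕ.* p ℕ.^ n)                       ≈⟨ ^-assocʳ _ p _ ⟨
        ((x + y) ^ p) ^ (p ℕ.^ n)                       ≈⟨ ^-congˡ (p ℕ.^ n) (homo-+ frobenius x y) ⟩
        (x ^ p + y ^ p) ^ (p ℕ.^ n)                     ≈⟨ homo n _ _ ⟩
        (x ^ p) ^ (p ℕ.^ n) + (y ^ p) ^ (p ℕ.^ n)       ≈⟨ +-cong (^-assocʳ x p _) (^-assocʳ y p _) ⟩
        x ^ (p ℕ.* p ℕ.^ n) + y ^ (p ℕ.* p ℕ.^ n)       ∎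

    ×1^p : ∀ n → (n ×′ 1#) ^ p ≈ n ×′ 1#
    ×1^p n = trans (homo-× frobenius n 1#) (×-congʳ n (1^ p))

-- Finite fields of order q = N + 1 and sums over them.

module FiniteField {c ℓ} (F : Field c ℓ) (N : ℕ) (card : HasCardinality (Field.setoid F) (suc N)) where
  open FieldProperties F public

  index : Carrier → Fin (suc N)
  index = Inverse.to card

  element : Fin (suc N) → Carrier
  element = Inverse.from card

  element-index : ∀ x → element (index x) ≈ x
  element-index = Inverse.strictlyInverseʳ card

  index-element : ∀ i → index (element i) ≡ i
  index-element = Inverse.strictlyInverseˡ card

  index-injective : ∀ {x y} → index x ≡ index y → x ≈ y
  index-injective {x} {y} eq = trans (sym (element-index x)) (trans (reflexive (cong element eq)) (element-index y))

  element-injective : ∀ {i j} → element i ≈ element j → i ≡ j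
  element-injective eq = ≡.trans (≡.sym (index-element _)) (≡.trans (Inverse.to-cong card eq) (index-element _))

  infix 4 _≟_

  abstract
    _≟_ : ∀ x y → Dec (x ≈ y)
    x ≟ y = map′ index-injective (Inverse.to-cong card) (index x Fin.≟ index y)

    exists? : {P : Pred Carrier ℓ₁} → P Respects _≈_ → Decidable P → Dec (∃ P)
    exists? P-resp P? = map′ (λ { (i , Pi) → element i , Pi })
      (λ { (x , Px) → index x , P-resp (sym (element-index x)) Px }) (Fin.any? (P? ∘ element))

    forall? : {P : Pred Carrier ℓ₁} → P Respects _≈_ → Decidable P → Dec (∀ x → P x)
    forall? P-resp P? = map′ (λ ∀P x → P-resp (element-index x) (∀P (index x)))
      (λ ∀P i → ∀P (element i)) (Fin.all? (P? ∘ element))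

    ¬∀⇒∃¬ : {P : Pred Carrier ℓ₁} → P Respects _≈_ → Decidable P → ¬ (∀ x → P x) → ∃ λ x → ¬ P x
    ¬∀⇒∃¬ P-resp P? ¬∀P with Fin.¬∀⟶∃¬ (suc N) _ (P? ∘ element) (λ ∀P → ¬∀P λ x → P-resp (element-index x) (∀P (index x)))
    ... | i , ¬Pi = element i , ¬Pi

  x^q≈x : ∀ x → x ^ suc N ≈ x
  x^q≈x x with x ≟ 0#
  ... | yes x≈0 = trans (^-≈0 N x≈0) (sym x≈0)
  ... | no  x≉0 = enumeration-power _≟_ element x x≉0
    (permutation (λ i → index (x · element i)) (λ i → index (x ⁻¹ · element i))
      (λ i → cancel x (x ⁻¹) (*-inverseʳ x x≉0) i) (λ i → cancel (x ⁻¹) x (*-inverseˡ x≉0) i))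
    (λ i → element-index _) (index 0#) (element-index 0#)
    (λ i ≈0 → element-injective (trans ≈0 (sym (element-index 0#))))
    where
    cancel : ∀ x y → x · y ≈ 1# → ∀ i → index (x · element (index (y · element i))) ≡ i
    cancel x y xy≈1 i = element-injective (begin
      element (index (x · element (index (y · element i))))  ≈⟨ element-index _ ⟩
      x · element (index (y · element i))                    ≈⟨ *-congˡ (element-index _) ⟩
      x · (y · element i)                                    ≈⟨ *-assoc _ _ _ ⟨
      x · y · element i                                      ≈⟨ *-congʳ xy≈1 ⟩
      1# · element i                                         ≈⟨ *-identityˡ _ ⟩
      element i                                              ∎)

  -- Translation by 1 permutes the field, so the sum of all elements equals itself plus q · 1.
  q×1≈0 : suc N ×′ 1# ≈ 0#
  q×1≈0 = begin
    suc N ×′ 1#                                          ≈⟨ ∑F.sum-replicate (suc N) ⟨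
    ones                                                 ≈⟨ +-identityˡ _ ⟨
    0# + ones                                            ≈⟨ +-congʳ (-‿inverseˡ total) ⟨
    - total + total + ones                               ≈⟨ +-assoc _ _ _ ⟩
    - total + (total + ones)                             ≈⟨ +-congˡ (∑F.∑-distrib-+ element (λ _ → 1#)) ⟨
    - total + ∑F.sum (λ i → element i + 1#)              ≈⟨ +-congˡ (∑F.sum-cong-≋ {suc N} {λ i → element (index (element i + 1#))} {λ i → element i + 1#} (λ i → element-index _)) ⟨
    - total + ∑F.sum (λ i → element (index (element i + 1#))) ≈⟨ +-congˡ (∑F.sum-permute element shift) ⟨
    - total + total                                      ≈⟨ -‿inverseˡ total ⟩
    0# ∎
    where
    total = ∑F.sum element
    ones = ∑F.sum {suc N} (λ _ → 1#)
    cancel : ∀ x y → y + x ≈ 0# → ∀ i → index (element (index (element i + y)) + x) ≡ i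
    cancel x y y+x≈0 i = element-injective (begin
      element (index (element (index (element i + y)) + x))  ≈⟨ element-index _ ⟩
      element (index (element i + y)) + x                    ≈⟨ +-congʳ (element-index _) ⟩
      element i + y + x                                      ≈⟨ +-assoc _ _ _ ⟩
      element i + (y + x)                                    ≈⟨ +-congˡ y+x≈0 ⟩
      element i + 0#                                         ≈⟨ +-identityʳ _ ⟩
      element i                                              ∎)
    shift : Permutation′ (suc N)
    shift = permutation (λ i → index (element i + 1#)) (λ i → index (element i + - 1#))
      (λ i → cancel 1# (- 1#) (-‿inverseˡ 1#) i) (λ i → cancel (- 1#) 1# (-‿inverseʳ 1#) i)

  -- Integer-valued sums over the field

  -- `∑` only sees the representatives `element i`; changing variables replaces them by other
  -- elements of the same ≈-class, so the summand has to respect ≈.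
  Invariant : (Carrier → ℤ) → Set _
  Invariant f = ∀ {x y} → x ≈ y → f x ≡ f y

  abstract
    ∑ : (Carrier → ℤ) → ℤ
    ∑ f = ∑ℤ.sum (f ∘ element)

    ∑-cong : ∀ {f f′} → (∀ x → f x ≡ f′ x) → ∑ f ≡ ∑ f′
    ∑-cong eq = ∑ℤ.sum-cong-≋ (eq ∘ element)

    ∑-+ : ∀ f f′ → ∑ (λ x → f x ℤ.+ f′ x) ≡ ∑ f ℤ.+ ∑ f′
    ∑-+ f f′ = ∑ℤ.∑-distrib-+ (f ∘ element) (f′ ∘ element)

    ∑-*ˡ : ∀ z f → ∑ (λ x → z ℤ.* f x) ≡ z ℤ.* ∑ f
    ∑-*ˡ z f = ≡.sym (∑ℤ.*-distribˡ-sum z (f ∘ element))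

    ∑-*ʳ : ∀ z f → ∑ (λ x → f x ℤ.* z) ≡ ∑ f ℤ.* z
    ∑-*ʳ z f = ≡.sym (∑ℤ.*-distribʳ-sum z (f ∘ element))

    ∑-const : ∀ z → ∑ (λ _ → z) ≡ ℤ.+ suc N ℤ.* z
    ∑-const = sumℤ-const (suc N)

    ∑-swap : ∀ (f : Carrier → Carrier → ℤ) → ∑ (λ x → ∑ (λ y → f x y)) ≡ ∑ (λ y → ∑ (λ x → f x y))
    ∑-swap f = ∑ℤ.∑-comm (λ i j → f (element i) (element j))

    ∑-swap-sum : ∀ {n} (f : Carrier → Fin n → ℤ) → ∑ (λ x → ∑ℤ.sum (λ j → f x j)) ≡ ∑ℤ.sum (λ j → ∑ (λ x → f x j))
    ∑-swap-sum f = ∑ℤ.∑-comm (λ i j → f (element i) j)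

    ∑-zero : ∀ f → (∀ x → f x ≡ 0ℤ) → ∑ f ≡ 0ℤ
    ∑-zero f f≡0 = sumℤ-zero (f ∘ element) (f≡0 ∘ element)

    ∑-single : ∀ {f} → Invariant f → ∀ a → (∀ x → ¬ x ≈ a → f x ≡ 0ℤ) → ∑ f ≡ f a
    ∑-single f-inv a f≡0 = ≡.trans
      (sumℤ-single _ (index a) λ j j≢ → f≡0 (element j) λ eq → j≢ (element-injective (trans eq (sym (element-index a)))))
      (f-inv (element-index a))

    ∑-nonneg-≤0 : ∀ {f} → Invariant f → (∀ x → 0ℤ ℤ.≤ f x) → ∑ f ℤ.≤ 0ℤ → ∀ x → f x ≡ 0ℤ
    ∑-nonneg-≤0 f-inv 0≤f ∑≤0 x = ≡.trans (f-inv (sym (element-index x)))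
      (sumℤ-nonneg-≤0 _ (0≤f ∘ element) ∑≤0 (index x))

  -- Each f x is spread over the indices i with x ≈ e i, of which there is at most one, and the
  -- double sum is exchanged. Translations, scalings, sums over powers of g and cardinalities of
  -- subsets are all instances.
  ∑-reindex : ∀ {n} (e : Fin n → Carrier) → (∀ {i j} → e i ≈ e j → i ≡ j) →
    ∀ {f} → Invariant f → (∀ x → (∃ λ i → x ≈ e i) ⊎ f x ≡ 0ℤ) → ∑ f ≡ ∑ℤ.sum (f ∘ e)
  ∑-reindex e e-inj {f} f-inv support = begin′
    ∑ f
      ≡⟨ ∑-cong spread ⟩
    ∑ (λ x → ∑ℤ.sum (λ i → ind (x ≟ e i) ℤ.* f (e i)))
      ≡⟨ ∑-swap-sum (λ x i → ind (x ≟ e i) ℤ.* f (e i)) ⟩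
    ∑ℤ.sum (λ i → ∑ (λ x → ind (x ≟ e i) ℤ.* f (e i)))
      ≡⟨ ∑ℤ.sum-cong-≋ gather ⟩
    ∑ℤ.sum (f ∘ e) ∎′
    where
    open ≡.≡-Reasoning renaming (begin_ to begin′_; _∎ to _∎′)
    at : ∀ x i → x ≈ e i → ind (x ≟ e i) ℤ.* f (e i) ≡ f (e i)
    at x i eq = ≡.trans (cong (ℤ._* f (e i)) (ind-yes (x ≟ e i) eq)) (ℤ.*-identityˡ _)
    off : ∀ x i → ¬ x ≈ e i → ind (x ≟ e i) ℤ.* f (e i) ≡ 0ℤ
    off x i ne = ≡.trans (cong (ℤ._* f (e i)) (ind-no (x ≟ e i) ne)) (ℤ.*-zeroˡ (f (e i)))
    spread : ∀ x → f x ≡ ∑ℤ.sum (λ i → ind (x ≟ e i) ℤ.* f (e i))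
    spread x with support x
    ... | inj₁ (i , x≈ei) = ≡.sym (≡.trans
      (sumℤ-single _ i (λ j j≢i → off x j (λ x≈ej → j≢i (e-inj (trans (sym x≈ej) x≈ei)))))
      (≡.trans (at x i x≈ei) (f-inv (sym x≈ei))))
    ... | inj₂ fx≡0 = ≡.trans fx≡0 (≡.sym (sumℤ-zero _ vanish))
      where
      vanish : ∀ i → ind (x ≟ e i) ℤ.* f (e i) ≡ 0ℤ
      vanish i with x ≟ e i
      ... | yes x≈ei = ≡.trans (ℤ.*-identityˡ _) (≡.trans (f-inv (sym x≈ei)) fx≡0)
      ... | no _     = ℤ.*-zeroˡ (f (e i))
    gather : ∀ i → ∑ (λ x → ind (x ≟ e i) ℤ.* f (e i)) ≡ f (e i)
    gather i = ≡.trans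
      (∑-single (λ x≈y → cong (ℤ._* f (e i)) (ind-⇔ (_ ≟ e i) (_ ≟ e i) (trans (sym x≈y)) (trans x≈y))) (e i) (λ x → off x i))
      (at (e i) i refl)

  abstract
    ∑-translate : ∀ {f} → Invariant f → ∀ a → ∑ f ≡ ∑ (λ x → f (x + a))
    ∑-translate f-inv a = ∑-reindex (λ i → element i + a)
      (λ eq → element-injective (+-cancelʳ a _ _ eq)) f-inv
      (λ x → inj₁ (index (x + - a) , sym (trans (+-congʳ (element-index _))
        (trans (+-assoc _ _ _) (trans (+-congˡ (-‿inverseˡ a)) (+-identityʳ x))))))

    ∑-scale : ∀ {f} → Invariant f → ∀ {a} → a ≉0 → ∑ f ≡ ∑ (λ x → f (a · x))
    ∑-scale f-inv {a} a≉0 = ∑-reindex (λ i → a · element i)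
      (λ eq → element-injective (*-cancelˡ a≉0 eq)) f-inv
      (λ x → inj₁ (index (a ⁻¹ · x) , sym (trans (*-congˡ (element-index _))
        (trans (sym (*-assoc _ _ _)) (trans (*-congʳ (*-inverseʳ a a≉0)) (*-identityˡ x))))))

  size : {U : Pred Carrier ℓ₁} → Decidable U → ℤ
  size U? = ∑ (λ x → ind (U? x))

  ind-invariant : {U : Pred Carrier ℓ₁} → U Respects _≈_ → (U? : Decidable U) → Invariant (λ x → ind (U? x))
  ind-invariant U-resp U? x≈y = ind-⇔ (U? _) (U? _) (U-resp x≈y) (U-resp (sym x≈y))

  size-enumeration : {U : Pred Carrier ℓ₁} → U Respects _≈_ → (U? : Decidable U) →
    ∀ {n} (e : Fin n → Carrier) → (∀ {i j} → e i ≈ e j → i ≡ j) → (∀ i → U (e i)) →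
    (∀ x → U x → ∃ λ i → x ≈ e i) → size U? ≡ ℤ.+ n
  size-enumeration U-resp U? {n} e e-inj e∈U covers = ≡.trans
    (∑-reindex e e-inj (ind-invariant U-resp U?) support)
    (≡.trans (∑ℤ.sum-cong-≋ (λ i → ind-yes (U? (e i)) (e∈U i))) (≡.trans (sumℤ-const n 1ℤ) (ℤ.*-identityʳ _)))
    where
    support : ∀ x → (∃ λ i → x ≈ e i) ⊎ ind (U? x) ≡ 0ℤ
    support x with U? x
    ... | yes x∈U = inj₁ (covers x x∈U)
    ... | no _    = inj₂ ≡.refl

  instance
    N-nonZero : NonZero N
    N-nonZero = ℕ.≢-nonZero λ N≡0 → 1≉0 (index-injective (one-element N≡0 (index 1#) (index 0#)))
      where
      one-element : ∀ {n} → n ≡ 0 → (i j : Fin (suc n)) → i ≡ j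
      one-element ≡.refl zero zero = ≡.refl

  -- Discrete logarithms and solutions of zᵐ⁺¹ ≈ z.

  module PrimitiveRoot (g : Carrier) (g-prim : IsPrimitiveRoot F g) where

    g≉0 : g ≉0
    g≉0 = proj₁ g-prim

    log : ∀ {x} → x ≉0 → ℕ
    log x≉0 = proj₁ (proj₂ g-prim _ x≉0)

    g^log : ∀ {x} (x≉0 : x ≉0) → x ≈ g ^ log x≉0
    g^log x≉0 = proj₂ (proj₂ g-prim _ x≉0)

    g^N≈1 : g ^ N ≈ 1#
    g^N≈1 = x^1+n≈x⇒x^n≈1 N g≉0 (x^q≈x g)

    g^-% : ∀ d .{{_ : NonZero d}} → g ^ d ≈ 1# → ∀ j → g ^ j ≈ g ^ (j % d)
    g^-% d g^d≈1 j = begin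
      g ^ j                                    ≈⟨ ^-congʳ g (m≡m%n+[m/n]*n j d) ⟩
      g ^ (j % d ℕ.+ j / d ℕ.* d)              ≈⟨ ^-homo-* g (j % d) _ ⟩
      g ^ (j % d) · g ^ (j / d ℕ.* d)          ≈⟨ *-congˡ (^-∣ (divides (j / d) ≡.refl) g^d≈1) ⟩
      g ^ (j % d) · 1#                         ≈⟨ *-identityʳ _ ⟩
      g ^ (j % d)                              ∎

    -- Pigeonhole: if gᵈ ≈ 1, then every element is 0 or one of g⁰, ..., gᵈ⁻¹, which embeds the N +
    -- 1 elements into d + 1 codes.
    order-minimal : ∀ d → .{{NonZero d}} → g ^ d ≈ 1# → N ℕ.≤ d
    order-minimal d g^d≈1 = ℕ.s≤s⁻¹ (Fin.injective⇒≤ {f = code ∘ element} (λ eq →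
      element-injective (trans (decode-code _) (trans (reflexive (cong decode eq)) (sym (decode-code _))))))
      where
      decode : Fin (suc d) → Carrier
      decode zero    = 0#
      decode (suc i) = g ^ toℕ i
      code : Carrier → Fin (suc d)
      code x with x ≟ 0#
      ... | yes _  = zero
      ... | no x≉0 = suc (Fin.fromℕ< (m%n<n (log x≉0) d))
      decode-code : ∀ x → x ≈ decode (code x)
      decode-code x with x ≟ 0#
      ... | yes x≈0 = x≈0
      ... | no x≉0  = trans (g^log x≉0) (trans (g^-% d g^d≈1 _)
        (^-congʳ g (≡.sym (Fin.toℕ-fromℕ< (m%n<n (log x≉0) d)))))

    g^m≈1⇒N∣m : ∀ m → g ^ m ≈ 1# → N ∣ m
    g^m≈1⇒N∣m m eq with m % N in r≡
    ... | zero    = m%n≡0⇒n∣m m N r≡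
    ... | suc r-1 = contradiction
      (order-minimal (suc r-1) (trans (sym (trans (g^-% N g^N≈1 m) (^-congʳ g r≡))) eq))
      (ℕ.<⇒≱ (≡.subst (ℕ._< N) r≡ (m%n<n m N)))

    ∑-powers : ∀ {f} → Invariant f → ∑ f ≡ f 0# ℤ.+ ∑ℤ.sum {N} (λ j → f (g ^ toℕ j))
    ∑-powers {f} f-inv = ∑-reindex e e-inj f-inv (λ x → inj₁ (covers x))
      where
      e : Fin (suc N) → Carrier
      e zero    = 0#
      e (suc j) = g ^ toℕ j
      g^-inj : ∀ {m n} → n ℕ.≤ m → m ℕ.< N → g ^ m ≈ g ^ n → m ≡ n
      g^-inj {m} {n} n≤m m<N eq with m ℕ.∸ n in d≡
      ... | zero = ℕ.≤-antisym (ℕ.m∸n≡0⇒m≤n d≡) n≤m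
      ... | suc d = contradiction
        (order-minimal (suc d) (trans (^-congʳ g (≡.sym d≡)) (^-≤ g≉0 n≤m (sym eq))))
        (ℕ.<⇒≱ (≡.subst (ℕ._< N) d≡ (ℕ.≤-<-trans (ℕ.m∸n≤m m n) m<N)))
      e-inj : ∀ {i j} → e i ≈ e j → i ≡ j
      e-inj {zero}  {zero}  _  = ≡.refl
      e-inj {zero}  {suc j} eq = contradiction (sym eq) (^-≉0 g≉0 (toℕ j))
      e-inj {suc i} {zero}  eq = contradiction eq (^-≉0 g≉0 (toℕ i))
      e-inj {suc i} {suc j} eq = cong suc (Fin.toℕ-injective
        ([ (λ i≤j → ≡.sym (g^-inj i≤j (toℕ<n j) (sym eq))) , (λ j≤i → g^-inj j≤i (toℕ<n i) eq) ]′
          (ℕ.≤-total (toℕ i) (toℕ j))))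
      covers : ∀ x → ∃ λ i → x ≈ e i
      covers x with x ≟ 0#
      ... | yes x≈0 = zero , x≈0
      ... | no x≉0  = suc (Fin.fromℕ< (m%n<n (log x≉0) N)) , trans (g^log x≉0) (trans (g^-% N g^N≈1 _)
        (^-congʳ g (≡.sym (Fin.toℕ-fromℕ< (m%n<n (log x≉0) N)))))

    -- Every solution of zᵐ⁺¹ ≈ z is 0 or one of the m powers of gᴸ.
    fixedPoints-exhausted : ∀ {n} m L .{{_ : NonZero m}} → n ≡ suc m → m ℕ.* L ≡ N →
      (e : Fin n → Carrier) → (∀ {i j} → e i ≈ e j → i ≡ j) → (∀ i → e i ^ n ≈ e i) →
      ∀ z → z ^ n ≈ z → ∃ λ i → z ≈ e i
    fixedPoints-exhausted m L ≡.refl mL≡N e e-inj e-fixed z z-fixed with Fin.any? (λ i → z ≟ e i)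
    ... | yes found = found
    -- A solution missed by `e` would, together with the entries of `e`, give m + 2 distinct
    -- solutions for m + 1 codes.
    ... | no  none  = contradiction (Fin.injective⇒≤ {f = λ i → proj₁ (code (e′ i) (e′-fixed i))} code-inj) ℕ.1+n≰n
      where
      decode : Fin (suc m) → Carrier
      decode zero    = 0#
      decode (suc i) = g ^ (L ℕ.* toℕ i)
      code : ∀ w → w ^ suc m ≈ w → ∃ λ i → w ≈ decode i
      code w w-fixed with w ≟ 0#
      ... | yes w≈0 = zero , w≈0
      ... | no w≉0 with g^m≈1⇒N∣m (log w≉0 ℕ.* m) (trans (sym (^-assocʳ g (log w≉0) m))
                          (trans (^-congˡ m (sym (g^log w≉0))) (x^1+n≈x⇒x^n≈1 m w≉0 w-fixed)))
      -- From wᵐ ≈ 1 and N = mL the logarithm of w is a multiple of L.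
      ... | N∣ with *-cancelˡ-∣ {L} {log w≉0} m (≡.subst₂ _∣_ (≡.sym mL≡N) (ℕ.*-comm (log w≉0) m) N∣)
      ... | divides k log≡ = suc (Fin.fromℕ< (m%n<n k m)) , (begin
        w                               ≈⟨ g^log w≉0 ⟩
        g ^ log w≉0                     ≈⟨ ^-congʳ g (≡.trans log≡ (ℕ.*-comm k L)) ⟩
        g ^ (L ℕ.* k)                   ≈⟨ ^-congʳ g (cong (L ℕ.*_) (m≡m%n+[m/n]*n k m)) ⟩
        g ^ (L ℕ.* (k % m ℕ.+ k / m ℕ.* m)) ≈⟨ ^-congʳ g (ℕ.*-distribˡ-+ L (k % m) _) ⟩
        g ^ (L ℕ.* (k % m) ℕ.+ L ℕ.* (k / m ℕ.* m)) ≈⟨ ^-homo-* g (L ℕ.* (k % m)) _ ⟩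
        g ^ (L ℕ.* (k % m)) · g ^ (L ℕ.* (k / m ℕ.* m))  ≈⟨ *-congˡ (^-∣ (divides (k / m) N∣′) g^N≈1) ⟩
        g ^ (L ℕ.* (k % m)) · 1#        ≈⟨ *-identityʳ _ ⟩
        g ^ (L ℕ.* (k % m))             ≈⟨ ^-congʳ g (cong (L ℕ.*_) (Fin.toℕ-fromℕ< (m%n<n k m))) ⟨
        g ^ (L ℕ.* toℕ (Fin.fromℕ< (m%n<n k m))) ∎)
        where
        N∣′ : L ℕ.* (k / m ℕ.* m) ≡ k / m ℕ.* N
        N∣′ = ≡.trans (≡.sym (ℕ.*-assoc L (k / m) m)) (≡.trans (cong (ℕ._* m) (ℕ.*-comm L (k / m)))
          (≡.trans (ℕ.*-assoc (k / m) L m) (cong (k / m ℕ.*_) (≡.trans (ℕ.*-comm L m) mL≡N))))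
      e′ : Fin (suc (suc m)) → Carrier
      e′ zero    = z
      e′ (suc i) = e i
      e′-fixed : ∀ i → e′ i ^ suc m ≈ e′ i
      e′-fixed zero    = z-fixed
      e′-fixed (suc i) = e-fixed i
      e′-inj : ∀ i j → e′ i ≈ e′ j → i ≡ j
      e′-inj zero    zero    _  = ≡.refl
      e′-inj zero    (suc j) eq = contradiction (j , eq) none
      e′-inj (suc i) zero    eq = contradiction (i , sym eq) none
      e′-inj (suc i) (suc j) eq = cong suc (e-inj eq)
      code-inj : ∀ {i j} → proj₁ (code (e′ i) (e′-fixed i)) ≡ proj₁ (code (e′ j) (e′-fixed j)) → i ≡ j
      code-inj {i} {j} eq = e′-inj i j (trans (proj₂ (code (e′ i) (e′-fixed i)))
        (trans (reflexive (cong decode eq)) (sym (proj₂ (code (e′ j) (e′-fixed j))))))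

-- The absolute trace and its nondegeneracy.

module Trace {c ℓ} (F : Field c ℓ) (N : ℕ) (card : HasCardinality (Field.setoid F) (suc N))
  (g : Field.Carrier F) (g-prim : IsPrimitiveRoot F g)
  (p : ℕ) (p-prime : Prime p) (n : ℕ) (q≡p^1+n : suc N ≡ p ℕ.^ suc n) where

  open FiniteField F N card public
  open PrimitiveRoot g g-prim public

  -- A field has no zero divisors, so if p · 1 were nonzero, then so would be pⁿ⁺¹ · 1 = q · 1.
  p×1≈0 : p ×′ 1# ≈ 0#
  p×1≈0 with p ×′ 1# ≟ 0#
  ... | yes eq = eq
  ... | no  ne = contradiction (trans (×-congˡ (≡.sym q≡p^1+n)) q×1≈0) (power≉0 (suc n))
    where
    power≉0 : ∀ m → ¬ (p ℕ.^ m) ×′ 1# ≈ 0#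
    power≉0 zero    eq = 1≉0 (trans (sym (+-identityʳ 1#)) eq)
    power≉0 (suc m) eq = power≉0 m (×1≈0-* p (p ℕ.^ m) eq ne)

  open Characteristic p p-prime p×1≈0 public

  p-1 : ℕ
  p-1 = ℕ.pred p

  p≡1+p-1 : p ≡ suc p-1
  p≡1+p-1 = ≡.sym (ℕ.suc-pred p {{prime⇒nonZero p-prime}})

  1<p : 1 ℕ.< p
  1<p = ℕ.nonTrivial⇒n>1 p {{prime⇒nonTrivial p-prime}}

  instance
    p-1-nonZero : NonZero p-1
    p-1-nonZero = ℕ.>-nonZero (ℕ.s≤s⁻¹ (≡.subst (1 ℕ.<_) p≡1+p-1 1<p))

  1<p^1+m : ∀ m → 1 ℕ.< p ℕ.^ suc m
  1<p^1+m m = ℕ.^-monoʳ-< p 1<p {0} {suc m} (s≤s z≤n)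

  p-1∣N : ∃ λ L → p-1 ℕ.* L ≡ N
  p-1∣N with 1+^ p-1 (suc n)
  ... | L , eq = L , ℕ.suc-injective (≡.trans (≡.sym eq)
    (≡.trans (cong (ℕ._^ suc n) (≡.sym p≡1+p-1)) (≡.sym q≡p^1+n)))

  -- The p multiples of 1 are already p distinct solutions of zᵖ ≈ z, and there are no more.
  primeSubfield : ∀ z → z ^ p ≈ z → ∃ λ (i : Fin p) → z ≈ toℕ i ×′ 1#
  primeSubfield z z-fixed = fixedPoints-exhausted p-1 (proj₁ p-1∣N) p≡1+p-1 (proj₂ p-1∣N)
    (λ i → toℕ i ×′ 1#)
    (λ eq → Fin.toℕ-injective (×1-injective _ _ (toℕ<n _) (toℕ<n _) eq))
    (λ i → ×1^p (toℕ i)) z z-fixed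

  ^p-· : ∀ {x y} → x ^ p ≈ x → y ^ p ≈ y → (x · y) ^ p ≈ x · y
  ^p-· x-fixed y-fixed = trans (^-distrib-* _ _ p) (*-cong x-fixed y-fixed)

  ^p-+ : ∀ {x y} → x ^ p ≈ x → y ^ p ≈ y → (x + y) ^ p ≈ x + y
  ^p-+ x-fixed y-fixed = trans (homo-+ frobenius _ _) (+-cong x-fixed y-fixed)

  ^p-neg : ∀ {x} → x ^ p ≈ x → (- x) ^ p ≈ - x
  ^p-neg x-fixed = trans (homo-neg frobenius _) (-‿cong x-fixed)

  ^p-⁻¹ : ∀ {x} → x ≉0 → x ^ p ≈ x → (x ⁻¹) ^ p ≈ x ⁻¹
  ^p-⁻¹ {x} x≉0 x-fixed = *-cancelˡ x≉0 (begin
    x · (x ⁻¹) ^ p      ≈⟨ *-congʳ x-fixed ⟨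
    x ^ p · (x ⁻¹) ^ p  ≈⟨ ^-distrib-* x (x ⁻¹) p ⟨
    (x · x ⁻¹) ^ p      ≈⟨ ^-congˡ p (*-inverseʳ x x≉0) ⟩
    1# ^ p              ≈⟨ 1^ p ⟩
    1#                  ≈⟨ *-inverseʳ x x≉0 ⟨
    x · x ⁻¹            ∎)

  -- The sum x + xᵖ + ... of m successive conjugates. The absolute trace is the case m = n + 1;
  -- shorter sums are needed for the inductions, in particular for peeling off one conjugate at a
  -- time.
  trace : ℕ → Carrier → Carrier
  trace zero    x = 0#
  trace (suc m) x = x + trace m (x ^ p)

  trace-additive : ∀ m → IsAdditive (trace m)
  trace-additive m = record { cong-≈ = congr m ; homo-+ = homo m }
    where
    congr : ∀ m {x y} → x ≈ y → trace m x ≈ trace m y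
    congr zero    x≈y = refl
    congr (suc m) x≈y = +-cong x≈y (congr m (^-congˡ p x≈y))
    homo : ∀ m x y → trace m (x + y) ≈ trace m x + trace m y
    homo zero    x y = sym (+-identityˡ 0#)
    homo (suc m) x y = begin
      x + y + trace m ((x + y) ^ p)                    ≈⟨ +-congˡ (congr m (homo-+ frobenius x y)) ⟩
      x + y + trace m (x ^ p + y ^ p)                  ≈⟨ +-congˡ (homo m _ _) ⟩
      x + y + (trace m (x ^ p) + trace m (y ^ p))      ≈⟨ +-interchange _ _ _ _ ⟩
      x + trace m (x ^ p) + (y + trace m (y ^ p))      ∎

  -- Both sides are the sum of the m + 1 conjugates from x to x to the power pᵐ. When pᵐ = q the
  -- last one is x again, whence the Frobenius invariance of T.
  trace-shift : ∀ m x → trace m (x ^ p) + x ≈ trace m x + x ^ (p ℕ.^ m)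
  trace-shift zero    x = +-congˡ (sym (*-identityʳ x))
  trace-shift (suc m) x = begin
    x ^ p + trace m ((x ^ p) ^ p) + x              ≈⟨ +-congʳ (+-comm _ _) ⟩
    trace m ((x ^ p) ^ p) + x ^ p + x              ≈⟨ +-congʳ (trace-shift m (x ^ p)) ⟩
    trace m (x ^ p) + (x ^ p) ^ (p ℕ.^ m) + x      ≈⟨ trans (+-comm _ _) (sym (+-assoc _ _ _)) ⟩
    x + trace m (x ^ p) + (x ^ p) ^ (p ℕ.^ m)      ≈⟨ +-congˡ (^-assocʳ x p _) ⟩
    x + trace m (x ^ p) + x ^ (p ℕ.* p ℕ.^ m)      ∎

  trace^p : ∀ m x → trace m x ^ p ≈ trace m (x ^ p)
  trace^p zero    x = homo-0 frobenius
  trace^p (suc m) x = trans (homo-+ frobenius _ _) (+-congˡ (trace^p m (x ^ p)))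

  trace-linear : ∀ m {z} → z ^ p ≈ z → ∀ x → trace m (z · x) ≈ z · trace m x
  trace-linear zero    {z} z-fixed x = sym (zeroʳ z)
  trace-linear (suc m) {z} z-fixed x = begin
    z · x + trace m ((z · x) ^ p)   ≈⟨ +-congˡ (cong-≈ (trace-additive m) (trans (^-distrib-* z x p) (*-congʳ z-fixed))) ⟩
    z · x + trace m (z · x ^ p)     ≈⟨ +-congˡ (trace-linear m z-fixed (x ^ p)) ⟩
    z · x + z · trace m (x ^ p)     ≈⟨ distribˡ _ _ _ ⟨
    z · (x + trace m (x ^ p))       ∎

  abstract
    T : Carrier → Carrier
    T = trace (suc n)

    T-linear : ∀ {z} → z ^ p ≈ z → ∀ x → T (z · x) ≈ z · T x
    T-linear = trace-linear (suc n)

    T-additive : IsAdditive T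
    T-additive = trace-additive (suc n)

    T-cong : ∀ {x y} → x ≈ y → T x ≈ T y
    T-cong = cong-≈ T-additive

    T-^p : ∀ x → T (x ^ p) ≈ T x
    T-^p x = +-cancelʳ x _ _ (trans (trace-shift (suc n) x)
      (+-congˡ (trans (^-congʳ x (≡.sym q≡p^1+n)) (x^q≈x x))))

    T-fixed : ∀ x → T x ^ p ≈ T x
    T-fixed x = trans (trace^p (suc n) x) (T-^p x)

    T-^p^ : ∀ m x → T (x ^ (p ℕ.^ m)) ≈ T x
    T-^p^ zero    x = T-cong (*-identityʳ x)
    T-^p^ (suc m) x = trans (T-cong (sym (^-assocʳ x p _))) (trans (T-^p^ m (x ^ p)) (T-^p x))

  geometric : Carrier → ℕ → Carrier
  geometric z m = ∑F.sum {m} (λ j → z ^ toℕ j)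

  geometric-suc : ∀ z m → geometric z (suc m) ≈ 1# + z · geometric z m
  geometric-suc z m = +-congˡ (sym (∑F.*-distribˡ-sum {m} z (λ j → z ^ toℕ j)))

  geometric-shift : ∀ z m → z · geometric z m + 1# ≈ geometric z m + z ^ m
  geometric-shift z zero    = +-congʳ (zeroʳ z)
  geometric-shift z (suc m) = begin
    z · geometric z (suc m) + 1#               ≈⟨ +-congʳ (*-congˡ (trans (geometric-suc z m) (+-comm _ _))) ⟩
    z · (z · geometric z m + 1#) + 1#          ≈⟨ +-congʳ (*-congˡ (geometric-shift z m)) ⟩
    z · (geometric z m + z ^ m) + 1#           ≈⟨ +-congʳ (distribˡ _ _ _) ⟩
    z · geometric z m + z ^ suc m + 1#         ≈⟨ trans (+-comm _ _) (sym (+-assoc _ _ _)) ⟩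
    1# + z · geometric z m + z ^ suc m         ≈⟨ +-congʳ (geometric-suc z m) ⟨
    geometric z (suc m) + z ^ suc m            ∎

  geometric≈0 : ∀ z m → z ^ m ≈ 1# → ¬ z ≈ 1# → geometric z m ≈ 0#
  geometric≈0 z m z^m≈1 z≉1 with geometric z m ≟ 0#
  ... | yes eq = eq
  ... | no  ne = contradiction (*-cancelˡ ne (begin
    geometric z m · z   ≈⟨ *-comm _ _ ⟩
    z · geometric z m   ≈⟨ +-cancelʳ 1# _ _ (trans (geometric-shift z m) (+-congˡ z^m≈1)) ⟩
    geometric z m       ≈⟨ *-identityʳ _ ⟨
    geometric z m · 1#  ∎)) z≉1

  geometric-1 : ∀ z m → z ≈ 1# → geometric z m ≈ m ×′ 1#
  geometric-1 z m z≈1 = trans (∑F.sum-cong-≋ {m} (λ j → trans (^-congˡ (toℕ j) z≈1) (1^ (toℕ j)))) (∑F.sum-replicate m)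

  -- The sum of x⁻¹ trace(xˢ) over x ≉ 0, with x⁻¹ written as xᴺ⁻¹.
  weighted : ℕ → ℕ → Carrier
  weighted m s = ∑F.sum {N} (λ j → (g ^ toℕ j) ^ ℕ.pred N · trace m ((g ^ toℕ j) ^ s))

  -- The leading conjugate xˢ contributes the powers xᴺ⁻¹⁺ˢ; along x = gʲ these form a geometric
  -- series.
  weighted-suc : ∀ m s → weighted (suc m) s ≈ geometric (g ^ (ℕ.pred N ℕ.+ s)) N + weighted m (s ℕ.* p)
  weighted-suc m s = trans (∑F.sum-cong-≋ {N} (λ j → term (g ^ toℕ j) (toℕ j) refl))
    (∑F.∑-distrib-+ {N} (λ j → (g ^ (ℕ.pred N ℕ.+ s)) ^ toℕ j) (λ j → (g ^ toℕ j) ^ ℕ.pred N · trace m ((g ^ toℕ j) ^ (s ℕ.* p))))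
    where
    term : ∀ x j → x ≈ g ^ j → x ^ ℕ.pred N · trace (suc m) (x ^ s) ≈
      (g ^ (ℕ.pred N ℕ.+ s)) ^ j + x ^ ℕ.pred N · trace m (x ^ (s ℕ.* p))
    term x j x≈ = begin
      x ^ ℕ.pred N · (x ^ s + trace m ((x ^ s) ^ p))
        ≈⟨ distribˡ _ _ _ ⟩
      x ^ ℕ.pred N · x ^ s + x ^ ℕ.pred N · trace m ((x ^ s) ^ p)
        ≈⟨ +-cong (sym (^-homo-* x (ℕ.pred N) s)) (*-congˡ (cong-≈ (trace-additive m) (^-assocʳ x s p))) ⟩
      x ^ (ℕ.pred N ℕ.+ s) + x ^ ℕ.pred N · trace m (x ^ (s ℕ.* p))
        ≈⟨ +-congʳ (trans (^-congˡ (ℕ.pred N ℕ.+ s) x≈) (trans (^-assocʳ g j _)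
             (trans (^-congʳ g (ℕ.*-comm j (ℕ.pred N ℕ.+ s))) (sym (^-assocʳ g (ℕ.pred N ℕ.+ s) j))))) ⟩
      (g ^ (ℕ.pred N ℕ.+ s)) ^ j + x ^ ℕ.pred N · trace m (x ^ (s ℕ.* p)) ∎

  -- Write s for the exponent pⁱ⁺¹. Ratio 1 in the geometric series would need N to divide N - 1 +
  -- s, hence s - 1, but 0 < s - 1 < N. So every proper conjugate of x contributes 0.
  weighted≈0 : ∀ m i → suc i ℕ.+ m ℕ.≤ suc n → weighted m (p ℕ.^ suc i) ≈ 0#
  weighted≈0 zero    i le = trans (∑F.sum-cong-≋ {N} (λ j → zeroʳ _)) (∑F.sum-replicate-zero N)
  weighted≈0 (suc m) i le = begin
    weighted (suc m) s                      ≈⟨ weighted-suc m s ⟩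
    geometric z N + weighted m (s ℕ.* p)    ≈⟨ +-congʳ (geometric≈0 z N z^N≈1 z≉1) ⟩
    0# + weighted m (s ℕ.* p)               ≈⟨ +-identityˡ _ ⟩
    weighted m (s ℕ.* p)                    ≈⟨ ∑F.sum-cong-≋ {N} (λ j → *-congˡ (cong-≈ (trace-additive m) (^-congʳ _ (ℕ.*-comm s p)))) ⟩
    weighted m (p ℕ.^ suc (suc i))          ≈⟨ weighted≈0 m (suc i) (≡.subst (ℕ._≤ suc n) (ℕ.+-suc (suc i) m) le) ⟩
    0#                                      ∎
    where
    s = p ℕ.^ suc i
    z = g ^ (ℕ.pred N ℕ.+ s)
    z^N≈1 : z ^ N ≈ 1#
    z^N≈1 = trans (^-assocʳ g (ℕ.pred N ℕ.+ s) N) (^-∣ {g} {N} (divides (ℕ.pred N ℕ.+ s) ≡.refl) g^N≈1)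
    i<n : suc i ℕ.< suc n
    i<n = ℕ.≤-trans (s≤s (ℕ.m≤m+n (suc i) m)) (≡.subst (ℕ._≤ suc n) (ℕ.+-suc (suc i) m) le)
    z≉1 : ¬ z ≈ 1#
    z≉1 z≈1 = ℕ.<⇒≱ s-1<N (∣⇒≤ {{ℕ.>-nonZero 0<s-1}} (∣m+n∣m⇒∣n (≡.subst (N ∣_) rearranged (g^m≈1⇒N∣m _ z≈1)) (divides 1 (≡.sym (ℕ.*-identityˡ N)))))
      where
      s≡ : suc (ℕ.pred s) ≡ s
      s≡ = ℕ.suc-pred s {{ℕ.>-nonZero (ℕ.<-trans (s≤s z≤n) (1<p^1+m i))}}
      0<s-1 : 0 ℕ.< ℕ.pred s
      0<s-1 = ℕ.s≤s⁻¹ (≡.subst (1 ℕ.<_) (≡.sym s≡) (1<p^1+m i))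
      s-1<N : ℕ.pred s ℕ.< N
      s-1<N = ℕ.s≤s⁻¹ (≡.subst₂ ℕ._<_ (≡.sym s≡) (≡.sym q≡p^1+n) (ℕ.^-monoʳ-< p 1<p i<n))
      rearranged : ℕ.pred N ℕ.+ s ≡ N ℕ.+ ℕ.pred s
      rearranged = ≡.trans (cong (ℕ.pred N ℕ.+_) (≡.sym s≡)) (≡.trans (ℕ.+-suc (ℕ.pred N) (ℕ.pred s))
        (cong (ℕ._+ ℕ.pred s) (ℕ.suc-pred N)))

  abstract
    -- In the sum of x⁻¹T(x) over x ≉ 0 only the conjugate x itself survives and gives N · 1 = -1.
    -- If T vanished identically, this would be 0. The argument replaces counting the roots of the
    -- trace polynomial.
    T-nonzero : ∃ λ x → T x ≉0
    T-nonzero = ¬∀⇒∃¬ (λ x≈y Tx≈0 → trans (T-cong (sym x≈y)) Tx≈0) (λ x → T x ≟ 0#) λ T≈0 → 1≉0 (begin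
      1#                                ≈⟨ +-identityʳ 1# ⟨
      1# + 0#                           ≈⟨ +-congˡ (trans (∑F.sum-cong-≋ {N} (λ j → trans (*-congˡ (T≈0 _)) (zeroʳ _))) (∑F.sum-replicate-zero N)) ⟨
      1# + weighted (suc n) 1           ≈⟨ +-congˡ (weighted-suc n 1) ⟩
      1# + (geometric (g ^ (ℕ.pred N ℕ.+ 1)) N + weighted n (1 ℕ.* p))
        ≈⟨ +-congˡ (+-cong (geometric-1 _ N (trans (^-congʳ g N≡) g^N≈1))
             (trans (∑F.sum-cong-≋ {N} (λ j → *-congˡ (cong-≈ (trace-additive n) (^-congʳ _ (ℕ.*-comm 1 p)))))
               (weighted≈0 n 0 ℕ.≤-refl))) ⟩
      1# + (N ×′ 1# + 0#)               ≈⟨ +-congˡ (+-identityʳ _) ⟩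
      suc N ×′ 1#                       ≈⟨ q×1≈0 ⟩
      0#                                ∎)
      where
      N≡ : ℕ.pred N ℕ.+ 1 ≡ N
      N≡ = ≡.trans (ℕ.+-comm (ℕ.pred N) 1) (ℕ.suc-pred N)

  T-nondegenerate : ∀ a → (∀ x → T (a · x) ≈ 0#) → a ≈ 0#
  T-nondegenerate a Ta≈0 with a ≟ 0#
  ... | yes a≈0 = a≈0
  ... | no  a≉0 = contradiction (trans (T-cong (begin
    x                ≈⟨ *-identityˡ x ⟨
    1# · x           ≈⟨ *-congʳ (*-inverseʳ a a≉0) ⟨
    a · a ⁻¹ · x     ≈⟨ *-assoc _ _ _ ⟩
    a · (a ⁻¹ · x)   ∎)) (Ta≈0 (a ⁻¹ · x))) (proj₂ T-nonzero)
    where x = proj₁ T-nonzero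

-- Orthogonality relations and duality for additive subgroups.

*-≡0-cancelˡ : ∀ {i j} → i ≢ 0ℤ → i ℤ.* j ≡ 0ℤ → j ≡ 0ℤ
*-≡0-cancelˡ {i} i≢0 eq = [ (λ i≡0 → contradiction i≡0 i≢0) , (λ j≡0 → j≡0) ]′ (ℤ.i*j≡0⇒i≡0∨j≡0 i eq)

module Orthogonality {c ℓ} (F : Field c ℓ) (N : ℕ) (card : HasCardinality (Field.setoid F) (suc N))
  (g : Field.Carrier F) (g-prim : IsPrimitiveRoot F g)
  (p : ℕ) (p-prime : Prime p) (n : ℕ) (q≡p^1+n : suc N ≡ p ℕ.^ suc n) where

  open Trace F N card g g-prim p p-prime n q≡p^1+n public

  P qℤ : ℤ
  P = ℤ.+ p
  qℤ = ℤ.+ suc N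

  P-1≡ : P ℤ.- 1ℤ ≡ ℤ.+ p-1
  P-1≡ = ≡.trans (cong (λ m → ℤ.+ m ℤ.- 1ℤ) p≡1+p-1) (ℤ.[1+m]⊖[1+n]≡m⊖n p-1 0)

  P-1≢0 : P ℤ.- 1ℤ ≢ 0ℤ
  P-1≢0 eq = ℕ.≢-nonZero⁻¹ p-1 (ℤ.+-injective (≡.trans (≡.sym P-1≡) eq))

  P≢0 : P ≢ 0ℤ
  P≢0 eq = ℕ.≢-nonZero⁻¹ p {{prime⇒nonZero p-prime}} (ℤ.+-injective eq)

  -- On the prime field, φ is the sum of the nontrivial additive characters.
  φ : Carrier → ℤ
  φ t = P ℤ.* ind (t ≟ 0#) ℤ.- 1ℤ

  φ-invariant : Invariant φ
  φ-invariant x≈y = cong (λ z → P ℤ.* z ℤ.- 1ℤ) (ind-⇔ (_ ≟ 0#) (_ ≟ 0#) (trans (sym x≈y)) (trans x≈y))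

  φ-≈0 : ∀ {t} → t ≈ 0# → φ t ≡ P ℤ.- 1ℤ
  φ-≈0 t≈0 = cong (ℤ._- 1ℤ) (≡.trans (cong (P ℤ.*_) (ind-yes (_ ≟ 0#) t≈0)) (ℤ.*-identityʳ P))

  φ-scale : ∀ {z} → z ≉0 → ∀ t → φ (z · t) ≡ φ t
  φ-scale z≉0 t = cong (λ i → P ℤ.* i ℤ.- 1ℤ) (ind-⇔ (_ ≟ 0#) (_ ≟ 0#)
    (λ zt≈0 → *-cancelˡ z≉0 (trans zt≈0 (sym (zeroʳ _)))) (λ t≈0 → trans (*-congˡ t≈0) (zeroʳ _)))

  ×-as-· : ∀ m x → m ×′ x ≈ (m ×′ 1#) · x
  ×-as-· m x = trans (×-congʳ m (sym (*-identityˡ x))) (sym (×-assoc-* m 1# x))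

  -- If z ≉ 0, the progression meets 0 exactly once, and p · 1 - p = 0; if z ≈ 0, it is constant. As
  -- p[z = 0] = φ(z) + 1, this is the convolution rule that stands in for multiplicativity of
  -- characters.
  φ-progression : ∀ {t z} → t ^ p ≈ t → z ^ p ≈ z →
    ∑ℤ.sum {p} (λ i → φ (t + toℕ i ×′ z)) ≡ P ℤ.* ind (z ≟ 0#) ℤ.* φ t
  φ-progression {t} {z} t-fixed z-fixed with z ≟ 0#
  ... | yes z≈0 = ≡.trans (∑ℤ.sum-cong-≋ {p} (λ i → φ-invariant (trans (+-congˡ
      (trans (×-as-· (toℕ i) z) (trans (*-congˡ z≈0) (zeroʳ _)))) (+-identityʳ t))))
      (≡.trans (sumℤ-const p (φ t)) (cong (ℤ._* φ t) (≡.sym (ℤ.*-identityʳ P))))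
  ... | no z≉0 = begin′
    ∑ℤ.sum {p} (λ i → φ (t + toℕ i ×′ z))
      ≡⟨ ∑ℤ.∑-distrib-+ {p} (λ i → P ℤ.* hit i) (λ _ → ℤ.-1ℤ) ⟩
    ∑ℤ.sum {p} (λ i → P ℤ.* hit i) ℤ.+ ∑ℤ.sum {p} (λ _ → ℤ.-1ℤ)
      ≡⟨ cong₂ ℤ._+_ (≡.sym (∑ℤ.*-distribˡ-sum {p} P hit)) (sumℤ-const p ℤ.-1ℤ) ⟩
    P ℤ.* ∑ℤ.sum {p} hit ℤ.+ P ℤ.* ℤ.-1ℤ
      ≡⟨ cong (λ s → P ℤ.* s ℤ.+ P ℤ.* ℤ.-1ℤ) (≡.trans (sumℤ-single hit i₀ miss) (ind-yes (_ ≟ 0#) t+i₀z≈0)) ⟩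
    P ℤ.* 1ℤ ℤ.+ P ℤ.* ℤ.-1ℤ
      ≡⟨ ≡.trans (≡.sym (ℤ.*-distribˡ-+ P 1ℤ ℤ.-1ℤ)) (ℤ.*-zeroʳ P) ⟩
    0ℤ
      ≡⟨ ≡.trans (cong (ℤ._* φ t) (ℤ.*-zeroʳ P)) (ℤ.*-zeroˡ (φ t)) ⟨
    P ℤ.* 0ℤ ℤ.* φ t ∎′
    where
    open ≡.≡-Reasoning renaming (begin_ to begin′_; _∎ to _∎′)
    hit : Fin p → ℤ
    hit i = ind (t + toℕ i ×′ z ≟ 0#)
    root = primeSubfield (- t · z ⁻¹) (^p-· (^p-neg t-fixed) (^p-⁻¹ z≉0 z-fixed))
    i₀ = proj₁ root
    i₀z≈-t : toℕ i₀ ×′ z ≈ - t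
    i₀z≈-t = begin
      toℕ i₀ ×′ z          ≈⟨ ×-as-· (toℕ i₀) z ⟩
      (toℕ i₀ ×′ 1#) · z   ≈⟨ *-congʳ (proj₂ root) ⟨
      - t · z ⁻¹ · z       ≈⟨ *-assoc _ _ _ ⟩
      - t · (z ⁻¹ · z)     ≈⟨ *-congˡ (*-inverseˡ z≉0) ⟩
      - t · 1#             ≈⟨ *-identityʳ _ ⟩
      - t                  ∎
    t+i₀z≈0 : t + toℕ i₀ ×′ z ≈ 0#
    t+i₀z≈0 = trans (+-congˡ i₀z≈-t) (-‿inverseʳ t)
    miss : ∀ j → j ≢ i₀ → hit j ≡ 0ℤ
    miss j j≢i₀ = ind-no (_ ≟ 0#) λ t+jz≈0 → j≢i₀ (Fin.toℕ-injective (×1-injective _ _ (toℕ<n j) (toℕ<n i₀)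
      (*-cancelˡ z≉0 (begin
        z · (toℕ j ×′ 1#)    ≈⟨ trans (*-comm _ _) (sym (×-as-· (toℕ j) z)) ⟩
        toℕ j ×′ z           ≈⟨ inverseʳ-unique t _ t+jz≈0 ⟩
        - t                  ≈⟨ i₀z≈-t ⟨
        toℕ i₀ ×′ z          ≈⟨ trans (×-as-· (toℕ i₀) z) (*-comm _ _) ⟩
        z · (toℕ i₀ ×′ 1#)   ∎))))

  record IsSubgroup (U : Pred Carrier ℓ₁) : Set (c ⊔ ℓ ⊔ ℓ₁) where
    field
      U-resp : U Respects _≈_
      U-0    : U 0#
      U-+    : ∀ {x y} → U x → U y → U (x + y)
      U-neg  : ∀ {x} → U x → U (- x)

    U-× : ∀ {x} m → U x → U (m ×′ x)
    U-× zero    Ux = U-0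
    U-× (suc m) Ux = U-+ Ux (U-× m Ux)

    U-+-cancelʳ : ∀ {x y} → U y → U (x + y) → U x
    U-+-cancelʳ {x} {y} Uy Uxy = U-resp
      (trans (+-assoc _ _ _) (trans (+-congˡ (-‿inverseʳ y)) (+-identityʳ x))) (U-+ Uxy (U-neg Uy))

  open IsSubgroup public

  -- Translating by multiples of u₀ leaves the sum unchanged; adding up the p translates puts a full
  -- progression with nonzero step f u₀ inside φ. The offset t is there for the polarised quadratic
  -- form, whose values are affine in one variable.
  orthogonality : {U : Pred Carrier ℓ₁} → IsSubgroup U → (U? : Decidable U) →
    ∀ {f} → IsAdditive f → (∀ x → f x ^ p ≈ f x) → ∀ u₀ → U u₀ → f u₀ ≉0 →
    ∀ {t} → t ^ p ≈ t → ∑ (λ u → ind (U? u) ℤ.* φ (t + f u)) ≡ 0ℤ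
  orthogonality {U = U} U-sub U? {f} f-add f-fixed u₀ Uu₀ fu₀≉0 {t} t-fixed = *-≡0-cancelˡ P≢0 (begin′
    P ℤ.* X
      ≡⟨ sumℤ-const p X ⟨
    ∑ℤ.sum {p} (λ _ → X)
      ≡⟨ ∑ℤ.sum-cong-≋ {p} (λ i → shift (toℕ i)) ⟩
    ∑ℤ.sum {p} (λ i → ∑ (λ u → ind (U? u) ℤ.* φ (t + f u + toℕ i ×′ f u₀)))
      ≡⟨ ∑-swap-sum {p} (λ u i → ind (U? u) ℤ.* φ (t + f u + toℕ i ×′ f u₀)) ⟨
    ∑ (λ u → ∑ℤ.sum {p} (λ i → ind (U? u) ℤ.* φ (t + f u + toℕ i ×′ f u₀)))
      ≡⟨ ∑-zero _ (λ u → ≡.trans (≡.sym (∑ℤ.*-distribˡ-sum {p} (ind (U? u)) (λ i → φ (t + f u + toℕ i ×′ f u₀))))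
           (≡.trans (cong (ind (U? u) ℤ.*_) (vanish u)) (ℤ.*-zeroʳ (ind (U? u))))) ⟩
    0ℤ ∎′)
    where
    open ≡.≡-Reasoning renaming (begin_ to begin′_; _∎ to _∎′)
    X = ∑ (λ u → ind (U? u) ℤ.* φ (t + f u))
    vanish : ∀ u → ∑ℤ.sum {p} (λ i → φ (t + f u + toℕ i ×′ f u₀)) ≡ 0ℤ
    vanish u = ≡.trans (φ-progression (^p-+ t-fixed (f-fixed u)) (f-fixed u₀))
      (≡.trans (cong (λ i → P ℤ.* i ℤ.* φ (t + f u)) (ind-no (f u₀ ≟ 0#) fu₀≉0))
      (≡.trans (cong (ℤ._* φ (t + f u)) (ℤ.*-zeroʳ P)) (ℤ.*-zeroˡ (φ (t + f u)))))
    shift : ∀ m → X ≡ ∑ (λ u → ind (U? u) ℤ.* φ (t + f u + m ×′ f u₀))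
    shift m = ≡.trans
      (∑-translate (λ x≈y → cong₂ ℤ._*_ (ind-invariant (U-resp U-sub) U? x≈y)
        (φ-invariant (+-congˡ (cong-≈ f-add x≈y)))) (m ×′ u₀))
      (∑-cong λ u → cong₂ ℤ._*_
        (ind-⇔ (U? _) (U? _) (U-+-cancelʳ U-sub (U-× U-sub m Uu₀)) (λ Uu → U-+ U-sub Uu (U-× U-sub m Uu₀)))
        (φ-invariant (trans (+-congˡ (trans (homo-+ f-add _ _) (+-congˡ (homo-× f-add m u₀)))) (sym (+-assoc _ _ _)))))

  orthogonality-all : ∀ {f} → IsAdditive f → (∀ x → f x ^ p ≈ f x) → ∀ u₀ → f u₀ ≉0 →
    ∀ {t} → t ^ p ≈ t → ∑ (λ u → φ (t + f u)) ≡ 0ℤ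
  orthogonality-all f-add f-fixed u₀ fu₀≉0 t-fixed = ≡.trans (∑-cong (λ u → ≡.sym (ℤ.*-identityˡ _)))
    (orthogonality {U = λ _ → ⊤} record { U-resp = λ _ _ → tt ; U-0 = tt ; U-+ = λ _ _ → tt ; U-neg = λ _ → tt }
      (λ _ → yes tt) f-add f-fixed u₀ tt fu₀≉0 t-fixed)

  T·-additive : ∀ a → IsAdditive (λ x → T (a · x))
  T·-additive a = record
    { cong-≈ = λ x≈y → T-cong (*-congˡ x≈y)
    ; homo-+ = λ x y → trans (T-cong (distribˡ a x y)) (homo-+ T-additive _ _) }

  T0≈0 : T 0# ≈ 0#
  T0≈0 = homo-0 T-additive

  e : Carrier → ℤ
  e x = φ (T x)

  e-invariant : Invariant e
  e-invariant x≈y = φ-invariant (T-cong x≈y)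

  e-≈0 : ∀ {x} → x ≈ 0# → e x ≡ P ℤ.- 1ℤ
  e-≈0 x≈0 = φ-≈0 (trans (T-cong x≈0) T0≈0)

  0^p≈0 : 0# ^ p ≈ 0#
  0^p≈0 = homo-0 frobenius

  φ-0+ : ∀ t → φ t ≡ φ (0# + t)
  φ-0+ t = φ-invariant (sym (+-identityˡ t))

  ∑-e-scaled : ∀ {a} → a ≉0 → ∑ (λ x → e (a · x)) ≡ 0ℤ
  ∑-e-scaled {a} a≉0 = ≡.trans (∑-cong (λ x → φ-0+ _))
    (orthogonality-all (T·-additive a) (λ x → T-fixed _) (proj₁ witness) (proj₂ witness) 0^p≈0)
    where
    witness : ∃ λ x → T (a · x) ≉0
    witness = ¬∀⇒∃¬ (λ x≈y → trans (T-cong (*-congˡ (sym x≈y)))) (λ x → T (a · x) ≟ 0#)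
      (λ Ta≈0 → a≉0 (T-nondegenerate a Ta≈0))

  -- Orthogonal complements for the trace form

  Perp : Pred Carrier ℓ₁ → Pred Carrier (c ⊔ ℓ ⊔ ℓ₁)
  Perp U x = ∀ u → U u → T (x · u) ≈ 0#

  Perp-subgroup : (U : Pred Carrier ℓ₁) → IsSubgroup (Perp U)
  Perp-subgroup U = record
    { U-resp = λ x≈y x⊥ u Uu → trans (T-cong (*-congʳ (sym x≈y))) (x⊥ u Uu)
    ; U-0    = λ u _ → trans (T-cong (zeroˡ u)) T0≈0
    ; U-+    = λ x⊥ y⊥ u Uu → trans (T-cong (distribʳ _ _ _)) (trans (homo-+ T-additive _ _)
                 (trans (+-cong (x⊥ u Uu) (y⊥ u Uu)) (+-identityʳ 0#)))
    ; U-neg  = λ x⊥ u Uu → trans (T-cong (sym (-‿distribˡ-* _ _))) (trans (homo-neg T-additive _)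
                 (trans (-‿cong (x⊥ u Uu)) ε⁻¹≈ε)) }

  module _ {U : Pred Carrier ℓ₁} (U-sub : IsSubgroup U) (U? : Decidable U) where

    abstract
      perp? : Decidable (Perp U)
      perp? x = forall? (λ u≈v imp Uv → trans (T-cong (*-congˡ (sym u≈v))) (imp (U-resp U-sub (sym u≈v) Uv)))
        (λ u → U? u →-dec (T (x · u) ≟ 0#))

    ¬Perp⇒∃ : ∀ {x} → ¬ Perp U x → ∃ λ u → U u × T (x · u) ≉0
    ¬Perp⇒∃ {x} ¬x⊥ with ¬∀⇒∃¬ {P = λ u → U u → T (x · u) ≈ 0#}
      (λ u≈v imp Uv → trans (T-cong (*-congˡ (sym u≈v))) (imp (U-resp U-sub (sym u≈v) Uv)))
      (λ u → U? u →-dec (T (x · u) ≟ 0#)) ¬x⊥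
    ... | u , ¬imp with U? u
    ...   | yes Uu = u , Uu , λ eq → ¬imp (λ _ → eq)
    ...   | no ¬Uu = ⊥-elim (¬imp (λ Uu → contradiction Uu ¬Uu))

    ∑-e-zero : ∀ {x u₀} → U u₀ → T (x · u₀) ≉0 → ∑ (λ u → ind (U? u) ℤ.* e (x · u)) ≡ 0ℤ
    ∑-e-zero {x} {u₀} Uu₀ ne = ≡.trans (∑-cong (λ u → cong (ind (U? u) ℤ.*_) (φ-0+ _)))
      (orthogonality U-sub U? (T·-additive x) (λ _ → T-fixed _) u₀ Uu₀ ne 0^p≈0)

    ∑-e-subgroup : ∀ x → ∑ (λ u → ind (U? u) ℤ.* e (x · u)) ≡ size U? ℤ.* (P ℤ.- 1ℤ) ℤ.* ind (perp? x)
    ∑-e-subgroup x with perp? x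
    ... | yes x⊥ = ≡.trans (∑-cong term) (≡.trans (∑-*ʳ (P ℤ.- 1ℤ) (λ u → ind (U? u))) (≡.sym (ℤ.*-identityʳ _)))
      where
      term : ∀ u → ind (U? u) ℤ.* e (x · u) ≡ ind (U? u) ℤ.* (P ℤ.- 1ℤ)
      term u with U? u
      ... | yes Uu = cong (1ℤ ℤ.*_) (φ-≈0 (x⊥ u Uu))
      ... | no _   = ≡.trans (ℤ.*-zeroˡ (e (x · u))) (≡.sym (ℤ.*-zeroˡ (P ℤ.- 1ℤ)))
    ... | no ¬x⊥ with ¬Perp⇒∃ ¬x⊥
    ...   | u , Uu , ne = ≡.trans (∑-e-zero Uu ne) (≡.sym (ℤ.*-zeroʳ (size U? ℤ.* (P ℤ.- 1ℤ))))

    -- Double counting of the sum of e(xu) over x in the field and u ∈ U: summed over u first, only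
    -- x ∈ U⊥ contributes; summed over x first, only u = 0.
    size-perp : size U? ℤ.* size perp? ≡ qℤ
    size-perp = ℤ.*-cancelˡ-≡ (P ℤ.- 1ℤ) (size U? ℤ.* size perp?) qℤ {{ℤ.≢-nonZero P-1≢0}} (begin′
      (P ℤ.- 1ℤ) ℤ.* (size U? ℤ.* size perp?)
        ≡⟨ rearrange (P ℤ.- 1ℤ) (size U?) (size perp?) ⟩
      size U? ℤ.* (P ℤ.- 1ℤ) ℤ.* size perp?
        ≡⟨ ∑-*ˡ (size U? ℤ.* (P ℤ.- 1ℤ)) (λ x → ind (perp? x)) ⟨
      ∑ (λ x → size U? ℤ.* (P ℤ.- 1ℤ) ℤ.* ind (perp? x))
        ≡⟨ ∑-cong ∑-e-subgroup ⟨
      ∑ (λ x → ∑ (λ u → ind (U? u) ℤ.* e (x · u)))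
        ≡⟨ ∑-swap (λ x u → ind (U? u) ℤ.* e (x · u)) ⟩
      ∑ (λ u → ∑ (λ x → ind (U? u) ℤ.* e (x · u)))
        ≡⟨ ∑-single inv 0# off ⟩
      ∑ (λ x → ind (U? 0#) ℤ.* e (x · 0#))
        ≡⟨ ∑-cong (λ x → cong₂ ℤ._*_ (ind-yes (U? 0#) (U-0 U-sub)) (e-≈0 (zeroʳ x))) ⟩
      ∑ (λ x → 1ℤ ℤ.* (P ℤ.- 1ℤ))
        ≡⟨ ≡.trans (∑-const (1ℤ ℤ.* (P ℤ.- 1ℤ))) (≡.trans (cong (qℤ ℤ.*_) (ℤ.*-identityˡ (P ℤ.- 1ℤ))) (ℤ.*-comm qℤ (P ℤ.- 1ℤ))) ⟩
      (P ℤ.- 1ℤ) ℤ.* qℤ ∎′)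
      where
      open ≡.≡-Reasoning renaming (begin_ to begin′_; _∎ to _∎′)
      rearrange : ∀ x y z → x ℤ.* (y ℤ.* z) ≡ y ℤ.* x ℤ.* z
      rearrange x y z = ≡.trans (≡.sym (ℤ.*-assoc x y z)) (cong (ℤ._* z) (ℤ.*-comm x y))
      inv : Invariant (λ u → ∑ (λ x → ind (U? u) ℤ.* e (x · u)))
      inv u≈v = ∑-cong (λ x → cong₂ ℤ._*_ (ind-invariant (U-resp U-sub) U? u≈v) (e-invariant (*-congˡ u≈v)))
      off : ∀ u → ¬ u ≈ 0# → ∑ (λ x → ind (U? u) ℤ.* e (x · u)) ≡ 0ℤ
      off u u≉0 = ≡.trans (∑-*ˡ (ind (U? u)) (λ x → e (x · u)))
        (≡.trans (cong (ind (U? u) ℤ.*_) (≡.trans (∑-cong (λ x → e-invariant (*-comm x u))) (∑-e-scaled u≉0)))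
          (ℤ.*-zeroʳ (ind (U? u))))

  -- U lies in U⊥⊥ and the two have equal size, so the difference of their indicators is nonnegative
  -- with sum 0 and vanishes everywhere.
  Perp-Perp : {U : Pred Carrier ℓ₁} → IsSubgroup U → Decidable U → ∀ x → Perp (Perp U) x → U x
  Perp-Perp {U = U} U-sub U? x x⊥⊥ with U? x
  ... | yes Ux = Ux
  ... | no ¬Ux = contradiction (gap x) λ gap≡0 → 1≢0 (≡.trans (≡.sym gap≡1) gap≡0)
    where
    ⊥-sub = Perp-subgroup U
    ⊥? = perp? U-sub U?
    ⊥⊥-sub = Perp-subgroup (Perp U)
    ⊥⊥? = perp? ⊥-sub ⊥?
    1≢0 : 1ℤ ≢ 0ℤ
    1≢0 ()
    sizes-equal : size U? ≡ size ⊥⊥?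
    sizes-equal = ℤ.*-cancelˡ-≡ (size ⊥?) (size U?) (size ⊥⊥?) {{ℤ.≢-nonZero nz}}
      (≡.trans (ℤ.*-comm (size ⊥?) (size U?)) (≡.trans (size-perp U-sub U?) (≡.sym (size-perp ⊥-sub ⊥?))))
      where
      nz : size ⊥? ≢ 0ℤ
      nz eq with () ← ≡.trans (≡.sym (size-perp ⊥-sub ⊥?)) (≡.trans (cong (ℤ._* size ⊥⊥?) eq) (ℤ.*-zeroˡ (size ⊥⊥?)))
    U⊆⊥⊥ : ∀ {y} → U y → Perp (Perp U) y
    U⊆⊥⊥ {y} Uy z z⊥ = trans (T-cong (*-comm y z)) (z⊥ y Uy)
    diff : Carrier → ℤ
    diff y = ind (⊥⊥? y) ℤ.+ ℤ.-1ℤ ℤ.* ind (U? y)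
    gap : ∀ y → diff y ≡ 0ℤ
    gap = ∑-nonneg-≤0
      (λ x≈y → cong₂ (λ s t → s ℤ.+ ℤ.-1ℤ ℤ.* t) (ind-invariant (U-resp ⊥⊥-sub) ⊥⊥? x≈y) (ind-invariant (U-resp U-sub) U? x≈y))
      nonneg
      (ℤ.≤-reflexive (≡.trans (∑-+ (λ y → ind (⊥⊥? y)) (λ y → ℤ.-1ℤ ℤ.* ind (U? y)))
        (≡.trans (cong (λ s → size ⊥⊥? ℤ.+ s) (≡.trans (∑-*ˡ ℤ.-1ℤ (λ y → ind (U? y))) (≡.trans (cong (ℤ.-1ℤ ℤ.*_) sizes-equal) (ℤ.-1*i≡-i (size ⊥⊥?)))))
          (ℤ.+-inverseʳ (size ⊥⊥?)))))
      where
      nonneg : ∀ y → 0ℤ ℤ.≤ diff y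
      nonneg y with U? y
      ... | no _   = ≡.subst (0ℤ ℤ.≤_) (≡.sym (ℤ.+-identityʳ (ind (⊥⊥? y)))) (ind-nonneg (⊥⊥? y))
      ... | yes Uy = ℤ.≤-reflexive (≡.sym (cong (ℤ._+ ℤ.-1ℤ) (ind-yes (⊥⊥? y) (U⊆⊥⊥ Uy))))
    gap≡1 : diff x ≡ 1ℤ
    gap≡1 = cong₂ (λ s t → s ℤ.+ ℤ.-1ℤ ℤ.* t) (ind-yes (⊥⊥? x) x⊥⊥) (ind-no (U? x) ¬Ux)

-- The quadratic sums of T(a yᵖ⁺¹).

sumℤ-head : ∀ {m k} (t : Fin m → ℤ) {A X} → m ≡ suc k → (∀ i → toℕ i ≡ 0 → t i ≡ A) →
  (∀ i → toℕ i ≢ 0 → t i ≡ X) → ∑ℤ.sum t ≡ A ℤ.+ ℤ.+ k ℤ.* X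
sumℤ-head {k = k} t {X = X} ≡.refl t₀ tᵢ = cong₂ ℤ._+_ (t₀ zero ≡.refl)
  (≡.trans (∑ℤ.sum-cong-≋ {k} (λ i → tᵢ (suc i) λ ())) (sumℤ-const k X))

module _ where
  open ℤ-Solver using (solve; _:+_; _:*_; _:-_; _:=_; con)

  difference-of-squares : ∀ s x y → s ℤ.* s ≡ x ℤ.* (y ℤ.* y ℤ.* x) →
    (s ℤ.- x ℤ.* y) ℤ.* (s ℤ.+ x ℤ.* y) ≡ 0ℤ
  difference-of-squares s x y eq = ≡.trans
    (solve 2 (λ s r → (s :- r) :* (s :+ r) := s :* s :- r :* r) ≡.refl s (x ℤ.* y))
    (≡.trans (cong (λ z → z ℤ.- x ℤ.* y ℤ.* (x ℤ.* y)) eq)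
      (solve 2 (λ x y → x :* (y :* y :* x) :- x :* y :* (x :* y) := con 0ℤ) ≡.refl x y))

  -- Excludes the wrong sign: with x = p - 1, y = p + 1 and q standing for √q, the equation S = -(p
  -- - 1)√q is divided by p - 1 and exhibits p + 1 as a divisor of 2.
  divide : ∀ x y b t {s q} → x ≢ 0ℤ → s ≡ x ℤ.+ x ℤ.* y ℤ.* b → q ≡ 1ℤ ℤ.+ x ℤ.* y ℤ.* t →
    s ℤ.+ x ℤ.* q ≡ 0ℤ → y ℤ.* (b ℤ.+ x ℤ.* t) ≡ ℤ.- (ℤ.+ 2)
  divide x y b t x≢0 ≡.refl ≡.refl eq = ℤ.i-j≡0⇒i≡j _ (ℤ.- (ℤ.+ 2)) (*-≡0-cancelˡ x≢0 (≡.trans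
    (solve 4 (λ x y b t → x :* (y :* (b :+ x :* t) :- con (ℤ.- (ℤ.+ 2))) :=
      (x :+ x :* y :* b) :+ x :* (con 1ℤ :+ x :* y :* t)) ≡.refl x y b t) eq))

divides-2 : ∀ {m z} → ℤ.+ m ℤ.* z ≡ ℤ.- (ℤ.+ 2) → m ∣ 2
divides-2 {m} {z} eq = divides ℤ.∣ z ∣ (≡.trans (cong ℤ.∣_∣ (≡.sym eq))
  (≡.trans (ℤ.abs-* (ℤ.+ m) z) (ℕ.*-comm m ℤ.∣ z ∣)))

-- `N≡` says that 2(p² - 1) divides q - 1, which recognises (p+1)-th powers; `Q≡` says that √q ≡ 1
-- modulo p² - 1, which fixes the sign of the sums.
module QuadraticSums {c ℓ} (F : Field c ℓ) (N : ℕ) (card : HasCardinality (Field.setoid F) (suc N))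
  (g : Field.Carrier F) (g-prim : IsPrimitiveRoot F g)
  (p : ℕ) (p-prime : Prime p) (n : ℕ) (q≡p^1+n : suc N ≡ p ℕ.^ suc n)
  (L : ℕ) (N≡ : ℕ.pred p ℕ.* (suc p ℕ.* (2 ℕ.* L)) ≡ N)
  (Q t : ℕ) (q≡Q² : suc N ≡ Q ℕ.* Q) (Q≡ : Q ≡ suc (ℕ.pred p ℕ.* suc p ℕ.* t)) where

  open Orthogonality F N card g g-prim p p-prime n q≡p^1+n public

  Q₁ P₁ : ℤ
  Q₁ = ℤ.+ Q
  P₁ = ℤ.+ p-1

  -- For b = gˢ the hypothesis says that N = 2(p - 1)(p + 1)L divides 2(p - 1)s, so p + 1 divides s.
  -- The factor 2 admits bᵖ⁻¹ = -1 beside bᵖ⁻¹ = 1.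
  power-criterion : ∀ {b} → b ≉0 → b ^ (2 ℕ.* p-1) ≈ 1# → ∃ λ z → b ≈ z ^ suc p
  power-criterion {b} b≉0 eq with *-cancelˡ-∣ {suc p ℕ.* L} {s} (2 ℕ.* p-1) {{ℕ.m*n≢0 2 p-1}}
      (≡.subst₂ _∣_ N-rearranged (ℕ.*-comm s (2 ℕ.* p-1)) (g^m≈1⇒N∣m (s ℕ.* (2 ℕ.* p-1)) g^≈1))
    where
    open ℕ-Solver using (solve; _:*_; _:=_; con)
    s = log b≉0
    g^≈1 : g ^ (s ℕ.* (2 ℕ.* p-1)) ≈ 1#
    g^≈1 = trans (sym (^-assocʳ g s (2 ℕ.* p-1))) (trans (^-congˡ (2 ℕ.* p-1) (sym (g^log b≉0))) eq)
    N-rearranged : N ≡ 2 ℕ.* p-1 ℕ.* (suc p ℕ.* L)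
    N-rearranged = ≡.trans (≡.sym N≡)
      (solve 3 (λ x y z → x :* (y :* (con 2 :* z)) := con 2 :* x :* (y :* z)) ≡.refl p-1 (suc p) L)
  ... | divides k log≡ = g ^ (k ℕ.* L) , (begin
    b                            ≈⟨ g^log b≉0 ⟩
    g ^ log b≉0                  ≈⟨ ^-congʳ g (≡.trans log≡ k-rearranged) ⟩
    g ^ (k ℕ.* L ℕ.* suc p)      ≈⟨ ^-assocʳ g (k ℕ.* L) (suc p) ⟨
    (g ^ (k ℕ.* L)) ^ suc p      ∎)
    where
    k-rearranged : k ℕ.* (suc p ℕ.* L) ≡ k ℕ.* L ℕ.* suc p
    k-rearranged = ≡.trans (cong (k ℕ.*_) (ℕ.*-comm (suc p) L)) (≡.sym (ℕ.*-assoc k L (suc p)))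

  ^p≈·^p-1 : ∀ x → x ^ p ≈ x · x ^ p-1
  ^p≈·^p-1 x = ^-congʳ x p≡1+p-1

  fixed⇒power : ∀ {b} → b ≉0 → b ^ p ≈ b → ∃ λ z → b ≈ z ^ suc p
  fixed⇒power {b} b≉0 b-fixed = power-criterion b≉0 (^-∣ {b} {p-1} (divides 2 ≡.refl)
    (x^1+n≈x⇒x^n≈1 p-1 b≉0 (trans (sym (^p≈·^p-1 b)) b-fixed)))

  negated⇒power : ∀ {b} → b ≉0 → b ^ p ≈ - b → ∃ λ z → b ≈ z ^ suc p
  negated⇒power {b} b≉0 b-negated = power-criterion b≉0 (begin
    b ^ (2 ℕ.* p-1)         ≈⟨ ^-congʳ b (ℕ.*-comm 2 p-1) ⟩
    b ^ (p-1 ℕ.* 2)         ≈⟨ ^-assocʳ b p-1 2 ⟨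
    (b ^ p-1) ^ 2           ≈⟨ ^-congˡ 2 b^p-1≈-1 ⟩
    - 1# · (- 1# · 1#)      ≈⟨ *-congˡ (*-identityʳ _) ⟩
    - 1# · - 1#             ≈⟨ -‿distribˡ-* 1# (- 1#) ⟨
    - (1# · - 1#)           ≈⟨ -‿cong (*-identityˡ _) ⟩
    - - 1#                  ≈⟨ ⁻¹-involutive 1# ⟩
    1#                      ∎)
    where
    b^p-1≈-1 : b ^ p-1 ≈ - 1#
    b^p-1≈-1 = *-cancelˡ b≉0 (begin
      b · b ^ p-1    ≈⟨ ^p≈·^p-1 b ⟨
      b ^ p          ≈⟨ b-negated ⟩
      - b            ≈⟨ -‿cong (*-identityʳ b) ⟨
      - (b · 1#)     ≈⟨ -‿distribʳ-* b 1# ⟩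
      b · - 1#       ∎)

  -- In terms of characters, `X a` is the sum over nontrivial characters ψ of 𝔽_p of |Σ_x ψ(T(a
  -- xᵖ⁺¹))|², whereas `S a` adds up the inner sums themselves.
  S X : Carrier → ℤ
  S a = ∑ (λ y → e (a · y ^ suc p))
  X a = ∑ (λ x → ∑ (λ y → φ (T (a · x ^ suc p) + - T (a · y ^ suc p))))

  form-cong : ∀ {a x y} → x ≈ y → T (a · x ^ suc p) ≈ T (a · y ^ suc p)
  form-cong x≈y = T-cong (*-congˡ (^-congˡ (suc p) x≈y))

  -- With f(y) = T(a yᵖ⁺¹), the sum of φ(f(x) - i f(y)) over x, y and i < p is computed twice.
  -- Summing over i first gives (S + q)S. For fixed i, the case i = 0 gives qS, and each i ≠ 0 gives
  -- X, since i is a (p+1)-th power dᵖ⁺¹ and is absorbed by y ↦ dy.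
  S²≡P₁X : ∀ a → S a ℤ.* S a ≡ P₁ ℤ.* X a
  S²≡P₁X a = cancel (S a) qℤ (P₁ ℤ.* X a) (≡.trans (≡.sym by-pairs) by-multiples)
    where
    open ≡.≡-Reasoning renaming (begin_ to begin′_; _∎ to _∎′)
    form : Carrier → Carrier
    form y = T (a · y ^ suc p)
    cancel : ∀ s q x → (s ℤ.+ q) ℤ.* s ≡ q ℤ.* s ℤ.+ x → s ℤ.* s ≡ x
    cancel s q x eq = ℤ+.∙-cancelˡ (q ℤ.* s) (s ℤ.* s) x (≡.trans
      (≡.trans (ℤ.+-comm (q ℤ.* s) (s ℤ.* s)) (≡.sym (ℤ.*-distribʳ-+ s s q))) eq)
    Z = ∑ℤ.sum {p} (λ i → ∑ (λ x → ∑ (λ y → φ (form x + toℕ i ×′ - form y))))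
    P*ind : ∀ u → P ℤ.* ind (- u ≟ 0#) ≡ φ u ℤ.+ 1ℤ
    P*ind u = ≡.trans (cong (P ℤ.*_) (ind-⇔ (- u ≟ 0#) (u ≟ 0#)
      (λ -u≈0 → trans (sym (⁻¹-involutive u)) (trans (-‿cong -u≈0) ε⁻¹≈ε))
      (λ u≈0 → trans (-‿cong u≈0) ε⁻¹≈ε)))
      (≡.sym (≡.trans (ℤ.+-assoc (P ℤ.* ind (u ≟ 0#)) ℤ.-1ℤ 1ℤ) (ℤ.+-identityʳ _)))
    by-pairs : Z ≡ (S a ℤ.+ qℤ) ℤ.* S a
    by-pairs = begin′
      Z
        ≡⟨ ∑-swap-sum {p} (λ x i → ∑ (λ y → φ (form x + toℕ i ×′ - form y))) ⟨
      ∑ (λ x → ∑ℤ.sum {p} (λ i → ∑ (λ y → φ (form x + toℕ i ×′ - form y))))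
        ≡⟨ ∑-cong (λ x → ≡.trans (≡.sym (∑-swap-sum {p} (λ y i → φ (form x + toℕ i ×′ - form y))))
             (≡.trans (∑-cong (λ y → ≡.trans (φ-progression (T-fixed _) (^p-neg (T-fixed _)))
               (cong (ℤ._* φ (form x)) (P*ind (form y)))))
             (∑-*ʳ (φ (form x)) (λ y → φ (form y) ℤ.+ 1ℤ)))) ⟩
      ∑ (λ x → ∑ (λ y → φ (form y) ℤ.+ 1ℤ) ℤ.* φ (form x))
        ≡⟨ ∑-*ˡ (∑ (λ y → φ (form y) ℤ.+ 1ℤ)) (λ x → φ (form x)) ⟩
      ∑ (λ y → φ (form y) ℤ.+ 1ℤ) ℤ.* S a
        ≡⟨ cong (ℤ._* S a) (≡.trans (∑-+ (λ y → φ (form y)) (λ _ → 1ℤ))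
             (cong (λ z → S a ℤ.+ z) (≡.trans (∑-const 1ℤ) (ℤ.*-identityʳ qℤ)))) ⟩
      (S a ℤ.+ qℤ) ℤ.* S a ∎′
    by-multiples : Z ≡ qℤ ℤ.* S a ℤ.+ P₁ ℤ.* X a
    by-multiples = sumℤ-head {k = p-1} (λ i → ∑ (λ x → ∑ (λ y → φ (form x + toℕ i ×′ - form y)))) p≡1+p-1 at0 at-i
      where
      at0 : ∀ (i : Fin p) → toℕ i ≡ 0 → ∑ (λ x → ∑ (λ y → φ (form x + toℕ i ×′ - form y))) ≡ qℤ ℤ.* S a
      at0 i i≡0 = ≡.trans (∑-cong (λ x → ≡.trans (∑-cong (λ y → φ-invariant (trans (+-congˡ (×-congˡ {x = - form y} i≡0)) (+-identityʳ _))))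
        (∑-const (φ (form x))))) (∑-*ˡ qℤ (λ x → φ (form x)))
      at-i : ∀ (i : Fin p) → toℕ i ≢ 0 → ∑ (λ x → ∑ (λ y → φ (form x + toℕ i ×′ - form y))) ≡ X a
      at-i i i≢0 = ∑-cong (λ x → ≡.sym (≡.trans
        (∑-scale (λ y≈z → φ-invariant (+-congˡ (-‿cong (form-cong y≈z)))) d≉0)
        (∑-cong (λ y → φ-invariant (+-congˡ (scaled y))))))
        where
        i×1≉0 : toℕ i ×′ 1# ≉0
        i×1≉0 eq = i≢0 (×1≈0⇒n≡0 (toℕ i) (toℕ<n i) eq)
        root = fixed⇒power i×1≉0 (×1^p (toℕ i))
        d = proj₁ root
        d≉0 : d ≉0
        d≉0 d≈0 = i×1≉0 (trans (proj₂ root) (^-≈0 p d≈0))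
        scaled : ∀ y → - form (d · y) ≈ toℕ i ×′ - form y
        scaled y = begin
          - T (a · (d · y) ^ suc p)              ≈⟨ -‿cong (T-cong (*-congˡ (^-distrib-* d y (suc p)))) ⟩
          - T (a · (d ^ suc p · y ^ suc p))      ≈⟨ -‿cong (T-cong (x·yz≈y·xz _ _ _)) ⟩
          - T (d ^ suc p · (a · y ^ suc p))      ≈⟨ -‿cong (T-cong (*-congʳ (sym (proj₂ root)))) ⟩
          - T ((toℕ i ×′ 1#) · (a · y ^ suc p))  ≈⟨ -‿cong (T-linear (×1^p (toℕ i)) _) ⟩
          - ((toℕ i ×′ 1#) · form y)             ≈⟨ -‿distribʳ-* _ _ ⟩
          (toℕ i ×′ 1#) · - form y               ≈⟨ ×-as-· (toℕ i) _ ⟨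
          toℕ i ×′ - form y                      ∎

  norm-+ : ∀ a u y → a · (u + y) ^ suc p ≈ a · u ^ suc p + (a · (u ^ p · y + u · y ^ p) + a · y ^ suc p)
  norm-+ a u y = trans (*-congˡ (*-congˡ (homo-+ frobenius u y)))
    (solve 5 (λ a u y v z → a :* ((u :+ y) :* (v :+ z)) := a :* (u :* v) :+ (a :* (v :* y :+ u :* z) :+ a :* (y :* z)))
      refl a u y (u ^ p) (y ^ p))
    where
    open import Algebra.Solver.Ring.NaturalCoefficients.Default commutativeSemiring using (solve; _:+_; _:*_; _:=_)

  module NonPower {a : Carrier} (a≉0 : a ≉0) (¬power : ¬ ∃ λ z → a ≈ z ^ suc p) where

    polar : Carrier → Carrier → Carrier
    polar u y = T (a · (u ^ p · y + u · y ^ p))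

    polar-additive : ∀ u → IsAdditive (polar u)
    polar-additive u = record
      { cong-≈ = λ x≈y → T-cong (*-congˡ (+-cong (*-congˡ x≈y) (*-congˡ (^-congˡ p x≈y))))
      ; homo-+ = λ x y → trans (T-cong (begin
          a · (u ^ p · (x + y) + u · (x + y) ^ p)
            ≈⟨ *-congˡ (+-cong (distribˡ _ _ _) (trans (*-congˡ (homo-+ frobenius x y)) (distribˡ _ _ _))) ⟩
          a · (u ^ p · x + u ^ p · y + (u · x ^ p + u · y ^ p))
            ≈⟨ *-congˡ (+-interchange _ _ _ _) ⟩
          a · (u ^ p · x + u · x ^ p + (u ^ p · y + u · y ^ p))
            ≈⟨ distribˡ _ _ _ ⟩
          a · (u ^ p · x + u · x ^ p) + a · (u ^ p · y + u · y ^ p) ∎)) (homo-+ T-additive _ _) }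

    -- If polar u vanishes then b = a uᵖ⁺¹ satisfies bᵖ ≈ - b, because the trace is Frobenius invariant.
    polar-nonzero : ∀ {u} → u ≉0 → ∃ λ y → polar u y ≉0
    polar-nonzero {u} u≉0 = ¬∀⇒∃¬ (λ x≈y → trans (cong-≈ (polar-additive u) (sym x≈y))) (λ y → polar u y ≟ 0#)
      λ polar≈0 → ¬power (a-power (negated⇒power b≉0 (b-negated (coefficient≈0 polar≈0))))
      where
      b = a · u ^ suc p
      b≉0 : b ≉0
      b≉0 = *-≉0 a≉0 (^-≉0 u≉0 (suc p))
      -- Frobenius invariance gives T(a uᵖ y) = T((a uᵖ)ᵖ yᵖ), after which `w` is the coefficient of
      -- yᵖ in `polar u y`. Since p-th powers exhaust the field, nondegeneracy of T applies to it.
      w = (a · u ^ p) ^ p + a · u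
      coefficient≈0 : (∀ y → polar u y ≈ 0#) → w ≈ 0#
      coefficient≈0 polar≈0 = T-nondegenerate w λ x → begin
        T (w · x)                              ≈⟨ T-cong (*-congˡ (root x)) ⟩
        T (w · (y x) ^ p)                      ≈⟨ T-cong (distribʳ _ _ _) ⟩
        T ((a · u ^ p) ^ p · y x ^ p + a · u · y x ^ p)
          ≈⟨ homo-+ T-additive _ _ ⟩
        T ((a · u ^ p) ^ p · y x ^ p) + T (a · u · y x ^ p)
          ≈⟨ +-cong (trans (T-cong (sym (^-distrib-* _ _ p))) (trans (T-^p _) (T-cong (*-assoc _ _ _)))) (T-cong (*-assoc _ _ _)) ⟩
        T (a · (u ^ p · y x)) + T (a · (u · y x ^ p))
          ≈⟨ homo-+ T-additive _ _ ⟨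
        T (a · (u ^ p · y x) + a · (u · y x ^ p))
          ≈⟨ T-cong (distribˡ _ _ _) ⟨
        polar u (y x)
          ≈⟨ polar≈0 (y x) ⟩
        0# ∎
        where
        y : Carrier → Carrier
        y x = x ^ (p ℕ.^ n)
        root : ∀ x → x ≈ y x ^ p
        root x = sym (trans (^-assocʳ x (p ℕ.^ n) p) (trans (^-congʳ x (≡.trans (ℕ.*-comm (p ℕ.^ n) p) (≡.sym q≡p^1+n))) (x^q≈x x)))
      b-negated : w ≈ 0# → b ^ p ≈ - b
      b-negated w≈0 = begin
        (a · (u · u ^ p)) ^ p           ≈⟨ ^-congˡ p (x·yz≈y·xz _ _ _) ⟩
        (u · (a · u ^ p)) ^ p           ≈⟨ ^-distrib-* _ _ p ⟩
        u ^ p · (a · u ^ p) ^ p         ≈⟨ *-congˡ (inverseˡ-unique _ _ w≈0) ⟩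
        u ^ p · - (a · u)               ≈⟨ -‿distribʳ-* _ _ ⟨
        - (u ^ p · (a · u))             ≈⟨ -‿cong (trans (x·yz≈y·xz _ _ _) (*-congˡ (*-comm _ _))) ⟩
        - (a · (u · u ^ p))             ∎
      a-power : (∃ λ z → b ≈ z ^ suc p) → ∃ λ z → a ≈ z ^ suc p
      a-power (z , b≈) = z · u ⁻¹ , (begin
        a                                    ≈⟨ *-identityʳ a ⟨
        a · 1#                               ≈⟨ *-congˡ (1^ (suc p)) ⟨
        a · 1# ^ suc p                       ≈⟨ *-congˡ (^-congˡ (suc p) (*-inverseʳ u u≉0)) ⟨
        a · (u · u ⁻¹) ^ suc p               ≈⟨ *-congˡ (^-distrib-* u (u ⁻¹) (suc p)) ⟩
        a · (u ^ suc p · (u ⁻¹) ^ suc p)     ≈⟨ *-assoc _ _ _ ⟨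
        b · (u ⁻¹) ^ suc p                   ≈⟨ *-congʳ b≈ ⟩
        z ^ suc p · (u ⁻¹) ^ suc p           ≈⟨ ^-distrib-* z (u ⁻¹) (suc p) ⟨
        (z · u ⁻¹) ^ suc p                   ∎)

    -- Substituting x = u + y turns the difference of the two forms into T(a uᵖ⁺¹) + `polar u y`,
    -- affine in y. For u ≉ 0 the linear part is not identically zero and the sum over y vanishes; u
    -- = 0 contributes q(p - 1).
    X≡ : X a ≡ qℤ ℤ.* P₁
    X≡ = begin′
      X a
        ≡⟨ ∑-swap (λ x y → φ (T (a · x ^ suc p) + - T (a · y ^ suc p))) ⟩
      ∑ (λ y → ∑ (λ x → φ (T (a · x ^ suc p) + - T (a · y ^ suc p))))
        ≡⟨ ∑-cong (λ y → ≡.trans (∑-translate (λ x≈z → φ-invariant (+-congʳ (form-cong x≈z))) y)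
             (∑-cong (λ u → φ-invariant (polarized u y)))) ⟩
      ∑ (λ y → ∑ (λ u → φ (T (a · u ^ suc p) + polar u y)))
        ≡⟨ ∑-swap (λ y u → φ (T (a · u ^ suc p) + polar u y)) ⟩
      ∑ (λ u → ∑ (λ y → φ (T (a · u ^ suc p) + polar u y)))
        ≡⟨ ∑-single inv 0# off ⟩
      ∑ (λ y → φ (T (a · 0# ^ suc p) + polar 0# y))
        ≡⟨ ∑-cong (λ y → ≡.trans (φ-≈0 (at-0 y)) P-1≡) ⟩
      ∑ (λ _ → P₁)
        ≡⟨ ∑-const P₁ ⟩
      qℤ ℤ.* P₁ ∎′
      where
      open ≡.≡-Reasoning renaming (begin_ to begin′_; _∎ to _∎′)
      polarized : ∀ u y → T (a · (u + y) ^ suc p) + - T (a · y ^ suc p) ≈ T (a · u ^ suc p) + polar u y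
      polarized u y = begin
        T (a · (u + y) ^ suc p) + - v            ≈⟨ +-congʳ (trans (T-cong (norm-+ a u y)) (trans (homo-+ T-additive _ _) (+-congˡ (homo-+ T-additive _ _)))) ⟩
        T (a · u ^ suc p) + (polar u y + v) + - v  ≈⟨ +-assoc _ _ _ ⟩
        T (a · u ^ suc p) + (polar u y + v + - v)  ≈⟨ +-congˡ (trans (+-assoc _ _ _) (trans (+-congˡ (-‿inverseʳ v)) (+-identityʳ _))) ⟩
        T (a · u ^ suc p) + polar u y            ∎
        where v = T (a · y ^ suc p)
      inv : Invariant (λ u → ∑ (λ y → φ (T (a · u ^ suc p) + polar u y)))
      inv u≈v = ∑-cong (λ y → φ-invariant (+-cong (form-cong u≈v)
        (T-cong (*-congˡ (+-cong (*-congʳ (^-congˡ p u≈v)) (*-congʳ u≈v))))))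
      off : ∀ u → ¬ u ≈ 0# → ∑ (λ y → φ (T (a · u ^ suc p) + polar u y)) ≡ 0ℤ
      off u u≉0 = orthogonality-all (polar-additive u) (λ _ → T-fixed _) (proj₁ (polar-nonzero u≉0)) (proj₂ (polar-nonzero u≉0)) (T-fixed _)
      at-0 : ∀ y → T (a · 0# ^ suc p) + polar 0# y ≈ 0#
      at-0 y = trans (+-cong (trans (T-cong (trans (*-congˡ (^-≈0 p refl)) (zeroʳ a))) T0≈0)
        (trans (T-cong (trans (*-congˡ (trans (+-cong (trans (*-congʳ 0^p≈0) (zeroˡ y)) (zeroˡ _)) (+-identityʳ 0#))) (zeroʳ a))) T0≈0))
        (+-identityʳ 0#)

    L′ : ℕ
    L′ = 2 ℕ.* L

    block : ℤ
    block = ∑ℤ.sum {L′} (λ j → e (a · (g ^ toℕ j) ^ suc p))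

    -- y ↦ e (a yᵖ⁺¹) only depends on the class of y modulo the (p² - 1)-th roots of unity.
    S-blocks : S a ≡ P₁ ℤ.+ P₁ ℤ.* ℤ.+ suc p ℤ.* block
    S-blocks = ≡.trans (∑-powers (λ x≈y → φ-invariant (form-cong x≈y))) (cong₂ ℤ._+_
      (≡.trans (e-≈0 (trans (*-congˡ (^-≈0 p refl)) (zeroʳ a))) P-1≡)
      (≡.trans (≡.subst (λ M → ∑ℤ.sum {M} (f ∘ toℕ) ≡ ℤ.+ (p-1 ℕ.* suc p) ℤ.* block)
        (≡.trans (ℕ.*-assoc p-1 (suc p) L′) N≡) (sumℤ-periodic (p-1 ℕ.* suc p) L′ f periodic))
        (cong (ℤ._* block) (ℤ.pos-* p-1 (suc p)))))
      where
      f : ℕ → ℤ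
      f j = e (a · (g ^ j) ^ suc p)
      z = (g ^ L′) ^ suc p
      z≉0 : z ≉0
      z≉0 = ^-≉0 (^-≉0 g≉0 L′) (suc p)
      z-fixed : z ^ p ≈ z
      z-fixed = begin
        z ^ p             ≈⟨ ^p≈·^p-1 z ⟩
        z · z ^ p-1       ≈⟨ *-congˡ (begin
          z ^ p-1                            ≈⟨ ^-congˡ p-1 (^-assocʳ g L′ (suc p)) ⟩
          (g ^ (L′ ℕ.* suc p)) ^ p-1         ≈⟨ ^-assocʳ g (L′ ℕ.* suc p) p-1 ⟩
          g ^ (L′ ℕ.* suc p ℕ.* p-1)         ≈⟨ ^-congʳ g (≡.trans (ℕ.*-comm (L′ ℕ.* suc p) p-1) (≡.trans (cong (p-1 ℕ.*_) (ℕ.*-comm L′ (suc p))) N≡)) ⟩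
          g ^ N                              ≈⟨ g^N≈1 ⟩
          1#                                 ∎) ⟩
        z · 1#            ≈⟨ *-identityʳ z ⟩
        z                 ∎
      periodic : ∀ j → f (L′ ℕ.+ j) ≡ f j
      periodic j = ≡.trans (φ-invariant (begin
        T (a · (g ^ (L′ ℕ.+ j)) ^ suc p)       ≈⟨ T-cong (*-congˡ (trans (^-congˡ (suc p) (^-homo-* g L′ j)) (^-distrib-* (g ^ L′) (g ^ j) (suc p)))) ⟩
        T (a · (z · (g ^ j) ^ suc p))          ≈⟨ T-cong (x·yz≈y·xz _ _ _) ⟩
        T (z · (a · (g ^ j) ^ suc p))          ≈⟨ T-linear z-fixed _ ⟩
        z · T (a · (g ^ j) ^ suc p)            ∎)) (φ-scale z≉0 _)

    S≡ : S a ≡ P₁ ℤ.* Q₁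
    S≡ = [ ℤ.i-j≡0⇒i≡j (S a) (P₁ ℤ.* Q₁) , (λ S+R≡0 → ⊥-elim (not-negative S+R≡0)) ]′
      (ℤ.i*j≡0⇒i≡0∨j≡0 (S a ℤ.- P₁ ℤ.* Q₁) (difference-of-squares (S a) P₁ Q₁
        (≡.trans (S²≡P₁X a) (cong (P₁ ℤ.*_) (≡.trans X≡ (cong (ℤ._* P₁) (≡.trans (cong ℤ.+_ q≡Q²) (ℤ.pos-* Q Q))))))))
      where
      Q₁≡ : Q₁ ≡ 1ℤ ℤ.+ P₁ ℤ.* ℤ.+ suc p ℤ.* ℤ.+ t
      Q₁≡ = ≡.trans (cong ℤ.+_ Q≡) (cong (λ z → 1ℤ ℤ.+ z)
        (≡.trans (ℤ.pos-* (p-1 ℕ.* suc p) t) (cong (ℤ._* ℤ.+ t) (ℤ.pos-* p-1 (suc p)))))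
      not-negative : ¬ S a ℤ.+ P₁ ℤ.* Q₁ ≡ 0ℤ
      not-negative S+R≡0 = ℕ.<⇒≱ 1<p (ℕ.s≤s⁻¹ (∣⇒≤ (divides-2
        (divide P₁ (ℤ.+ suc p) block (ℤ.+ t) (λ eq → P-1≢0 (≡.trans P-1≡ eq)) S-blocks Q₁≡ S+R≡0))))

-- Unions of two adjacent quartic classes and their character sums.

%4<2-flip : ∀ m → (m % 4 ℕ.< 2 × ¬ (2 ℕ.+ m) % 4 ℕ.< 2) ⊎ (¬ m % 4 ℕ.< 2 × (2 ℕ.+ m) % 4 ℕ.< 2)
%4<2-flip 0 = inj₁ (s≤s z≤n , λ { (s≤s (s≤s ())) })
%4<2-flip 1 = inj₁ (s≤s (s≤s z≤n) , λ { (s≤s (s≤s ())) })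
%4<2-flip 2 = inj₂ ((λ { (s≤s (s≤s ())) }) , s≤s z≤n)
%4<2-flip 3 = inj₂ ((λ { (s≤s (s≤s ())) }) , s≤s (s≤s z≤n))
%4<2-flip (suc (suc (suc (suc m)))) = %4<2-flip m

%4-cong-+ : ∀ k {i j} → i % 4 ≡ j % 4 → (k ℕ.+ i) % 4 ≡ (k ℕ.+ j) % 4
%4-cong-+ k {i} {j} eq = ≡.trans (%-distribˡ-+ k i 4)
  (≡.trans (cong (λ r → (k % 4 ℕ.+ r) % 4) eq) (≡.sym (%-distribˡ-+ k j 4)))

module _ where
  open ℤ-Solver using (solve; _:+_; _:*_; _:-_; :-_; _:=_; con)

  -- The hypothesis amounts to (q - 1)θ = sP(Q - 1), where q - 1 = 2s. In the averaging, q - 1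
  -- values of y give θ each and y = 0 gives sP.
  average : ∀ q θ s P Q → q ≢ 1ℤ → ℤ.+ 2 ℤ.* s ≡ q ℤ.- 1ℤ →
    q ℤ.* θ ℤ.+ (s ℤ.* P ℤ.- θ) ≡ s ℤ.* (P ℤ.* Q) → ℤ.+ 2 ℤ.* θ ≡ P ℤ.* (Q ℤ.- 1ℤ)
  average q θ s P Q q≢1 2s≡ eq = ℤ.i-j≡0⇒i≡j (ℤ.+ 2 ℤ.* θ) _ (*-≡0-cancelˡ {q ℤ.- 1ℤ} (q≢1 ∘ ℤ.i-j≡0⇒i≡j q 1ℤ) (≡.trans
    (≡.trans
      (solve 4 (λ q θ P Q → (q :- con 1ℤ) :* (con (ℤ.+ 2) :* θ :- P :* (Q :- con 1ℤ)) :=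
        con (ℤ.+ 2) :* (q :* θ :- θ) :- (q :- con 1ℤ) :* (P :* (Q :- con 1ℤ))) ≡.refl q θ P Q)
      (cong (λ z → ℤ.+ 2 ℤ.* (q ℤ.* θ ℤ.- θ) ℤ.- z ℤ.* (P ℤ.* (Q ℤ.- 1ℤ))) (≡.sym 2s≡)))
    (≡.trans
      (solve 5 (λ q θ s P Q → con (ℤ.+ 2) :* (q :* θ :- θ) :- con (ℤ.+ 2) :* s :* (P :* (Q :- con 1ℤ)) :=
        con (ℤ.+ 2) :* ((q :* θ :+ (s :* P :- θ)) :- s :* (P :* Q))) ≡.refl q θ s P Q)
      (≡.trans (cong (λ z → ℤ.+ 2 ℤ.* (z ℤ.- s ℤ.* (P ℤ.* Q))) eq)
        (solve 1 (λ z → con (ℤ.+ 2) :* (z :- z) := con 0ℤ) ≡.refl (s ℤ.* (P ℤ.* Q)))))))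

  double : ∀ x → ℤ.+ 2 ℤ.* x ≡ x ℤ.+ x
  double = solve 1 (λ x → con (ℤ.+ 2) :* x := x :+ x) ≡.refl

  -- This and the next two identities fit the three values of 2Θ, namely P(Q² - 1), P(Q - 1) and
  -- -P(Q + 1), into one formula linear in the indicators of u = 0 and of u⁻¹ outside the set, so
  -- that it can be summed over a subgroup.
  value-at-0 : ∀ P Q → P ℤ.* (Q ℤ.* Q ℤ.- 1ℤ) ≡
    P ℤ.* (ℤ.+ 2 ℤ.* Q ℤ.* 0ℤ ℤ.- (Q ℤ.+ 1ℤ) ℤ.+ 1ℤ ℤ.* ((Q ℤ.+ 1ℤ) ℤ.* Q))
  value-at-0 = solve 2 (λ P Q → P :* (Q :* Q :- con 1ℤ) :=
    P :* (con (ℤ.+ 2) :* Q :* con 0ℤ :- (Q :+ con 1ℤ) :+ con 1ℤ :* ((Q :+ con 1ℤ) :* Q))) ≡.refl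

  value-off : ∀ P Q → P ℤ.* (Q ℤ.- 1ℤ) ≡
    P ℤ.* (ℤ.+ 2 ℤ.* Q ℤ.* 1ℤ ℤ.- (Q ℤ.+ 1ℤ) ℤ.+ 0ℤ ℤ.* ((Q ℤ.+ 1ℤ) ℤ.* Q))
  value-off = solve 2 (λ P Q → P :* (Q :- con 1ℤ) :=
    P :* (con (ℤ.+ 2) :* Q :* con 1ℤ :- (Q :+ con 1ℤ) :+ con 0ℤ :* ((Q :+ con 1ℤ) :* Q))) ≡.refl

  value-on : ∀ P Q θ θ′ → θ ℤ.+ θ′ ≡ ℤ.- P → ℤ.+ 2 ℤ.* θ′ ≡ P ℤ.* (Q ℤ.- 1ℤ) → ℤ.+ 2 ℤ.* θ ≡
    P ℤ.* (ℤ.+ 2 ℤ.* Q ℤ.* 0ℤ ℤ.- (Q ℤ.+ 1ℤ) ℤ.+ 0ℤ ℤ.* ((Q ℤ.+ 1ℤ) ℤ.* Q))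
  value-on P Q θ θ′ sum≡ eq = ≡.trans
    (solve 2 (λ θ θ′ → con (ℤ.+ 2) :* θ := con (ℤ.+ 2) :* (θ :+ θ′) :- con (ℤ.+ 2) :* θ′) ≡.refl θ θ′)
    (≡.trans (cong₂ (λ x y → ℤ.+ 2 ℤ.* x ℤ.- y) sum≡ eq)
    (solve 2 (λ P Q → con (ℤ.+ 2) :* (:- P) :- P :* (Q :- con 1ℤ) :=
      P :* (con (ℤ.+ 2) :* Q :* con 0ℤ :- (Q :+ con 1ℤ) :+ con 0ℤ :* ((Q :+ con 1ℤ) :* Q))) ≡.refl P Q))

  distribute : ∀ i Q d z → i ℤ.* (ℤ.+ 2 ℤ.* Q ℤ.* d ℤ.- (Q ℤ.+ 1ℤ) ℤ.+ z ℤ.* ((Q ℤ.+ 1ℤ) ℤ.* Q)) ≡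
    ℤ.+ 2 ℤ.* Q ℤ.* (i ℤ.* d) ℤ.+ (ℤ.- (Q ℤ.+ 1ℤ) ℤ.* i ℤ.+ (Q ℤ.+ 1ℤ) ℤ.* Q ℤ.* (i ℤ.* z))
  distribute = solve 4 (λ i Q d z → i :* (con (ℤ.+ 2) :* Q :* d :- (Q :+ con 1ℤ) :+ z :* ((Q :+ con 1ℤ) :* Q)) :=
    con (ℤ.+ 2) :* Q :* (i :* d) :+ (:- (Q :+ con 1ℤ) :* i :+ (Q :+ con 1ℤ) :* Q :* (i :* z))) ≡.refl

  isolate : ∀ Q w s → ℤ.+ 2 ℤ.* Q ℤ.* w ℤ.+ (ℤ.- (Q ℤ.+ 1ℤ) ℤ.* s ℤ.+ (Q ℤ.+ 1ℤ) ℤ.* Q ℤ.* 1ℤ) ≡ 0ℤ →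
    ℤ.+ 2 ℤ.* Q ℤ.* w ≡ (Q ℤ.+ 1ℤ) ℤ.* (s ℤ.- Q)
  isolate Q w s eq = ≡.trans
    (solve 3 (λ Q w s → con (ℤ.+ 2) :* Q :* w :=
      (con (ℤ.+ 2) :* Q :* w :+ (:- (Q :+ con 1ℤ) :* s :+ (Q :+ con 1ℤ) :* Q :* con 1ℤ)) :+ (Q :+ con 1ℤ) :* (s :- Q)) ≡.refl Q w s)
    (≡.trans (cong (λ z → z ℤ.+ (Q ℤ.+ 1ℤ) ℤ.* (s ℤ.- Q)) eq) (ℤ.+-identityˡ _))

module HalfSets {c ℓ} (F : Field c ℓ) (N : ℕ) (card : HasCardinality (Field.setoid F) (suc N))
  (g : Field.Carrier F) (g-prim : IsPrimitiveRoot F g)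
  (p : ℕ) (p-prime : Prime p) (n : ℕ) (q≡p^1+n : suc N ≡ p ℕ.^ suc n)
  (L : ℕ) (N≡ : ℕ.pred p ℕ.* (suc p ℕ.* (2 ℕ.* L)) ≡ N)
  (Q t : ℕ) (q≡Q² : suc N ≡ Q ℕ.* Q) (Q≡ : Q ≡ suc (ℕ.pred p ℕ.* suc p ℕ.* t))
  (4∣1+p : 4 ∣ suc p) where

  open QuadraticSums F N card g g-prim p p-prime n q≡p^1+n L N≡ Q t q≡Q² Q≡ public

  4∣N : 4 ∣ N
  4∣N = ≡.subst (4 ∣_) N≡ (∣n⇒∣m*n p-1 (∣m⇒∣m*n (2 ℕ.* L) 4∣1+p))

  +-4∣-% : ∀ i {k} → 4 ∣ k → (i ℕ.+ k) % 4 ≡ i % 4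
  +-4∣-% i (divides k ≡.refl) = [m+kn]%n≡m%n i k 4

  g^≈⇒%4≡ : ∀ i j → g ^ i ≈ g ^ j → i % 4 ≡ j % 4
  g^≈⇒%4≡ i j eq = [ (λ i≤j → ≡.sym (go i≤j eq)) , (λ j≤i → go j≤i (sym eq)) ]′ (ℕ.≤-total i j)
    where
    go : ∀ {i j} → i ℕ.≤ j → g ^ i ≈ g ^ j → j % 4 ≡ i % 4
    go {i} {j} i≤j eq = ≡.trans (cong (_% 4) (≡.sym (ℕ.m+[n∸m]≡n i≤j)))
      (+-4∣-% i (∣-trans 4∣N (g^m≈1⇒N∣m (j ℕ.∸ i) (^-≤ g≉0 i≤j eq))))

  -- H k is the union of the two quartic classes of exponents j ≡ -k, 1 - k (mod 4).
  H : ℕ → Pred Carrier ℓ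
  H k x = ∃ λ j → x ≈ g ^ j × (k ℕ.+ j) % 4 ℕ.< 2

  H-resp : ∀ k → H k Respects _≈_
  H-resp k x≈y (j , x≈ , lt) = j , trans (sym x≈y) x≈ , lt

  H-≉0 : ∀ k {x} → H k x → x ≉0
  H-≉0 k (j , x≈ , _) x≈0 = ^-≉0 g≉0 j (trans (sym x≈) x≈0)

  H-exponent : ∀ k {x} j → x ≈ g ^ j → H k x → (k ℕ.+ j) % 4 ℕ.< 2
  H-exponent k j x≈ (j′ , x≈′ , lt) =
    ≡.subst (ℕ._< 2) (%4-cong-+ k {j′} {j} (g^≈⇒%4≡ j′ j (trans (sym x≈′) x≈))) lt

  H-disjoint : ∀ k {x} → H k x → ¬ H (2 ℕ.+ k) x
  H-disjoint k (j , x≈ , lt) Hx′ with %4<2-flip (k ℕ.+ j)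
  ... | inj₁ (_ , ¬lt) = ¬lt (H-exponent (2 ℕ.+ k) j x≈ Hx′)
  ... | inj₂ (¬lt , _) = ¬lt lt

  H-cover : ∀ k {x} → x ≉0 → H k x ⊎ H (2 ℕ.+ k) x
  H-cover k x≉0 with %4<2-flip (k ℕ.+ log x≉0)
  ... | inj₁ (lt , _) = inj₁ (log x≉0 , g^log x≉0 , lt)
  ... | inj₂ (_ , lt) = inj₂ (log x≉0 , g^log x≉0 , lt)

  abstract
    H? : ∀ k → Decidable (H k)
    H? k x with x ≟ 0#
    ... | yes x≈0 = no λ Hx → H-≉0 k Hx x≈0
    ... | no x≉0 with H-cover k x≉0
    ...   | inj₁ Hx  = yes Hx
    ...   | inj₂ Hx′ = no λ Hx → H-disjoint k Hx Hx′

  -- As 4 divides p + 1, multiplying by zᵖ⁺¹ does not change the exponent modulo 4.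
  H-scale : ∀ k {x z} → z ≉0 → H k x → H k (z ^ suc p · x)
  H-scale k {x} {z} z≉0 (j , x≈ , lt) = j ℕ.+ log z≉0 ℕ.* suc p , (begin
    z ^ suc p · x                                ≈⟨ *-cong (^-congˡ (suc p) (g^log z≉0)) x≈ ⟩
    (g ^ log z≉0) ^ suc p · g ^ j                ≈⟨ *-congʳ (^-assocʳ g (log z≉0) (suc p)) ⟩
    g ^ (log z≉0 ℕ.* suc p) · g ^ j              ≈⟨ *-comm _ _ ⟩
    g ^ j · g ^ (log z≉0 ℕ.* suc p)              ≈⟨ ^-homo-* g j _ ⟨
    g ^ (j ℕ.+ log z≉0 ℕ.* suc p)                ∎) ,
    ≡.subst (ℕ._< 2) (%4-cong-+ k {j} {j ℕ.+ log z≉0 ℕ.* suc p}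
      (≡.sym (+-4∣-% j (∣n⇒∣m*n (log z≉0) 4∣1+p)))) lt

  H-unscale : ∀ k {x z} → z ≉0 → H k (z ^ suc p · x) → H k x
  H-unscale k {x} {z} z≉0 Hzx = H-resp k (begin
    (z ⁻¹) ^ suc p · (z ^ suc p · x)    ≈⟨ *-assoc _ _ _ ⟨
    (z ⁻¹) ^ suc p · z ^ suc p · x      ≈⟨ *-congʳ (^-distrib-* (z ⁻¹) z (suc p)) ⟨
    (z ⁻¹ · z) ^ suc p · x              ≈⟨ *-congʳ (trans (^-congˡ (suc p) (*-inverseˡ z≉0)) (1^ (suc p))) ⟩
    1# · x                              ≈⟨ *-identityˡ x ⟩
    x                                   ∎) (H-scale k (⁻¹-≉0 z≉0) Hzx)

  indH : ℕ → Carrier → ℤ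
  indH k x = ind (H? k x)

  indH-invariant : ∀ k → Invariant (indH k)
  indH-invariant k = ind-invariant (H-resp k) (H? k)

  indH-sum : ∀ k x → indH k x ℤ.+ indH (2 ℕ.+ k) x ≡ 1ℤ ℤ.- ind (x ≟ 0#)
  indH-sum k x with x ≟ 0#
  ... | yes x≈0 = cong₂ ℤ._+_ (ind-no (H? k x) (λ Hx → H-≉0 k Hx x≈0)) (ind-no (H? (2 ℕ.+ k) x) (λ Hx → H-≉0 (2 ℕ.+ k) Hx x≈0))
  ... | no x≉0 with H-cover k x≉0
  ...   | inj₁ Hx = cong₂ ℤ._+_ (ind-yes (H? k x) Hx) (ind-no (H? (2 ℕ.+ k) x) (H-disjoint k Hx))
  ...   | inj₂ Hx′ = cong₂ ℤ._+_ (ind-no (H? k x) (λ Hx → H-disjoint k Hx Hx′)) (ind-yes (H? (2 ℕ.+ k) x) Hx′)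

  size-H-flip : ∀ k → size (H? k) ≡ size (H? (2 ℕ.+ k))
  size-H-flip k = ≡.trans (∑-scale (indH-invariant k) (^-≉0 g≉0 2))
    (∑-cong λ x → ind-⇔ (H? k _) (H? (2 ℕ.+ k) x) (from x) to)
    where
    shift : ∀ j → (k ℕ.+ (2 ℕ.+ j)) ≡ 2 ℕ.+ k ℕ.+ j
    shift j = ≡.trans (ℕ.+-suc k (suc j)) (cong suc (ℕ.+-suc k j))
    to : ∀ {x} → H (2 ℕ.+ k) x → H k (g ^ 2 · x)
    to (j , x≈ , lt) = 2 ℕ.+ j , trans (*-congˡ x≈) (sym (^-homo-* g 2 j)) , ≡.subst (λ m → m % 4 ℕ.< 2) (≡.sym (shift j)) lt
    from : ∀ x → H k (g ^ 2 · x) → H (2 ℕ.+ k) x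
    from x Hgx = log x≉0 , g^log x≉0 , ≡.subst (λ m → m % 4 ℕ.< 2) (shift (log x≉0))
      (H-exponent k (2 ℕ.+ log x≉0) (trans (*-congˡ (g^log x≉0)) (sym (^-homo-* g 2 (log x≉0)))) Hgx)
      where
      x≉0 : x ≉0
      x≉0 x≈0 = H-≉0 k Hgx (trans (*-congˡ x≈0) (zeroʳ _))

  ∑-ind-0 : ∀ {f} → Invariant f → ∑ (λ x → ind (x ≟ 0#) ℤ.* f x) ≡ f 0#
  ∑-ind-0 {f} f-inv = ≡.trans
    (∑-single (λ x≈y → cong₂ ℤ._*_ (ind-⇔ (_ ≟ 0#) (_ ≟ 0#) (trans (sym x≈y)) (trans x≈y)) (f-inv x≈y)) 0#
      (λ x x≉0 → ≡.trans (cong (ℤ._* f x) (ind-no (x ≟ 0#) x≉0)) (ℤ.*-zeroˡ (f x))))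
    (≡.trans (cong (ℤ._* f 0#) (ind-yes (0# ≟ 0#) refl)) (ℤ.*-identityˡ (f 0#)))

  2*size-H : ∀ k → ℤ.+ 2 ℤ.* size (H? k) ≡ qℤ ℤ.- 1ℤ
  2*size-H k = begin′
    ℤ.+ 2 ℤ.* size (H? k)
      ≡⟨ double (size (H? k)) ⟩
    size (H? k) ℤ.+ size (H? k)
      ≡⟨ cong (λ z → size (H? k) ℤ.+ z) (size-H-flip k) ⟩
    size (H? k) ℤ.+ size (H? (2 ℕ.+ k))
      ≡⟨ ∑-+ (indH k) (indH (2 ℕ.+ k)) ⟨
    ∑ (λ x → indH k x ℤ.+ indH (2 ℕ.+ k) x)
      ≡⟨ ∑-cong (λ x → ≡.trans (indH-sum k x) (cong (λ z → 1ℤ ℤ.+ z) (negate (ind (x ≟ 0#))))) ⟩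
    ∑ (λ x → 1ℤ ℤ.+ ind (x ≟ 0#) ℤ.* ℤ.-1ℤ)
      ≡⟨ ∑-+ (λ _ → 1ℤ) (λ x → ind (x ≟ 0#) ℤ.* ℤ.-1ℤ) ⟩
    ∑ (λ _ → 1ℤ) ℤ.+ ∑ (λ x → ind (x ≟ 0#) ℤ.* ℤ.-1ℤ)
      ≡⟨ cong₂ ℤ._+_ (≡.trans (∑-const 1ℤ) (ℤ.*-identityʳ qℤ)) (∑-ind-0 {λ _ → ℤ.-1ℤ} (λ _ → ≡.refl)) ⟩
    qℤ ℤ.- 1ℤ ∎′
    where
    open ≡.≡-Reasoning renaming (begin_ to begin′_; _∎ to _∎′)
    negate : ∀ i → ℤ.- i ≡ i ℤ.* ℤ.-1ℤ
    negate i = ≡.trans (≡.sym (ℤ.-1*i≡-i i)) (ℤ.*-comm ℤ.-1ℤ i)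

  -- Because nonzero elements of 𝔽_p are fourth powers, this is p - 1 times the eigenvalue at u of
  -- the Cayley graph with connection set `H k`.
  Θ : ℕ → Carrier → ℤ
  Θ k u = ∑ (λ x → indH k x ℤ.* e (u · x))

  Θ-≈0 : ∀ k {u} → u ≈ 0# → Θ k u ≡ size (H? k) ℤ.* P₁
  Θ-≈0 k u≈0 = ≡.trans (∑-cong (λ x → cong (indH k x ℤ.*_) (≡.trans (e-≈0 (trans (*-congʳ u≈0) (zeroˡ x))) P-1≡)))
    (∑-*ʳ P₁ (indH k))

  qℤ≢1 : qℤ ≢ 1ℤ
  qℤ≢1 eq = ℕ.≢-nonZero⁻¹ N (ℕ.suc-injective (ℤ.+-injective eq))

  -- Averaging over x ↦ yᵖ⁺¹ x, which preserves H k, turns Θ into the quadratic sums S.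
  2Θ-off : ∀ k {u} → u ≉0 → ¬ H k (u ⁻¹) → ℤ.+ 2 ℤ.* Θ k u ≡ P₁ ℤ.* (Q₁ ℤ.- 1ℤ)
  2Θ-off k {u} u≉0 ¬Hu⁻¹ = average qℤ (Θ k u) (size (H? k)) P₁ Q₁ qℤ≢1 (2*size-H k) (≡.trans (≡.sym by-y) by-x)
    where
    open ≡.≡-Reasoning renaming (begin_ to begin′_; _∎ to _∎′)
    term : Carrier → Carrier → ℤ
    term x y = indH k x ℤ.* e (u · x · y ^ suc p)
    by-x : ∑ (λ y → ∑ (λ x → term x y)) ≡ size (H? k) ℤ.* (P₁ ℤ.* Q₁)
    by-x = ≡.trans (∑-swap (λ y x → term x y)) (≡.trans (∑-cong inner) (∑-*ʳ (P₁ ℤ.* Q₁) (indH k)))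
      where
      -- If ux = zᵖ⁺¹, then x and u⁻¹ differ by a (p+1)-th power, so u⁻¹ would lie in `H k` along
      -- with x. This is the only place where the position of u⁻¹ matters.
      ¬power : ∀ {x} → H k x → ¬ ∃ λ z → u · x ≈ z ^ suc p
      ¬power {x} Hx (z , ux≈) = ¬Hu⁻¹ (H-unscale k z≉0 (H-resp k (begin
        x                      ≈⟨ *-identityˡ x ⟨
        1# · x                 ≈⟨ *-congʳ (*-inverseˡ u≉0) ⟨
        u ⁻¹ · u · x           ≈⟨ *-assoc _ _ _ ⟩
        u ⁻¹ · (u · x)         ≈⟨ *-congˡ ux≈ ⟩
        u ⁻¹ · z ^ suc p       ≈⟨ *-comm _ _ ⟩
        z ^ suc p · u ⁻¹       ∎) Hx))
        where
        z≉0 : z ≉0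
        z≉0 z≈0 = *-≉0 u≉0 (H-≉0 k Hx) (trans ux≈ (^-≈0 p z≈0))
      inner : ∀ x → ∑ (λ y → term x y) ≡ indH k x ℤ.* (P₁ ℤ.* Q₁)
      inner x = ≡.trans (∑-*ˡ (indH k x) (λ y → e (u · x · y ^ suc p))) (by-cases (H? k x))
        where
        by-cases : (d : Dec (H k x)) → ind d ℤ.* S (u · x) ≡ ind d ℤ.* (P₁ ℤ.* Q₁)
        by-cases (yes Hx) = cong (1ℤ ℤ.*_) (NonPower.S≡ (*-≉0 u≉0 (H-≉0 k Hx)) (¬power Hx))
        by-cases (no _)   = ≡.trans (ℤ.*-zeroˡ (S (u · x))) (≡.sym (ℤ.*-zeroˡ (P₁ ℤ.* Q₁)))
    -- For y ≉ 0 the substitution x ↦ yᵖ⁺¹x gives back Θ; at y = 0 every e-value is p - 1, and the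
    -- second summand corrects for that one column.
    column : ∀ y → ∑ (λ x → term x y) ≡ Θ k u ℤ.+ ind (y ≟ 0#) ℤ.* (size (H? k) ℤ.* P₁ ℤ.- Θ k u)
    column y with y ≟ 0#
    ... | yes y≈0 = ≡.trans (≡.trans (∑-cong (λ x → cong (indH k x ℤ.*_) (≡.trans (e-≈0 (trans (*-congˡ (^-≈0 p y≈0)) (zeroʳ _))) P-1≡)))
      (∑-*ʳ P₁ (indH k))) (add-difference (Θ k u) (size (H? k) ℤ.* P₁))
      where
      add-difference : ∀ x y → y ≡ x ℤ.+ 1ℤ ℤ.* (y ℤ.- x)
      add-difference x y = solve 2 (λ x y → y := x :+ con 1ℤ :* (y :- x)) ≡.refl x y
        where open ℤ-Solver using (solve; _:+_; _:*_; _:-_; _:=_; con)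
    ... | no y≉0 = ≡.trans (≡.sym (≡.trans
      (∑-scale (λ x≈z → cong₂ ℤ._*_ (indH-invariant k x≈z) (e-invariant (*-congˡ x≈z))) (^-≉0 y≉0 (suc p)))
      (∑-cong (λ x → cong₂ ℤ._*_ (ind-⇔ (H? k _) (H? k x) (H-unscale k y≉0) (H-scale k y≉0))
        (e-invariant (trans (sym (*-assoc _ _ _)) (xy·z≈xz·y _ _ _)))))))
      (≡.sym (≡.trans (cong (λ z → Θ k u ℤ.+ z) (ℤ.*-zeroˡ (size (H? k) ℤ.* P₁ ℤ.- Θ k u))) (ℤ.+-identityʳ _)))
    by-y : ∑ (λ y → ∑ (λ x → term x y)) ≡ qℤ ℤ.* Θ k u ℤ.+ (size (H? k) ℤ.* P₁ ℤ.- Θ k u)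
    by-y = ≡.trans (∑-cong column) (≡.trans (∑-+ (λ _ → Θ k u) (λ y → ind (y ≟ 0#) ℤ.* (size (H? k) ℤ.* P₁ ℤ.- Θ k u)))
      (cong₂ ℤ._+_ (∑-const (Θ k u)) (∑-ind-0 {λ _ → size (H? k) ℤ.* P₁ ℤ.- Θ k u} (λ _ → ≡.refl))))

  -- The two sets partition the nonzero elements, and the sum of e(ux) over the whole field is 0, so
  -- only minus the term at x = 0 remains.
  Θ-sum : ∀ k {u} → u ≉0 → Θ k u ℤ.+ Θ (2 ℕ.+ k) u ≡ ℤ.- P₁
  Θ-sum k {u} u≉0 = begin′
    Θ k u ℤ.+ Θ (2 ℕ.+ k) u
      ≡⟨ ∑-+ (λ x → indH k x ℤ.* e (u · x)) (λ x → indH (2 ℕ.+ k) x ℤ.* e (u · x)) ⟨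
    ∑ (λ x → indH k x ℤ.* e (u · x) ℤ.+ indH (2 ℕ.+ k) x ℤ.* e (u · x))
      ≡⟨ ∑-cong (λ x → ≡.trans (≡.sym (ℤ.*-distribʳ-+ (e (u · x)) (indH k x) (indH (2 ℕ.+ k) x)))
           (≡.trans (cong (ℤ._* e (u · x)) (indH-sum k x)) (expand (ind (x ≟ 0#)) (e (u · x))))) ⟩
    ∑ (λ x → e (u · x) ℤ.+ ind (x ≟ 0#) ℤ.* (ℤ.- e (u · x)))
      ≡⟨ ∑-+ (λ x → e (u · x)) (λ x → ind (x ≟ 0#) ℤ.* (ℤ.- e (u · x))) ⟩
    ∑ (λ x → e (u · x)) ℤ.+ ∑ (λ x → ind (x ≟ 0#) ℤ.* (ℤ.- e (u · x)))
      ≡⟨ cong₂ ℤ._+_ (∑-e-scaled u≉0) (∑-ind-0 {λ x → ℤ.- e (u · x)} (λ x≈y → cong ℤ.-_ (e-invariant (*-congˡ x≈y)))) ⟩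
    0ℤ ℤ.+ ℤ.- e (u · 0#)
      ≡⟨ ≡.trans (ℤ.+-identityˡ _) (cong ℤ.-_ (≡.trans (e-≈0 (zeroʳ u)) P-1≡)) ⟩
    ℤ.- P₁ ∎′
    where
    open ≡.≡-Reasoning renaming (begin_ to begin′_; _∎ to _∎′)
    expand : ∀ i x → (1ℤ ℤ.- i) ℤ.* x ≡ x ℤ.+ i ℤ.* (ℤ.- x)
    expand = solve 2 (λ i x → (con 1ℤ :- i) :* x := x :+ i :* (:- x)) ≡.refl
      where open ℤ-Solver using (solve; _:+_; _:*_; _:-_; :-_; _:=_; con)

  module _ (k : ℕ) where

    Outside : Pred Carrier ℓ
    Outside u = u ≉0 × H (2 ℕ.+ k) (u ⁻¹)

    outside? : Decidable Outside
    outside? u = ¬? (u ≟ 0#) ×-dec H? (2 ℕ.+ k) (u ⁻¹)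

    Outside-resp : Outside Respects _≈_
    Outside-resp u≈v (u≉0 , Hu) = ≉0-cong u≈v u≉0 , H-resp (2 ℕ.+ k) (⁻¹-cong u≈v) Hu

    2Θ : ∀ u → ℤ.+ 2 ℤ.* Θ k u ≡
      P₁ ℤ.* (ℤ.+ 2 ℤ.* Q₁ ℤ.* ind (outside? u) ℤ.- (Q₁ ℤ.+ 1ℤ) ℤ.+ ind (u ≟ 0#) ℤ.* ((Q₁ ℤ.+ 1ℤ) ℤ.* Q₁))
    2Θ u = by-cases (u ≟ 0#) (outside? u)
      where
      by-cases : (d₀ : Dec (u ≈ 0#)) (d : Dec (Outside u)) → ℤ.+ 2 ℤ.* Θ k u ≡
        P₁ ℤ.* (ℤ.+ 2 ℤ.* Q₁ ℤ.* ind d ℤ.- (Q₁ ℤ.+ 1ℤ) ℤ.+ ind d₀ ℤ.* ((Q₁ ℤ.+ 1ℤ) ℤ.* Q₁))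
      by-cases (yes u≈0) (yes (u≉0 , _)) = contradiction u≈0 u≉0
      by-cases (yes u≈0) (no _) = ≡.trans (≡.trans (cong (ℤ.+ 2 ℤ.*_) (Θ-≈0 k u≈0))
        (≡.trans (≡.sym (ℤ.*-assoc (ℤ.+ 2) (size (H? k)) P₁)) (≡.trans (cong (ℤ._* P₁)
          (≡.trans (2*size-H k) (cong (ℤ._- 1ℤ) (≡.trans (cong ℤ.+_ q≡Q²) (ℤ.pos-* Q Q))))) (ℤ.*-comm _ P₁))))
        (value-at-0 P₁ Q₁)
      by-cases (no u≉0) (yes (_ , Hu)) = ≡.trans (2Θ-off k u≉0 (λ Hu′ → H-disjoint k Hu′ Hu)) (value-off P₁ Q₁)
      by-cases (no u≉0) (no ¬out) = value-on P₁ Q₁ (Θ k u) (Θ (2 ℕ.+ k) u) (Θ-sum k u≉0)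
        (2Θ-off (2 ℕ.+ k) u≉0 (λ Hu → ¬out (u≉0 , Hu)))

    -- `separated` is U⊥ ∩ H k = ∅ in the form of witnesses, and it makes the sum of Θ over U
    -- vanish. In that sum the linear formula `2Θ` leaves the number of nonzero u ∈ U with u⁻¹
    -- outside `H k` as the only unknown. An upper bound on |U| therefore suffices.
    half-set-duality : {U : Pred Carrier ℓ₁} → IsSubgroup U → (U? : Decidable U) → size U? ℤ.≤ Q₁ →
      (∀ x → H k x → ∃ λ u → U u × T (x · u) ≉0) → ∀ u → U u → u ≉0 → H k (u ⁻¹)
    half-set-duality {U = U} U-sub U? size≤Q separated u Uu u≉0 with H-cover k (⁻¹-≉0 u≉0)
    ... | inj₁ Hu  = Hu
    ... | inj₂ Hu′ = contradiction
      (≡.trans (≡.sym (cong₂ ℤ._*_ (ind-yes (U? u) Uu) (ind-yes (outside? u) (u≉0 , Hu′)))) (all-inside u)) λ ()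
      where
      open ≡.≡-Reasoning renaming (begin_ to begin′_; _∎ to _∎′)
      exchange : ∀ x y z → x ℤ.* (y ℤ.* z) ≡ y ℤ.* (x ℤ.* z)
      exchange x y z = ≡.trans (≡.sym (ℤ.*-assoc x y z)) (≡.trans (cong (ℤ._* z) (ℤ.*-comm x y)) (ℤ.*-assoc y x z))
      weight : Carrier → ℤ
      weight v = ind (U? v) ℤ.* ind (outside? v)
      value : Carrier → ℤ
      value v = ℤ.+ 2 ℤ.* Q₁ ℤ.* ind (outside? v) ℤ.- (Q₁ ℤ.+ 1ℤ) ℤ.+ ind (v ≟ 0#) ℤ.* ((Q₁ ℤ.+ 1ℤ) ℤ.* Q₁)
      ∑UΘ≡0 : ∑ (λ v → ind (U? v) ℤ.* Θ k v) ≡ 0ℤ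
      ∑UΘ≡0 = begin′
        ∑ (λ v → ind (U? v) ℤ.* Θ k v)
          ≡⟨ ∑-cong (λ v → ≡.sym (∑-*ˡ (ind (U? v)) (λ x → indH k x ℤ.* e (v · x)))) ⟩
        ∑ (λ v → ∑ (λ x → ind (U? v) ℤ.* (indH k x ℤ.* e (v · x))))
          ≡⟨ ∑-swap (λ v x → ind (U? v) ℤ.* (indH k x ℤ.* e (v · x))) ⟩
        ∑ (λ x → ∑ (λ v → ind (U? v) ℤ.* (indH k x ℤ.* e (v · x))))
          ≡⟨ ∑-cong (λ x → ≡.trans (∑-cong (λ v → ≡.trans (exchange (ind (U? v)) (indH k x) (e (v · x)))
               (cong (λ z → indH k x ℤ.* (ind (U? v) ℤ.* z)) (e-invariant (*-comm v x)))))
               (∑-*ˡ (indH k x) (λ v → ind (U? v) ℤ.* e (x · v)))) ⟩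
        ∑ (λ x → indH k x ℤ.* ∑ (λ v → ind (U? v) ℤ.* e (x · v)))
          ≡⟨ ∑-zero _ (λ x → vanish x (H? k x)) ⟩
        0ℤ ∎′
        where
        vanish : ∀ x (d : Dec (H k x)) → ind d ℤ.* ∑ (λ v → ind (U? v) ℤ.* e (x · v)) ≡ 0ℤ
        vanish x (no _)   = ℤ.*-zeroˡ (∑ (λ v → ind (U? v) ℤ.* e (x · v)))
        vanish x (yes Hx) with separated x Hx
        ... | v , Uv , ne = cong (1ℤ ℤ.*_) (∑-e-zero U-sub U? Uv ne)
      ∑Uvalue≡0 : ∑ (λ v → ind (U? v) ℤ.* value v) ≡ 0ℤ
      ∑Uvalue≡0 = *-≡0-cancelˡ {P₁} (λ eq → P-1≢0 (≡.trans P-1≡ eq)) (begin′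
        P₁ ℤ.* ∑ (λ v → ind (U? v) ℤ.* value v)
          ≡⟨ ∑-*ˡ P₁ (λ v → ind (U? v) ℤ.* value v) ⟨
        ∑ (λ v → P₁ ℤ.* (ind (U? v) ℤ.* value v))
          ≡⟨ ∑-cong (λ v → ≡.trans (exchange P₁ (ind (U? v)) (value v)) (≡.trans (cong (ind (U? v) ℤ.*_) (≡.sym (2Θ v)))
               (exchange (ind (U? v)) (ℤ.+ 2) (Θ k v)))) ⟩
        ∑ (λ v → ℤ.+ 2 ℤ.* (ind (U? v) ℤ.* Θ k v))
          ≡⟨ ∑-*ˡ (ℤ.+ 2) (λ v → ind (U? v) ℤ.* Θ k v) ⟩
        ℤ.+ 2 ℤ.* ∑ (λ v → ind (U? v) ℤ.* Θ k v)
          ≡⟨ cong (ℤ.+ 2 ℤ.*_) ∑UΘ≡0 ⟩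
        0ℤ ∎′)
      expanded : ℤ.+ 2 ℤ.* Q₁ ℤ.* ∑ weight ℤ.+ (ℤ.- (Q₁ ℤ.+ 1ℤ) ℤ.* size U? ℤ.+ (Q₁ ℤ.+ 1ℤ) ℤ.* Q₁ ℤ.* 1ℤ) ≡ 0ℤ
      expanded = ≡.trans (≡.sym (begin′
        ∑ (λ v → ind (U? v) ℤ.* value v)
          ≡⟨ ∑-cong (λ v → distribute (ind (U? v)) Q₁ (ind (outside? v)) (ind (v ≟ 0#))) ⟩
        ∑ (λ v → ℤ.+ 2 ℤ.* Q₁ ℤ.* weight v ℤ.+ (ℤ.- (Q₁ ℤ.+ 1ℤ) ℤ.* ind (U? v) ℤ.+ (Q₁ ℤ.+ 1ℤ) ℤ.* Q₁ ℤ.* (ind (U? v) ℤ.* ind (v ≟ 0#))))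
          ≡⟨ ≡.trans (∑-+ (λ v → ℤ.+ 2 ℤ.* Q₁ ℤ.* weight v) _) (cong₂ ℤ._+_ (∑-*ˡ (ℤ.+ 2 ℤ.* Q₁) weight)
               (≡.trans (∑-+ (λ v → ℤ.- (Q₁ ℤ.+ 1ℤ) ℤ.* ind (U? v)) _) (cong₂ ℤ._+_ (∑-*ˡ (ℤ.- (Q₁ ℤ.+ 1ℤ)) (λ v → ind (U? v)))
                 (≡.trans (∑-*ˡ ((Q₁ ℤ.+ 1ℤ) ℤ.* Q₁) (λ v → ind (U? v) ℤ.* ind (v ≟ 0#)))
                   (cong (λ z → (Q₁ ℤ.+ 1ℤ) ℤ.* Q₁ ℤ.* z) zero-counted))))) ⟩
        ℤ.+ 2 ℤ.* Q₁ ℤ.* ∑ weight ℤ.+ (ℤ.- (Q₁ ℤ.+ 1ℤ) ℤ.* size U? ℤ.+ (Q₁ ℤ.+ 1ℤ) ℤ.* Q₁ ℤ.* 1ℤ) ∎′)) ∑Uvalue≡0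
        where
        zero-counted : ∑ (λ v → ind (U? v) ℤ.* ind (v ≟ 0#)) ≡ 1ℤ
        zero-counted = ≡.trans (∑-cong (λ v → ℤ.*-comm (ind (U? v)) (ind (v ≟ 0#))))
          (≡.trans (∑-ind-0 (ind-invariant (U-resp U-sub) U?)) (ind-yes (U? 0#) (U-0 U-sub)))
      0<Q : 0 ℕ.< Q
      0<Q = ≡.subst (0 ℕ.<_) (≡.sym Q≡) (s≤s z≤n)
      -- From 2Q · Σ weight = (Q + 1)(|U| - Q) and |U| ≤ Q. The weights are nonnegative, so each of
      -- them is 0.
      ∑weight≤0 : ∑ weight ℤ.≤ 0ℤ
      ∑weight≤0 = ℤ.*-cancelˡ-≤-pos (∑ weight) 0ℤ (ℤ.+ (2 ℕ.* Q)) {{ℤ.positive (ℤ.+<+ (ℕ.*-monoʳ-< 2 0<Q))}}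
        (ℤ.≤-trans (ℤ.≤-reflexive (≡.trans (cong (ℤ._* ∑ weight) (ℤ.pos-* 2 Q)) (isolate Q₁ (∑ weight) (size U?) expanded)))
          (ℤ.≤-trans (ℤ.*-monoˡ-≤-nonNeg (Q₁ ℤ.+ 1ℤ) (ℤ.i≤j⇒i-j≤0 size≤Q))
            (ℤ.≤-reflexive (≡.trans (ℤ.*-zeroʳ (Q₁ ℤ.+ 1ℤ)) (≡.sym (ℤ.*-zeroʳ (ℤ.+ (2 ℕ.* Q))))))))
      all-inside : ∀ v → weight v ≡ 0ℤ
      all-inside = ∑-nonneg-≤0
        (λ x≈y → cong₂ ℤ._*_ (ind-invariant (U-resp U-sub) U? x≈y) (ind-invariant Outside-resp outside? x≈y))
        (λ v → nonneg (U? v) (outside? v)) ∑weight≤0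
        where
        nonneg : ∀ {A : Set ℓ₁} {B : Set ℓ₂} (d : Dec A) (d′ : Dec B) → 0ℤ ℤ.≤ ind d ℤ.* ind d′
        nonneg (yes _) d′ = ≡.subst (0ℤ ℤ.≤_) (≡.sym (ℤ.*-identityˡ (ind d′))) (ind-nonneg d′)
        nonneg (no _)  d′ = ℤ.≤-reflexive (≡.sym (ℤ.*-zeroˡ (ind d′)))

-- Inversion negates exponents modulo 4 and so carries the residues {3, 0} of t to the residues {1,
-- 0} of s.
inverse-residue : ∀ s t → (s ℕ.+ t) % 4 ≡ 0 → (1 ℕ.+ t) % 4 ℕ.< 2 → s % 4 ℕ.< 2
inverse-residue (suc (suc (suc (suc s)))) t eq lt = inverse-residue s t eq lt
inverse-residue s (suc (suc (suc (suc t)))) eq lt = inverse-residue s t (≡.trans (≡.sym (shift s t)) eq) lt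
  where
  shift : ∀ s t → (s ℕ.+ (4 ℕ.+ t)) % 4 ≡ (s ℕ.+ t) % 4
  shift s t = cong (_% 4) (≡.trans (ℕ.+-comm s (4 ℕ.+ t)) (cong (4 ℕ.+_) (ℕ.+-comm t s)))
inverse-residue 0 _ _ _ = s≤s z≤n
inverse-residue 1 _ _ _ = s≤s (s≤s z≤n)
inverse-residue 2 0 ()
inverse-residue 2 1 ()
inverse-residue 2 2 _ (s≤s (s≤s ()))
inverse-residue 2 3 ()
inverse-residue 3 0 ()
inverse-residue 3 1 _ (s≤s (s≤s ()))
inverse-residue 3 2 ()
inverse-residue 3 3 ()

-- The subfield K, the image I and the space V = K ⊕ hK.

module Peisert {c ℓ κ} (F : Field c ℓ) (N : ℕ) (card : HasCardinality (Field.setoid F) (suc N))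
  (g : Field.Carrier F) (g-prim : IsPrimitiveRoot F g)
  (p : ℕ) (p-prime : Prime p) (n : ℕ) (q≡p^1+n : suc N ≡ p ℕ.^ suc n)
  (L : ℕ) (N≡ : ℕ.pred p ℕ.* (suc p ℕ.* (2 ℕ.* L)) ≡ N)
  (r t : ℕ) (q≡Q² : suc N ≡ (p ℕ.^ r ℕ.* p ℕ.^ r) ℕ.* (p ℕ.^ r ℕ.* p ℕ.^ r))
  (Q≡ : p ℕ.^ r ℕ.* p ℕ.^ r ≡ suc (ℕ.pred p ℕ.* suc p ℕ.* t))
  (4∣1+p : 4 ∣ suc p)
  (k-1 M : ℕ) (0<k-1 : 0 ℕ.< k-1) (k≡ : p ℕ.^ r ≡ suc k-1) (M≡ : k-1 ℕ.* M ≡ N)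
  (K : Pred (Field.Carrier F) κ) (K-order : IsSubfieldOfOrder F K (p ℕ.^ r))
  (h : Field.Carrier F) (h∉K : h ∉ K) where

  private
    k Q : ℕ
    k = p ℕ.^ r
    Q = k ℕ.* k

  open HalfSets F N card g g-prim p p-prime n q≡p^1+n L N≡ Q t q≡Q² Q≡ 4∣1+p
  open IsSubfield (proj₁ K-order) renaming (resp to K-resp)

  private
    K-card = proj₂ K-order
    I = setI F k
    V = span F K h

  K-index : ∀ {x} → K x → Fin k
  K-index {x} x∈K = Inverse.to K-card (x , x∈K)

  K-element : Fin k → Carrier
  K-element i = proj₁ (Inverse.from K-card i)

  K-element∈ : ∀ i → K (K-element i)
  K-element∈ i = proj₂ (Inverse.from K-card i)

  K-element-index : ∀ {x} (x∈K : K x) → K-element (K-index x∈K) ≈ x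
  K-element-index x∈K = Inverse.strictlyInverseʳ K-card (_ , x∈K)

  K-index-cong : ∀ {x y} (x∈K : K x) (y∈K : K y) → x ≈ y → K-index x∈K ≡ K-index y∈K
  K-index-cong x∈K y∈K x≈y = Inverse.to-cong K-card x≈y

  K-index-element : ∀ i → K-index (K-element∈ i) ≡ i
  K-index-element = Inverse.strictlyInverseˡ K-card

  K-element-injective : ∀ {i j} → K-element i ≈ K-element j → i ≡ j
  K-element-injective {i} {j} eq = ≡.trans (≡.sym (K-index-element i))
    (≡.trans (K-index-cong (K-element∈ i) (K-element∈ j) eq) (K-index-element j))

  K-fixed : ∀ {x} → K x → x ^ k ≈ x
  K-fixed {x} x∈K with x ≟ 0#
  ... | yes x≈0 = trans (^-congʳ x k≡) (trans (^-≈0 k-1 x≈0) (sym x≈0))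
  ... | no x≉0  = enumeration-power _≟_ K-element x x≉0
    (permutation (mult x∈K) (mult x⁻¹∈K)
      (cancel x∈K x⁻¹∈K (*-inverseʳ x x≉0)) (cancel x⁻¹∈K x∈K (*-inverseˡ x≉0)))
    (λ i → K-element-index _) (K-index 0∈) (K-element-index 0∈)
    (λ i ≈0 → K-element-injective (trans ≈0 (sym (K-element-index 0∈))))
    where
    x⁻¹∈K : K (x ⁻¹)
    x⁻¹∈K = ⁻¹-closed x≉0 x∈K
    mult : ∀ {y} → K y → Fin k → Fin k
    mult y∈K i = K-index (*-closed y∈K (K-element∈ i))
    cancel : ∀ {y z} (y∈K : K y) (z∈K : K z) → y · z ≈ 1# → ∀ i → mult y∈K (mult z∈K i) ≡ i
    cancel {y} {z} y∈K z∈K yz≈1 i = K-element-injective (begin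
      K-element (mult y∈K (mult z∈K i))  ≈⟨ K-element-index _ ⟩
      y · K-element (mult z∈K i)         ≈⟨ *-congˡ (K-element-index _) ⟩
      y · (z · K-element i)              ≈⟨ *-assoc _ _ _ ⟨
      y · z · K-element i                ≈⟨ *-congʳ yz≈1 ⟩
      1# · K-element i                   ≈⟨ *-identityˡ _ ⟩
      K-element i                        ∎)

  -- K already supplies k distinct solutions of zᵏ ≈ z, and there are no others; so K is the fixed
  -- field of x ↦ xᵏ.
  fixed⇒K : ∀ z → z ^ k ≈ z → K z
  fixed⇒K z z-fixed with fixedPoints-exhausted k-1 M {{ℕ.>-nonZero 0<k-1}} k≡ M≡ K-element
    K-element-injective (λ i → K-fixed (K-element∈ i)) z z-fixed
  ... | i , z≈ = K-resp (sym z≈) (K-element∈ i)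

  frobenius-k : IsAdditive (_^ k)
  frobenius-k = frobenius^ r

  T-^k : ∀ x → T (x ^ k) ≈ T x
  T-^k = T-^p^ r

  T-neg : ∀ x → T (- x) ≈ - T x
  T-neg = homo-neg T-additive

  I-subgroup : IsSubgroup I
  I-subgroup = record
    { U-resp = λ { z≈w (x , z≈) → x , trans (sym z≈w) z≈ }
    ; U-0    = 0# , sym (trans (+-congʳ (homo-0 frobenius-k)) (-‿inverseʳ 0#))
    ; U-+    = λ { (x , z≈) (y , w≈) → x + y , trans (+-cong z≈ w≈) (trans (+-interchange _ _ _ _)
                 (+-cong (sym (homo-+ frobenius-k x y)) (⁻¹-∙-comm x y))) }
    ; U-neg  = λ { (x , z≈) → - x , trans (-‿cong z≈) (trans (sym (⁻¹-∙-comm _ _)) (+-congʳ (sym (homo-neg frobenius-k x)))) } }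

  I? : Decidable I
  I? z = exists? (λ x≈y z≈ → trans z≈ (+-cong (^-congˡ k x≈y) (-‿cong x≈y))) (λ x → z ≟ x ^ k + - x)

  I⇒Perp-K : ∀ {z} → I z → Perp K z
  I⇒Perp-K {z} (x , z≈) y y∈K = begin
    T (z · y)                      ≈⟨ T-cong (trans (*-congʳ z≈) (distribʳ _ _ _)) ⟩
    T (x ^ k · y + - x · y)        ≈⟨ homo-+ T-additive _ _ ⟩
    T (x ^ k · y) + T (- x · y)    ≈⟨ +-cong (T-cong (trans (*-congˡ (sym (K-fixed y∈K))) (sym (^-distrib-* x y k))))
                                       (trans (T-cong (sym (-‿distribˡ-* x y))) (T-neg _)) ⟩
    T ((x · y) ^ k) + - T (x · y)  ≈⟨ +-congʳ (T-^k _) ⟩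
    T (x · y) + - T (x · y)        ≈⟨ -‿inverseʳ _ ⟩
    0#                             ∎

  -- By invariance of T under x ↦ xᵏ, T(w(xᵏ - x)) = T((w - wᵏ)xᵏ). Since xᵏ runs through the whole
  -- field, nondegeneracy forces w = wᵏ.
  Perp-I⇒K : ∀ {w} → Perp I w → K w
  Perp-I⇒K {w} w⊥ = fixed⇒K w (sym (x∙y⁻¹≈ε⇒x≈y w (w ^ k) (T-nondegenerate (w + - w ^ k) λ y →
    begin
      T ((w + - w ^ k) · y)                ≈⟨ T-cong (*-congˡ (root y)) ⟩
      T ((w + - w ^ k) · x y ^ k)          ≈⟨ T-cong (distribʳ _ _ _) ⟩
      T (w · x y ^ k + - w ^ k · x y ^ k)  ≈⟨ homo-+ T-additive _ _ ⟩
      T (w · x y ^ k) + T (- w ^ k · x y ^ k)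
        ≈⟨ +-congˡ (trans (T-cong (trans (sym (-‿distribˡ-* _ _)) (-‿cong (sym (^-distrib-* w (x y) k))))) (T-neg _)) ⟩
      T (w · x y ^ k) + - T ((w · x y) ^ k)  ≈⟨ +-congˡ (-‿cong (T-^k _)) ⟩
      T (w · x y ^ k) + - T (w · x y)        ≈⟨ +-congˡ (trans (T-cong (sym (-‿distribʳ-* w (x y)))) (T-neg _)) ⟨
      T (w · x y ^ k) + T (w · - x y)        ≈⟨ homo-+ T-additive _ _ ⟨
      T (w · x y ^ k + w · - x y)            ≈⟨ T-cong (distribˡ _ _ _) ⟨
      T (w · (x y ^ k + - x y))              ≈⟨ w⊥ _ (x y , refl) ⟩
      0#                                     ∎)))
    where
    x : Carrier → Carrier
    -- The exponent is k³, and k⁴ = q, so this is the k-th root of y.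
    x y = y ^ (Q ℕ.* k)
    root : ∀ y → y ≈ x y ^ k
    root y = sym (trans (^-assocʳ y (Q ℕ.* k) k) (trans (^-congʳ y (≡.trans (ℕ.*-assoc Q k k) (≡.sym q≡Q²))) (x^q≈x y)))

  -- I⊥ ⊆ K gives K⊥ ⊆ I⊥⊥ = I. Duality thus takes the place of an additive Hilbert 90, and no
  -- preimage under x ↦ xᵏ - x is constructed.
  Perp-K⇒I : ∀ {z} → Perp K z → I z
  Perp-K⇒I {z} z⊥ = Perp-Perp I-subgroup I? z (λ w w⊥ → z⊥ w (Perp-I⇒K w⊥))

  h≉0 : h ≉0
  h≉0 h≈0 = h∉K (K-resp (sym h≈0) 0∈)

  V-subgroup : IsSubgroup V
  V-subgroup = record
    { U-resp = λ { z≈w (x , y , x∈ , y∈ , z≈) → x , y , x∈ , y∈ , trans (sym z≈w) z≈ }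
    ; U-0    = 0# , 0# , 0∈ , 0∈ , sym (trans (+-congˡ (zeroʳ h)) (+-identityʳ 0#))
    ; U-+    = λ { (x , y , x∈ , y∈ , z≈) (x′ , y′ , x′∈ , y′∈ , w≈) →
        x + x′ , y + y′ , +-closed x∈ x′∈ , +-closed y∈ y′∈ ,
        trans (+-cong z≈ w≈) (trans (+-interchange _ _ _ _) (+-congˡ (sym (distribˡ h y y′)))) }
    ; U-neg  = λ { (x , y , x∈ , y∈ , z≈) → - x , - y , neg-closed x∈ , neg-closed y∈ ,
        trans (-‿cong z≈) (trans (sym (⁻¹-∙-comm _ _)) (+-congˡ (-‿distribʳ-* h y))) } }

  V-element : Fin k → Fin k → Carrier
  V-element i j = K-element i + h · K-element j

  V? : Decidable V
  V? z = map′
    (λ { (i , j , z≈) → K-element i , K-element j , K-element∈ i , K-element∈ j , z≈ })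
    (λ { (x , y , x∈ , y∈ , z≈) → K-index x∈ , K-index y∈ ,
      trans z≈ (sym (+-cong (K-element-index x∈) (*-congˡ (K-element-index y∈)))) })
    (Fin.any? λ i → Fin.any? λ j → z ≟ V-element i j)

  +-swap-neg : ∀ {x y x′ y′} → x + y ≈ x′ + y′ → x + - x′ ≈ y′ + - y
  +-swap-neg {x} {y} {x′} {y′} eq = begin
    x + - x′                     ≈⟨ trans (+-congʳ (sym (+-identityʳ x))) (+-congʳ (+-congˡ (sym (-‿inverseʳ y)))) ⟩
    x + (y + - y) + - x′         ≈⟨ +-congʳ (sym (+-assoc _ _ _)) ⟩
    x + y + - y + - x′           ≈⟨ +-congʳ (+-congʳ eq) ⟩
    x′ + y′ + - y + - x′         ≈⟨ trans (+-comm _ _) (+-congˡ (+-assoc _ _ _)) ⟩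
    - x′ + (x′ + (y′ + - y))     ≈⟨ +-assoc _ _ _ ⟨
    - x′ + x′ + (y′ + - y)       ≈⟨ trans (+-congʳ (-‿inverseˡ x′)) (+-identityˡ _) ⟩
    y′ + - y                     ∎

  -- If y and y′ differed, h would be the quotient (x - x′)/(y′ - y) of elements of K.
  V-unique : ∀ {x y x′ y′} → K x → K y → K x′ → K y′ → x + h · y ≈ x′ + h · y′ → x ≈ x′ × y ≈ y′
  V-unique {x} {y} {x′} {y′} x∈ y∈ x′∈ y′∈ eq = x≈x′ , y≈y′
    where
    y≈y′ : y ≈ y′
    y≈y′ with y ≟ y′
    ... | yes eq′ = eq′
    ... | no y≉y′ = contradiction (K-resp (begin
      (x + - x′) · d ⁻¹           ≈⟨ *-congʳ (+-swap-neg eq) ⟩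
      (h · y′ + - (h · y)) · d ⁻¹ ≈⟨ *-congʳ (x[y-z]≈xy-xz h y′ y) ⟨
      h · d · d ⁻¹                ≈⟨ *-assoc _ _ _ ⟩
      h · (d · d ⁻¹)              ≈⟨ *-congˡ (*-inverseʳ d d≉0) ⟩
      h · 1#                      ≈⟨ *-identityʳ h ⟩
      h                           ∎)
      (*-closed (+-closed x∈ (neg-closed x′∈)) (⁻¹-closed d≉0 (+-closed y′∈ (neg-closed y∈))))) h∉K
      where
      d = y′ + - y
      d≉0 : d ≉0
      d≉0 d≈0 = y≉y′ (sym (x∙y⁻¹≈ε⇒x≈y y′ y d≈0))
    x≈x′ : x ≈ x′
    x≈x′ = x∙y⁻¹≈ε⇒x≈y x x′ (trans (+-swap-neg eq) (x≈y⇒x∙y⁻¹≈ε (*-congˡ (sym y≈y′))))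

  V-card : HasCardinality (subsetoid setoid V) Q
  V-card = record
    { to        = λ { (z , x , y , x∈ , y∈ , z≈) → combine (K-index x∈) (K-index y∈) }
    ; from      = from
    ; to-cong   = λ { {z , x , y , x∈ , y∈ , z≈} {w , x′ , y′ , x′∈ , y′∈ , w≈} z≈w →
        let x≈x′ , y≈y′ = V-unique x∈ y∈ x′∈ y′∈ (trans (sym z≈) (trans z≈w w≈))
        in cong₂ combine (K-index-cong x∈ x′∈ x≈x′) (K-index-cong y∈ y′∈ y≈y′) }
    ; from-cong = λ { ≡.refl → refl }
    ; inverse   = (λ { {s} {z , x , y , x∈ , y∈ , z≈} z≈from → to-from s x∈ y∈ (trans (sym z≈) z≈from) })
                , (λ { {z , x , y , x∈ , y∈ , z≈} ≡.refl → trans (reflexive (cong (λ { (i , j) → V-element i j })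
                    (remQuot-combine (K-index x∈) (K-index y∈))))
                    (sym (trans z≈ (sym (+-cong (K-element-index x∈) (*-congˡ (K-element-index y∈)))))) })
    }
    where
    from : Fin Q → Σ Carrier V
    from s = let i , j = remQuot {k} k s in
      V-element i j , K-element i , K-element j , K-element∈ i , K-element∈ j , refl
    to-from : ∀ s {x y} (x∈ : K x) (y∈ : K y) → x + h · y ≈ proj₁ (from s) → combine (K-index x∈) (K-index y∈) ≡ s
    to-from s x∈ y∈ eq =
      let i , j = remQuot {k} k s
          x≈ , y≈ = V-unique x∈ y∈ (K-element∈ i) (K-element∈ j) eq
      in ≡.trans (cong₂ combine (≡.trans (K-index-cong x∈ (K-element∈ i) x≈) (K-index-element i))
           (≡.trans (K-index-cong y∈ (K-element∈ j) y≈) (K-index-element j)))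
         (combine-remQuot {k} k s)

  size-V : size V? ≡ ℤ.+ Q
  size-V = size-enumeration (U-resp V-subgroup) V? (λ s → proj₁ (Inverse.from V-card s))
    (λ {s} {s′} eq → ≡.trans (≡.sym (Inverse.strictlyInverseˡ V-card s))
      (≡.trans (Inverse.to-cong V-card {Inverse.from V-card s} {Inverse.from V-card s′} eq) (Inverse.strictlyInverseˡ V-card s′)))
    (λ s → proj₂ (Inverse.from V-card s))
    (λ x Vx → Inverse.to V-card (x , Vx) , sym (Inverse.strictlyInverseʳ V-card (x , Vx)))

  V⊥? : Decidable (Perp V)
  V⊥? = perp? V-subgroup V?

  size-V⊥ : size V⊥? ≡ ℤ.+ Q
  size-V⊥ = ℤ.*-cancelˡ-≡ (ℤ.+ Q) (size V⊥?) (ℤ.+ Q) {{ℤ.≢-nonZero Q≢0}}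
    (≡.trans (cong (ℤ._* size V⊥?) (≡.sym size-V)) (≡.trans (size-perp V-subgroup V?) (≡.trans (cong ℤ.+_ q≡Q²) (ℤ.pos-* Q Q))))
    where
    Q≢0 : ℤ.+ Q ≢ 0ℤ
    Q≢0 eq with () ← ≡.trans (≡.sym (ℤ.+-injective eq)) Q≡

  -- Testing z against K and against hK separately puts both z and hz into K⊥.
  Perp-V⇒I : ∀ {z} → Perp V z → (I ∩ scale F (h ⁻¹) I) z
  Perp-V⇒I {z} z⊥ =
    Perp-K⇒I (λ x x∈K → z⊥ x (x , 0# , x∈K , 0∈ , sym (trans (+-congˡ (zeroʳ h)) (+-identityʳ x)))) ,
    h · z , Perp-K⇒I (λ y y∈K → trans (T-cong (trans (*-congʳ (*-comm h z)) (*-assoc z h y)))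
      (z⊥ (h · y) (0# , y , 0∈ , y∈K , sym (+-identityˡ _)))) ,
    sym (trans (sym (*-assoc _ _ _)) (trans (*-congʳ (*-inverseˡ h≉0)) (*-identityˡ z)))

  I⇒Perp-V : ∀ {z} → (I ∩ scale F (h ⁻¹) I) z → Perp V z
  I⇒Perp-V {z} (z∈I , w , w∈I , z≈) v (x , y , x∈K , y∈K , v≈) = begin
    T (z · v)                   ≈⟨ T-cong (trans (*-congˡ v≈) (distribˡ _ _ _)) ⟩
    T (z · x + z · (h · y))     ≈⟨ homo-+ T-additive _ _ ⟩
    T (z · x) + T (z · (h · y)) ≈⟨ +-cong (I⇒Perp-K z∈I x x∈K) (trans (T-cong (trans (sym (*-assoc z h y)) (*-congʳ zh≈w))) (I⇒Perp-K w∈I y y∈K)) ⟩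
    0# + 0#                     ≈⟨ +-identityʳ 0# ⟩
    0#                          ∎
    where
    zh≈w : z · h ≈ w
    zh≈w = trans (*-comm z h) (trans (*-congˡ z≈) (trans (sym (*-assoc _ _ _)) (trans (*-congʳ (*-inverseʳ h h≉0)) (*-identityˡ w))))

  -- B and adjacency as unions of quartic classes, and the two implications.

  private
    B = setB F (suc N) g

  B⇒H : ∀ {x} → B x → H 1 x
  B⇒H (inj₁ (i , _ , _ , x≈)) = 4 ℕ.* i ℕ.+ 0 , x≈ ,
    ≡.subst (ℕ._< 2) (≡.sym (≡.trans (cong (_% 4) (cong suc (ℕ.+-identityʳ (4 ℕ.* i)))) (+-4∣-% 1 (m∣m*n i)))) (s≤s (s≤s z≤n))
  B⇒H (inj₂ (i , _ , _ , x≈)) = 4 ℕ.* i ℕ.+ 3 , x≈ ,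
    ≡.subst (ℕ._< 2) (≡.sym (≡.trans (cong (_% 4) (cong suc (ℕ.+-comm (4 ℕ.* i) 3))) (+-4∣-% 4 (m∣m*n i)))) (s≤s z≤n)

  -- The powers of g⁴ have period (q - 1)/4, so the bounds on k in B select one full period of
  -- representatives.
  H⇒B : ∀ {x} → H 1 x → B x
  H⇒B {x} (j , x≈ , lt) = by-residue (j % 4) ≡.refl
    where
    n₄ = N / 4
    N≡n₄*4 : N ≡ n₄ ℕ.* 4
    N≡n₄*4 = ≡.sym (m/n*n≡m 4∣N)
    instance
      n₄≢0 : NonZero n₄
      n₄≢0 = ℕ.≢-nonZero λ eq → ℕ.≢-nonZero⁻¹ N (≡.trans N≡n₄*4 (cong (ℕ._* 4) eq))
    g^4n₄≈1 : g ^ (n₄ ℕ.* 4) ≈ 1#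
    g^4n₄≈1 = trans (^-congʳ g (≡.sym N≡n₄*4)) g^N≈1
    reduced : ∀ i → ∃ λ i′ → 1 ℕ.≤ i′ × i′ ℕ.≤ n₄ × g ^ (4 ℕ.* i) ≈ g ^ (4 ℕ.* i′)
    reduced i = go (i % n₄) ≡.refl
      where
      period : ∀ m → g ^ (4 ℕ.* (m ℕ.* n₄)) ≈ 1#
      period m = ^-∣ {g} {n₄ ℕ.* 4} (divides m (≡.trans (ℕ.*-comm 4 (m ℕ.* n₄)) (ℕ.*-assoc m n₄ 4))) g^4n₄≈1
      split : g ^ (4 ℕ.* i) ≈ g ^ (4 ℕ.* (i % n₄))
      split = begin
        g ^ (4 ℕ.* i)                                         ≈⟨ ^-congʳ g (cong (4 ℕ.*_) (m≡m%n+[m/n]*n i n₄)) ⟩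
        g ^ (4 ℕ.* (i % n₄ ℕ.+ i / n₄ ℕ.* n₄))                ≈⟨ ^-congʳ g (ℕ.*-distribˡ-+ 4 (i % n₄) (i / n₄ ℕ.* n₄)) ⟩
        g ^ (4 ℕ.* (i % n₄) ℕ.+ 4 ℕ.* (i / n₄ ℕ.* n₄))        ≈⟨ ^-homo-* g (4 ℕ.* (i % n₄)) _ ⟩
        g ^ (4 ℕ.* (i % n₄)) · g ^ (4 ℕ.* (i / n₄ ℕ.* n₄))    ≈⟨ trans (*-congˡ (period (i / n₄))) (*-identityʳ _) ⟩
        g ^ (4 ℕ.* (i % n₄))                                  ∎
      go : ∀ m → i % n₄ ≡ m → ∃ λ i′ → 1 ℕ.≤ i′ × i′ ℕ.≤ n₄ × g ^ (4 ℕ.* i) ≈ g ^ (4 ℕ.* i′)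
      -- The range in B starts at 1, so remainder 0 is represented by the upper end.
      go zero    eq = n₄ , ℕ.>-nonZero⁻¹ n₄ , ℕ.≤-refl ,
        trans split (trans (^-congʳ g (cong (4 ℕ.*_) eq)) (sym (trans (^-congʳ g (ℕ.*-comm 4 n₄)) g^4n₄≈1)))
      go (suc m) eq = suc m , s≤s z≤n , ≡.subst (ℕ._≤ n₄) eq (m%n≤n i n₄) ,
        trans split (^-congʳ g (cong (4 ℕ.*_) eq))
    x≈split : ∀ m → j % 4 ≡ m → x ≈ g ^ (4 ℕ.* (j / 4)) · g ^ m
    x≈split m eq = trans x≈ (trans (^-congʳ g (≡.trans (m≡m%n+[m/n]*n j 4) (≡.trans (cong (ℕ._+ j / 4 ℕ.* 4) eq)
      (≡.trans (ℕ.+-comm m (j / 4 ℕ.* 4)) (cong (ℕ._+ m) (ℕ.*-comm (j / 4) 4)))))) (^-homo-* g (4 ℕ.* (j / 4)) m))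
    member : ∀ m → j % 4 ≡ m → ∃ λ i → 1 ℕ.≤ i × i ℕ.≤ n₄ × x ≈ g ^ (4 ℕ.* i ℕ.+ m)
    member m eq = let i , 1≤i , i≤n₄ , g≈ = reduced (j / 4) in
      i , 1≤i , i≤n₄ , trans (x≈split m eq) (trans (*-congʳ g≈) (sym (^-homo-* g (4 ℕ.* i) m)))
    lt′ : ∀ m → j % 4 ≡ m → (1 ℕ.+ m) % 4 ℕ.< 2
    lt′ m eq = ≡.subst (ℕ._< 2) (≡.trans (%-distribˡ-+ 1 j 4) (cong (λ z → (1 ℕ.+ z) % 4) eq)) lt
    by-residue : ∀ m → j % 4 ≡ m → B x
    by-residue 0 eq = inj₁ (member 0 eq)
    by-residue 1 eq with lt′ 1 eq
    ... | s≤s (s≤s ())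
    by-residue 2 eq with lt′ 2 eq
    ... | s≤s (s≤s ())
    by-residue 3 eq = inj₂ (member 3 eq)
    by-residue (suc (suc (suc (suc m)))) eq = contradiction (≡.subst (ℕ._< 4) eq (m%n<n j 4)) (ℕ.≤⇒≯ (ℕ.m≤m+n 4 m))

  PeisertSet⇒H : ∀ {x} → PeisertSet F g x → H 0 x
  PeisertSet⇒H (j , inj₁ eq , x≈) = j , x≈ , ≡.subst (ℕ._< 2) (≡.sym eq) (s≤s z≤n)
  PeisertSet⇒H (j , inj₂ eq , x≈) = j , x≈ , ≡.subst (ℕ._< 2) (≡.sym eq) (s≤s (s≤s z≤n))

  H⇒PeisertSet : ∀ {x} → H 0 x → PeisertSet F g x
  H⇒PeisertSet (j , x≈ , lt) = j , residue (j % 4) lt , x≈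
    where
    residue : ∀ m → m ℕ.< 2 → m ≡ 0 ⊎ m ≡ 1
    residue 0 _ = inj₁ ≡.refl
    residue 1 _ = inj₂ ≡.refl
    residue (suc (suc _)) (s≤s (s≤s ()))

  private
    Adj = PeisertAdj F g
    Disjoint = Empty (I ∩ scale F (h ⁻¹) I ∩ B)

  clique⇒H : IsClique setoid Adj V → ∀ {x} → V x → x ≉0 → H 0 x
  clique⇒H clique {x} Vx x≉0 = H-resp 0 (trans (+-congˡ ε⁻¹≈ε) (+-identityʳ x))
    (PeisertSet⇒H (proj₂ (clique Vx (U-0 V-subgroup) x≉0)))

  H⇒clique : (∀ {x} → V x → x ≉0 → H 0 x) → IsClique setoid Adj V
  H⇒clique V⊆H Vx Vy x≉y = x≉y , H⇒PeisertSet (V⊆H (U-+ V-subgroup Vx (U-neg V-subgroup Vy))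
    (λ eq → x≉y (x∙y⁻¹≈ε⇒x≈y _ _ eq)))

  inverse-exponents : ∀ {x} → x ≉0 → ∀ s t → x ≈ g ^ s → x ⁻¹ ≈ g ^ t → (s ℕ.+ t) % 4 ≡ 0
  inverse-exponents {x} x≉0 s t x≈ x⁻¹≈ = g^≈⇒%4≡ (s ℕ.+ t) 0
    (trans (^-homo-* g s t) (trans (*-cong (sym x≈) (sym x⁻¹≈)) (*-inverseʳ x x≉0)))

  -- Nonzero elements of V⊥⊥ = V lie in `H 0`, so V⊥⊥ misses `H 2` and the duality applies to V⊥
  -- with k = 2. For z ∈ V⊥ it puts z⁻¹ at exponents 2, 3, hence z at exponents 2, 1, which B
  -- avoids.
  clique⇒disjoint : IsClique setoid Adj V → Disjoint
  clique⇒disjoint clique z (z∈I , z∈h⁻¹I , z∈B) = conflict (B⇒H z∈B , half-set-duality 2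
    (Perp-subgroup V) V⊥? (ℤ.≤-reflexive size-V⊥) separated z (I⇒Perp-V (z∈I , z∈h⁻¹I)) z≉0)
    where
    z≉0 : z ≉0
    z≉0 = H-≉0 1 (B⇒H z∈B)
    separated : ∀ x → H 2 x → ∃ λ u → Perp V u × T (x · u) ≉0
    separated x Hx = ¬Perp⇒∃ (Perp-subgroup V) V⊥? λ x⊥⊥ →
      H-disjoint 0 (clique⇒H clique (Perp-Perp V-subgroup V? x x⊥⊥) (H-≉0 2 Hx)) Hx
    conflict : ¬ (H 1 z × H 2 (z ⁻¹))
    conflict ((s , z≈ , lt) , (t , z⁻¹≈ , lt′)) with %4<2-flip (1 ℕ.+ s)
    ... | inj₂ (¬lt , _) = ¬lt lt
    -- The shifts 3 + s and 1 + t still add up to 0 modulo 4 and move the exponents 2, 3 of z⁻¹ to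
    -- 3, 0, the residues that `inverse-residue` handles.
    ... | inj₁ (_ , ¬lt) = ¬lt (inverse-residue (3 ℕ.+ s) (1 ℕ.+ t)
      (≡.trans (cong (λ m → (3 ℕ.+ m) % 4) (ℕ.+-suc s t)) (inverse-exponents z≉0 s t z≈ z⁻¹≈)) lt′)

  -- Here k = 1, because `H 1` is B. The duality places v⁻¹ at exponents 0, 3, so v has exponent 0
  -- or 1, as adjacency to 0 requires.
  disjoint⇒clique : Disjoint → IsClique setoid Adj V
  disjoint⇒clique disjoint = H⇒clique λ {v} Vv v≉0 → invert v≉0
    (half-set-duality 1 V-subgroup V? (ℤ.≤-reflexive size-V) separated v Vv v≉0)
    where
    separated : ∀ x → H 1 x → ∃ λ u → V u × T (x · u) ≉0
    separated x Hx = ¬Perp⇒∃ V-subgroup V? λ x⊥ →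
      let x∈I , x∈h⁻¹I = Perp-V⇒I x⊥ in disjoint x (x∈I , x∈h⁻¹I , H⇒B Hx)
    invert : ∀ {v} → v ≉0 → H 1 (v ⁻¹) → H 0 v
    invert v≉0 (t , v⁻¹≈ , lt) = log v≉0 , g^log v≉0 ,
      inverse-residue (log v≉0) t (inverse-exponents v≉0 (log v≉0) t (g^log v≉0) v⁻¹≈) lt

  -- The graph is isomorphic to its complement by x ↦ g² x, so (x , y) ↦ x + g² y
  -- is injective on C × C for every clique C, and |C|² ≤ q.
  clique-bound : ∀ {ℓ₁} (C : Pred Carrier ℓ₁) m → IsClique setoid Adj C →
    HasCardinality (subsetoid setoid C) m → m ℕ.≤ Q
  clique-bound C m clique C-card = ℕ.≮⇒≥ λ Q<m → ℕ.<⇒≱ (ℕ.*-mono-< Q<m Q<m)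
    (≡.subst (m ℕ.* m ℕ.≤_) q≡Q² (Fin.injective⇒≤ {f = pair} pair-injective))
    where
    member : Fin m → Carrier
    member i = proj₁ (Inverse.from C-card i)
    member-injective : ∀ {i j} → member i ≈ member j → i ≡ j
    member-injective {i} {j} eq = ≡.trans (≡.sym (Inverse.strictlyInverseˡ C-card i))
      (≡.trans (Inverse.to-cong C-card {Inverse.from C-card i} {Inverse.from C-card j} eq) (Inverse.strictlyInverseˡ C-card j))
    difference : ∀ {i j} → ¬ member i ≈ member j → H 0 (member i + - member j)
    difference {i} {j} ne = PeisertSet⇒H (proj₂ (clique (proj₂ (Inverse.from C-card i)) (proj₂ (Inverse.from C-card j)) ne))
    sum-injective : ∀ i j i′ j′ → member i + g ^ 2 · member j ≈ member i′ + g ^ 2 · member j′ → i ≡ i′ × j ≡ j′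
    sum-injective i j i′ j′ eq with member i ≟ member i′ | member j′ ≟ member j
    ... | _ | yes j′≈j = member-injective (x∙y⁻¹≈ε⇒x≈y _ _ (trans (+-swap-neg eq) (x≈y⇒x∙y⁻¹≈ε (*-congˡ j′≈j)))) ,
      member-injective (sym j′≈j)
    ... | yes i≈i′ | no j′≉j = contradiction (x∙y⁻¹≈ε⇒x≈y _ _ (*-cancelˡ (^-≉0 g≉0 2)
      (trans (x[y-z]≈xy-xz _ _ _) (trans (sym (+-swap-neg eq)) (trans (x≈y⇒x∙y⁻¹≈ε i≈i′) (sym (zeroʳ _))))))) j′≉j
    ... | no i≉i′ | no j′≉j = ⊥-elim (H-disjoint 0 (difference i≉i′)
      (H-resp 2 (trans (x[y-z]≈xy-xz _ _ _) (sym (+-swap-neg eq))) (shifted (difference j′≉j))))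
      where
      shifted : ∀ {x} → H 0 x → H 2 (g ^ 2 · x)
      shifted (j , x≈ , lt) = 2 ℕ.+ j , trans (*-congˡ x≈) (sym (^-homo-* g 2 j)) , lt
    pair : Fin (m ℕ.* m) → Fin (suc N)
    pair s = let i , j = remQuot {m} m s in index (member i + g ^ 2 · member j)
    pair-injective : ∀ {s s′} → pair s ≡ pair s′ → s ≡ s′
    pair-injective {s} {s′} eq =
      let i , j = remQuot {m} m s
          i′ , j′ = remQuot {m} m s′
          i≡i′ , j≡j′ = sum-injective i j i′ j′ (index-injective eq)
      in ≡.trans (≡.sym (combine-remQuot {m} m s)) (≡.trans (cong₂ combine i≡i′ j≡j′) (combine-remQuot {m} m s′))

  maximumClique⇒clique : IsMaximumClique setoid Adj V → IsClique setoid Adj V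
  maximumClique⇒clique (clique , _) = clique

  clique⇒maximumClique : IsClique setoid Adj V → IsMaximumClique setoid Adj V
  clique⇒maximumClique clique = clique , Q , V-card , clique-bound

  clique⇔disjoint : (IsClique setoid Adj V ⇔ Disjoint) × (IsMaximumClique setoid Adj V ⇔ Disjoint)
  clique⇔disjoint = mk⇔ clique⇒disjoint disjoint⇒clique , mk⇔ to from
    where
    to : IsMaximumClique setoid Adj V → Disjoint
    to maximum = clique⇒disjoint (maximumClique⇒clique maximum)
    from : Disjoint → IsMaximumClique setoid Adj V
    from disjoint = clique⇒maximumClique (disjoint⇒clique disjoint)

-- The numerical data for q = p⁴ʳ and the theorem.

-- Here N = q - 1 and pʳ * pʳ = √q.
record Arithmetic (p r : ℕ) : Set where
  field
    N n L t k-1 M : ℕ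
    q≡1+N  : p ℕ.^ (4 ℕ.* r) ≡ suc N
    q≡p^1+n : suc N ≡ p ℕ.^ suc n
    N≡     : ℕ.pred p ℕ.* (suc p ℕ.* (2 ℕ.* L)) ≡ N
    q≡Q²   : suc N ≡ (p ℕ.^ r ℕ.* p ℕ.^ r) ℕ.* (p ℕ.^ r ℕ.* p ℕ.^ r)
    Q≡     : p ℕ.^ r ℕ.* p ℕ.^ r ≡ suc (ℕ.pred p ℕ.* suc p ℕ.* t)
    4∣1+p  : 4 ∣ suc p
    0<k-1  : 0 ℕ.< k-1
    k≡     : p ℕ.^ r ≡ suc k-1
    M≡     : k-1 ℕ.* M ≡ N

arithmetic : ∀ p r → 0 ℕ.< r → p % 4 ≡ 3 → Arithmetic p r
arithmetic p r@(suc r-1) _ p%4≡3 = go (p / 4) (≡.trans (m≡m%n+[m/n]*n p 4) (cong (ℕ._+ p / 4 ℕ.* 4) p%4≡3))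
  where
  open ℕ-Solver using (solve; _:+_; _:*_; _:=_; con)
  -- With p = 3 + 4m the predecessors of p and its powers become polynomials in m, so the
  -- factorisations are polynomial identities without subtraction.
  go : ∀ m → p ≡ 3 ℕ.+ m ℕ.* 4 → Arithmetic p r
  go m ≡.refl = record
    { N = N ; n = r-1 ℕ.+ 3 ℕ.* r ; L = w ℕ.* proj₁ fourth ; t = proj₁ square
    ; k-1 = ℕ.pred k ; M = proj₁ k-power
    ; q≡1+N = q≡1+N ; q≡p^1+n = ≡.sym q≡1+N
    ; N≡ = ℕ.suc-injective (≡.trans (cong suc (solve 4 (λ x y w z → x :* (y :* (con 2 :* (w :* z))) := x :* (y :* (con 2 :* w)) :* z)
        ≡.refl (2 ℕ.+ m ℕ.* 4) (suc p) w (proj₁ fourth)))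
        (≡.trans (≡.sym (proj₂ fourth)) (≡.trans (cong (ℕ._^ r) (≡.sym p^4≡)) (≡.trans (ℕ.^-*-assoc p 4 r) q≡1+N))))
    ; q≡Q² = ≡.trans (≡.sym q≡1+N) q≡k^4
    ; Q≡ = ≡.trans (≡.sym (≡.trans (cong (ℕ._^ r) (≡.sym p^2≡)) (≡.trans (ℕ.^-*-assoc p 2 r)
        (≡.trans (ℕ.^-distribˡ-+-* p r (r ℕ.+ 0)) (cong (λ z → k ℕ.* p ℕ.^ z) (ℕ.+-identityʳ r)))))) (proj₂ square)
    ; 4∣1+p = divides (suc m) ≡.refl
    ; 0<k-1 = ℕ.s≤s⁻¹ (≡.subst (1 ℕ.<_) k≡ (ℕ.^-monoʳ-< p (s≤s (s≤s z≤n)) {0} {r} (s≤s z≤n)))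
    ; k≡ = k≡
    ; M≡ = ℕ.suc-injective (≡.trans (≡.sym (proj₂ k-power)) (≡.trans (cong (ℕ._^ 4) (≡.sym k≡))
        (≡.trans (≡.trans (solve 1 (λ x → x :* (x :* (x :* (x :* con 1))) := x :* x :* (x :* x)) ≡.refl k) (≡.sym q≡k^4)) q≡1+N)))
    }
    where
    k = p ℕ.^ r
    N = ℕ.pred (p ℕ.^ (4 ℕ.* r))
    -- This is (p² + 1)/2, so that p⁴ - 1 = (p - 1)(p + 1) · 2w; the factor 2 split off here is the
    -- one in 2(p² - 1) dividing q - 1.
    w = 5 ℕ.+ 12 ℕ.* m ℕ.+ 8 ℕ.* (m ℕ.* m)
    q≡1+N : p ℕ.^ (4 ℕ.* r) ≡ suc N
    q≡1+N = ≡.sym (ℕ.suc-pred (p ℕ.^ (4 ℕ.* r)) {{ℕ.m^n≢0 p (4 ℕ.* r)}})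
    k≡ : k ≡ suc (ℕ.pred k)
    k≡ = ≡.sym (ℕ.suc-pred k {{ℕ.m^n≢0 p r}})
    p^4≡ : p ℕ.^ 4 ≡ suc (ℕ.pred p ℕ.* (suc p ℕ.* (2 ℕ.* w)))
    p^4≡ = solve 1 (λ m → let p = con 3 :+ m :* con 4 in p :* (p :* (p :* (p :* con 1))) :=
      con 1 :+ (con 2 :+ m :* con 4) :* ((con 4 :+ m :* con 4) :* (con 2 :* (con 5 :+ con 12 :* m :+ con 8 :* (m :* m))))) ≡.refl m
    p^2≡ : p ℕ.^ 2 ≡ suc (ℕ.pred p ℕ.* suc p)
    p^2≡ = solve 1 (λ m → let p = con 3 :+ m :* con 4 in p :* (p :* con 1) :=
      con 1 :+ (con 2 :+ m :* con 4) :* (con 4 :+ m :* con 4)) ≡.refl m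
    fourth = 1+^ (ℕ.pred p ℕ.* (suc p ℕ.* (2 ℕ.* w))) r
    square = 1+^ (ℕ.pred p ℕ.* suc p) r
    k-power = 1+^ (ℕ.pred k) 4
    q≡k^4 : p ℕ.^ (4 ℕ.* r) ≡ (k ℕ.* k) ℕ.* (k ℕ.* k)
    q≡k^4 = ≡.trans (cong (p ℕ.^_) (solve 1 (λ r → con 4 :* r := (r :+ r) :+ (r :+ r)) ≡.refl r))
      (≡.trans (ℕ.^-distribˡ-+-* p (r ℕ.+ r) (r ℕ.+ r)) (cong₂ ℕ._*_ (ℕ.^-distribˡ-+-* p r r) (ℕ.^-distribˡ-+-* p r r)))

open import Data.Nat.Base using (_^_; _*_; _<_)

theorem5p7 : ∀ {c ℓ k} (r p q : ℕ) → 0 < r → Prime p → p % 4 ≡ 3 → q ≡ p ^ (4 * r) →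
    (F : Field c ℓ) → let module F = Field F in
    HasCardinality F.setoid q →
    (g : F.Carrier) → IsPrimitiveRoot F g →
    (K : Pred F.Carrier k) → IsSubfieldOfOrder F K (p ^ r) →
    (h : F.Carrier) → h ∉ K →
    let I = setI F (p ^ r)
        B = setB F q g
        V = span F K h
    in (IsClique F.setoid (PeisertAdj F g) V ⇔ Empty (I ∩ scale F (h F.⁻¹) I ∩ B))
     × (IsMaximumClique F.setoid (PeisertAdj F g) V ⇔ Empty (I ∩ scale F (h F.⁻¹) I ∩ B))
theorem5p7 r p q 0<r p-prime p%4≡3 q≡p^4r F card g g-prim K K-order h h∉K
  with arithmetic p r 0<r p%4≡3
... | A with ≡.trans q≡p^4r (Arithmetic.q≡1+N A)
... | ≡.refl = Peisert.clique⇔disjoint F N card g g-prim p p-prime n q≡p^1+n L N≡ r t q≡Q² Q≡ 4∣1+p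
  k-1 M 0<k-1 k≡ M≡ K K-order h h∉K
  where open Arithmetic A
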